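{- Let $T$ be a well-covered tree of order $2n$ such that $T\not\cong P_n^{\ast}$ and $T\not\cong S_n^{\ast}$. Then $P_n^{\ast}\prec T\prec S_n^{\ast}$.
   Context: All graphs are finite, simple and undirected. A graph is well-covered if all of its maximal independent sets have the same size. The independence polynomial of a graph $G$ is $I(G,x)=\sum_{k\ge 0} i_kx^k$, where $i_k$ is the number of independent sets of size $k$ in $G$. It is known that the root of $I(G,x)$ of smallest modulus is real and lies in $[-1,0)$; it is denoted $\xi(G)$ (equivalently, the largest real root of $I(G,x)$). For graphs $G,H$, write $H\preceq G$ if and only if $I(H,x)\ge I(G,x)$ for all $x\in[\xi(G),0]$, and $H\prec G$ if and only if $H\preceq G$ and $I(H,x)\neq I(G,x)$ as polynomials. For a graph $G$, the graph star $G^{\ast}$ is obtained from $G$ by attaching, for each vertex $v$ of $G$, a new vertex $v^{\ast}$ joined by an edge to $v$ only. $P_n$ and $S_n$ denote the path and the star ($S_n=K_{1,n-1}$) of order $n$. -}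

module Defs where

open import Algebra.Bundles.Raw using (RawSemiring)
import Algebra.Definitions.RawSemiring as RawSemiringDefinitions
open import Data.Empty using (⊥)
open import Data.Fin.Base using (Fin; zero; suc; toℕ; fromℕ; inject₁; splitAt)
import Data.Fin.Properties as Fin
open import Data.Fin.Subset using (Subset; inside; outside; _∈_; _⊆_; ∣_∣)
open import Data.Fin.Subset.Properties using (_∈?_)
open import Data.List.Base using (List; []; _∷_; _++_; map; filter; length)
open import Data.Nat.Base as ℕ using (ℕ; zero; suc)
import Data.Nat.Properties as ℕ
open import Data.Product.Base using (Σ; ∃; _×_; _,_; proj₁; proj₂)
open import Data.Rational.Base as ℚ using (ℚ; 0ℚ; 1ℚ; ½)
import Data.Rational.Properties as ℚ
open import Data.Rational.Solver using (module +-*-Solver)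
open import Data.Sum.Base using (_⊎_; inj₁; inj₂; swap)
open import Data.Vec.Base using ([]; _∷_)
open import Function.Base using (_on_)
open import Function.Bundles using (_↔_; _⇔_; Inverse)
open import Level using (0ℓ)
open import Relation.Binary.Construct.Closure.ReflexiveTransitive using (Star)
open import Relation.Binary.Core using (Rel)
open import Relation.Binary.Definitions using (Decidable; Symmetric)
open import Relation.Binary.PropositionalEquality
  using (_≡_; _≢_; refl; sym; trans; cong; cong₂; subst)
open import Relation.Nullary using (¬_; Dec; yes; no)
open import Relation.Nullary.Decidable using (_×-dec_; _⊎-dec_; _→-dec_; ¬?)

------------------------------------------------------------------------
-- Real numbers: Cauchy sequences of rationals, up to null sequences

IsCauchy : (ℕ → ℚ) → Set
IsCauchy s = ∀ ε → 0ℚ ℚ.< ε →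
  ∃ λ N → ∀ m n → N ℕ.≤ m → N ℕ.≤ n → ℚ.∣ s m ℚ.- s n ∣ ℚ.< ε

record ℝ : Set where
  constructor mkℝ
  field
    seq    : ℕ → ℚ
    cauchy : IsCauchy seq

open ℝ public

infix 4 _≃ᵣ_ _≤ᵣ_

_≃ᵣ_ : Rel ℝ 0ℓ
x ≃ᵣ y = ∀ ε → 0ℚ ℚ.< ε →
  ∃ λ N → ∀ n → N ℕ.≤ n → ℚ.∣ seq x n ℚ.- seq y n ∣ ℚ.< ε

_≤ᵣ_ : Rel ℝ 0ℓ
x ≤ᵣ y = ∀ ε → 0ℚ ℚ.< ε →
  ∃ λ N → ∀ n → N ℕ.≤ n → seq x n ℚ.< seq y n ℚ.+ ε

fromℚ : ℚ → ℝ
fromℚ q = mkℝ (λ _ → q) λ ε 0<ε → 0 , λ _ _ _ _ →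
  subst (λ t → ℚ.∣ t ∣ ℚ.< ε) (sym (ℚ.+-inverseʳ q)) 0<ε

0ᵣ 1ᵣ : ℝ
0ᵣ = fromℚ 0ℚ
1ᵣ = fromℚ 1ℚ

private
  halves : ∀ ε → ½ ℚ.* ε ℚ.+ ½ ℚ.* ε ≡ ε
  halves ε = trans (sym (ℚ.*-distribʳ-+ ε ½ ½)) (ℚ.*-identityˡ ε)

  half-pos : ∀ ε → 0ℚ ℚ.< ε → 0ℚ ℚ.< ½ ℚ.* ε
  half-pos ε 0<ε = subst (ℚ._< ½ ℚ.* ε) (ℚ.*-zeroʳ ½) (ℚ.*-monoʳ-<-pos ½ 0<ε)

  +-rearrange : ∀ a b c d →
    (a ℚ.+ b) ℚ.- (c ℚ.+ d) ≡ (a ℚ.- c) ℚ.+ (b ℚ.- d)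
  +-rearrange = solve 4 (λ a b c d →
    (a :+ b) :- (c :+ d) := (a :- c) :+ (b :- d)) refl
    where open +-*-Solver

  *-rearrange : ∀ a b c d →
    (a ℚ.* b) ℚ.- (c ℚ.* d) ≡ a ℚ.* (b ℚ.- d) ℚ.+ d ℚ.* (a ℚ.- c)
  *-rearrange = solve 4 (λ a b c d →
    (a :* b) :- (c :* d) := a :* (b :- d) :+ d :* (a :- c)) refl
    where open +-*-Solver

  add-sub : ∀ a b → a ≡ b ℚ.+ (a ℚ.- b)
  add-sub = solve 2 (λ a b → a := b :+ (a :- b)) refl
    where open +-*-Solver

  record EventuallyBounded (s : ℕ → ℚ) : Set where
    field
      bound   : ℚ
      pos     : 0ℚ ℚ.< bound
      from    : ℕ
      bounded : ∀ n → from ℕ.≤ n → ℚ.∣ s n ∣ ℚ.≤ bound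

  cauchy⇒bounded : ∀ s → IsCauchy s → EventuallyBounded s
  cauchy⇒bounded s c = record
    { bound   = ℚ.∣ s N ∣ ℚ.+ 1ℚ
    ; pos     = ℚ.+-mono-≤-< (ℚ.0≤∣p∣ (s N)) 0<1
    ; from    = N
    ; bounded = λ n N≤n → begin
        ℚ.∣ s n ∣                        ≡⟨ cong ℚ.∣_∣ (add-sub (s n) (s N)) ⟩
        ℚ.∣ s N ℚ.+ (s n ℚ.- s N) ∣      ≤⟨ ℚ.∣p+q∣≤∣p∣+∣q∣ (s N) (s n ℚ.- s N) ⟩
        ℚ.∣ s N ∣ ℚ.+ ℚ.∣ s n ℚ.- s N ∣  ≤⟨ ℚ.+-monoʳ-≤ ℚ.∣ s N ∣
                                             (ℚ.<⇒≤ (close n N N≤n ℕ.≤-refl)) ⟩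
        ℚ.∣ s N ∣ ℚ.+ 1ℚ                 ∎
    }
    where
    open ℚ.≤-Reasoning
    0<1 : 0ℚ ℚ.< 1ℚ
    0<1 = ℚ.positive⁻¹ 1ℚ
    N = proj₁ (c 1ℚ 0<1)
    close = proj₂ (c 1ℚ 0<1)

  -- A δ with b * δ ≡ ε / 2.
  shrink : ∀ b ε → 0ℚ ℚ.< b → 0ℚ ℚ.< ε →
           ∃ λ δ → 0ℚ ℚ.< δ × b ℚ.* δ ≡ ½ ℚ.* ε
  shrink b ε 0<b 0<ε = δ , 0<δ , b*δ
    where
    instance
      b-pos : ℚ.Positive b
      b-pos = ℚ.positive 0<b
      b-nonZero : ℚ.NonZero b
      b-nonZero = ℚ.pos⇒nonZero b
      1/b-pos : ℚ.Positive (ℚ.1/ b)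
      1/b-pos = ℚ.1/pos⇒pos b
    δ = ℚ.1/ b ℚ.* (½ ℚ.* ε)
    0<δ : 0ℚ ℚ.< δ
    0<δ = subst (ℚ._< δ) (ℚ.*-zeroʳ (ℚ.1/ b))
            (ℚ.*-monoʳ-<-pos (ℚ.1/ b) (half-pos ε 0<ε))
    b*δ : b ℚ.* δ ≡ ½ ℚ.* ε
    b*δ = trans (sym (ℚ.*-assoc b (ℚ.1/ b) (½ ℚ.* ε)))
            (trans (cong (ℚ._* (½ ℚ.* ε)) (ℚ.*-inverseʳ b))
                   (ℚ.*-identityˡ (½ ℚ.* ε)))

  -- ∣p∣ ≤ b and ∣q∣ < δ give ∣p * q∣ < b * δ, for b > 0.
  ∣*∣-bound : ∀ p q b δ → 0ℚ ℚ.< b → ℚ.∣ p ∣ ℚ.≤ b → ℚ.∣ q ∣ ℚ.< δ →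
              ℚ.∣ p ℚ.* q ∣ ℚ.< b ℚ.* δ
  ∣*∣-bound p q b δ 0<b p≤b q<δ = begin-strict
    ℚ.∣ p ℚ.* q ∣        ≡⟨ ℚ.∣p*q∣≡∣p∣*∣q∣ p q ⟩
    ℚ.∣ p ∣ ℚ.* ℚ.∣ q ∣  ≤⟨ ℚ.*-monoʳ-≤-nonNeg ℚ.∣ q ∣ p≤b ⟩
    b ℚ.* ℚ.∣ q ∣        <⟨ ℚ.*-monoʳ-<-pos b q<δ ⟩
    b ℚ.* δ              ∎
    where
    open ℚ.≤-Reasoning
    instance
      b-pos : ℚ.Positive b
      b-pos = ℚ.positive 0<b
      q-nonNeg : ℚ.NonNegative ℚ.∣ q ∣
      q-nonNeg = ℚ.nonNegative (ℚ.0≤∣p∣ q)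

  cauchy-+ : ∀ s t → IsCauchy s → IsCauchy t → IsCauchy (λ n → s n ℚ.+ t n)
  cauchy-+ s t cs ct ε 0<ε = M ℕ.⊔ N , λ m n l l′ → begin-strict
    ℚ.∣ (s m ℚ.+ t m) ℚ.- (s n ℚ.+ t n) ∣
      ≡⟨ cong ℚ.∣_∣ (+-rearrange (s m) (t m) (s n) (t n)) ⟩
    ℚ.∣ (s m ℚ.- s n) ℚ.+ (t m ℚ.- t n) ∣
      ≤⟨ ℚ.∣p+q∣≤∣p∣+∣q∣ (s m ℚ.- s n) (t m ℚ.- t n) ⟩
    ℚ.∣ s m ℚ.- s n ∣ ℚ.+ ℚ.∣ t m ℚ.- t n ∣
      <⟨ ℚ.+-mono-< (closeˢ m n (ℕ.m⊔n≤o⇒m≤o M N l) (ℕ.m⊔n≤o⇒m≤o M N l′))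
                    (closeᵗ m n (ℕ.m⊔n≤o⇒n≤o M N l) (ℕ.m⊔n≤o⇒n≤o M N l′)) ⟩
    ½ ℚ.* ε ℚ.+ ½ ℚ.* ε
      ≡⟨ halves ε ⟩
    ε ∎
    where
    open ℚ.≤-Reasoning
    M = proj₁ (cs (½ ℚ.* ε) (half-pos ε 0<ε))
    closeˢ = proj₂ (cs (½ ℚ.* ε) (half-pos ε 0<ε))
    N = proj₁ (ct (½ ℚ.* ε) (half-pos ε 0<ε))
    closeᵗ = proj₂ (ct (½ ℚ.* ε) (half-pos ε 0<ε))

  cauchy-* : ∀ s t → IsCauchy s → IsCauchy t → IsCauchy (λ n → s n ℚ.* t n)
  cauchy-* s t cs ct ε 0<ε = K , λ m n l l′ → begin-strict
    ℚ.∣ (s m ℚ.* t m) ℚ.- (s n ℚ.* t n) ∣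
      ≡⟨ cong ℚ.∣_∣ (*-rearrange (s m) (t m) (s n) (t n)) ⟩
    ℚ.∣ s m ℚ.* (t m ℚ.- t n) ℚ.+ t n ℚ.* (s m ℚ.- s n) ∣
      ≤⟨ ℚ.∣p+q∣≤∣p∣+∣q∣ (s m ℚ.* (t m ℚ.- t n)) (t n ℚ.* (s m ℚ.- s n)) ⟩
    ℚ.∣ s m ℚ.* (t m ℚ.- t n) ∣ ℚ.+ ℚ.∣ t n ℚ.* (s m ℚ.- s n) ∣
      <⟨ ℚ.+-mono-<
           (∣*∣-bound (s m) (t m ℚ.- t n) (bound bs) (proj₁ δᵗ) (pos bs)
             (bounded bs m (ℕ.≤-trans bs≤K l))
             (proj₂ Nᵗ m n (ℕ.≤-trans Nᵗ≤K l) (ℕ.≤-trans Nᵗ≤K l′)))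
           (∣*∣-bound (t n) (s m ℚ.- s n) (bound bt) (proj₁ δˢ) (pos bt)
             (bounded bt n (ℕ.≤-trans bt≤K l′))
             (proj₂ Nˢ m n (ℕ.≤-trans Nˢ≤K l) (ℕ.≤-trans Nˢ≤K l′))) ⟩
    bound bs ℚ.* proj₁ δᵗ ℚ.+ bound bt ℚ.* proj₁ δˢ
      ≡⟨ cong₂ ℚ._+_ (proj₂ (proj₂ δᵗ)) (proj₂ (proj₂ δˢ)) ⟩
    ½ ℚ.* ε ℚ.+ ½ ℚ.* ε
      ≡⟨ halves ε ⟩
    ε ∎
    where
    open ℚ.≤-Reasoning
    open EventuallyBounded
    bs = cauchy⇒bounded s cs
    bt = cauchy⇒bounded t ct
    δˢ = shrink (bound bt) ε (pos bt) 0<ε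
    δᵗ = shrink (bound bs) ε (pos bs) 0<ε
    Nˢ = cs (proj₁ δˢ) (proj₁ (proj₂ δˢ))
    Nᵗ = ct (proj₁ δᵗ) (proj₁ (proj₂ δᵗ))
    K₁ = from bs ℕ.⊔ from bt
    K₂ = proj₁ Nˢ ℕ.⊔ proj₁ Nᵗ
    K  = K₁ ℕ.⊔ K₂
    bs≤K : from bs ℕ.≤ K
    bs≤K = ℕ.≤-trans (ℕ.m≤m⊔n (from bs) (from bt)) (ℕ.m≤m⊔n K₁ K₂)
    bt≤K : from bt ℕ.≤ K
    bt≤K = ℕ.≤-trans (ℕ.m≤n⊔m (from bs) (from bt)) (ℕ.m≤m⊔n K₁ K₂)
    Nˢ≤K : proj₁ Nˢ ℕ.≤ K
    Nˢ≤K = ℕ.≤-trans (ℕ.m≤m⊔n (proj₁ Nˢ) (proj₁ Nᵗ)) (ℕ.m≤n⊔m K₁ K₂)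
    Nᵗ≤K : proj₁ Nᵗ ℕ.≤ K
    Nᵗ≤K = ℕ.≤-trans (ℕ.m≤n⊔m (proj₁ Nˢ) (proj₁ Nᵗ)) (ℕ.m≤n⊔m K₁ K₂)

infixl 6 _+ᵣ_
infixl 7 _*ᵣ_

_+ᵣ_ : ℝ → ℝ → ℝ
x +ᵣ y = mkℝ (λ n → seq x n ℚ.+ seq y n)
             (cauchy-+ (seq x) (seq y) (cauchy x) (cauchy y))

_*ᵣ_ : ℝ → ℝ → ℝ
x *ᵣ y = mkℝ (λ n → seq x n ℚ.* seq y n)
             (cauchy-* (seq x) (seq y) (cauchy x) (cauchy y))

ℝ-rawSemiring : RawSemiring 0ℓ 0ℓ
ℝ-rawSemiring = record
  { Carrier = ℝ
  ; _≈_     = _≃ᵣ_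
  ; _+_     = _+ᵣ_
  ; _*_     = _*ᵣ_
  ; 0#      = 0ᵣ
  ; 1#      = 1ᵣ
  }

-- In the library's RawSemiring vocabulary, a × x is the a-fold sum of x.
open RawSemiringDefinitions ℝ-rawSemiring public
  using () renaming (sum to sumᵣ; _^_ to _^ᵣ_; _×_ to _×ᵣ_)

------------------------------------------------------------------------
-- Finite simple graphs on the vertex set Fin n

record Graph (n : ℕ) : Set₁ where
  field
    Adj        : Rel (Fin n) 0ℓ
    adj?       : Decidable Adj
    adj-sym    : Symmetric Adj
    adj-irrefl : ∀ v → ¬ Adj v v

open Graph public

infix 4 _≅_

_≅_ : ∀ {m n} → Graph m → Graph n → Set
_≅_ {m} {n} G H = Σ (Fin m ↔ Fin n) λ f →
  ∀ u v → Adj G u v ⇔ Adj H (Inverse.to f u) (Inverse.to f v)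

Connected : ∀ {n} → Graph n → Set
Connected G = ∀ u v → Star (Adj G) u v

-- A cycle of length 3 + k.
record Cycle {n} (G : Graph n) : Set where
  field
    k        : ℕ
    vertex   : Fin (3 ℕ.+ k) → Fin n
    distinct : ∀ i j → vertex i ≡ vertex j → i ≡ j
    step     : ∀ (i : Fin (2 ℕ.+ k)) → Adj G (vertex (inject₁ i)) (vertex (suc i))
    close    : Adj G (vertex (fromℕ (2 ℕ.+ k))) (vertex zero)

record IsTree {n} (G : Graph n) : Set where
  field
    nonEmpty  : 0 ℕ.< n
    connected : Connected G
    acyclic   : ¬ Cycle G

Independent : ∀ {n} → Graph n → Subset n → Set
Independent G S = ∀ u v → u ∈ S → v ∈ S → ¬ Adj G u v

independent? : ∀ {n} (G : Graph n) (S : Subset n) → Dec (Independent G S)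
independent? G S = Fin.all? λ u → Fin.all? λ v →
  (u ∈? S) →-dec ((v ∈? S) →-dec ¬? (adj? G u v))

MaximalIndependent : ∀ {n} → Graph n → Subset n → Set
MaximalIndependent G S =
  Independent G S × (∀ S′ → Independent G S′ → S ⊆ S′ → S′ ≡ S)

WellCovered : ∀ {n} → Graph n → Set
WellCovered G = ∀ S S′ → MaximalIndependent G S → MaximalIndependent G S′ →
  ∣ S ∣ ≡ ∣ S′ ∣

path : ∀ n → Graph n
path n = record
  { Adj        = λ u v → toℕ v ≡ suc (toℕ u) ⊎ toℕ u ≡ suc (toℕ v)
  ; adj?       = λ u v → (toℕ v ℕ.≟ suc (toℕ u)) ⊎-dec (toℕ u ℕ.≟ suc (toℕ v))
  ; adj-sym    = swap
  ; adj-irrefl = λ { v (inj₁ e) → ℕ.1+n≢n (sym e) ; v (inj₂ e) → ℕ.1+n≢n (sym e) }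
  }

-- K_{1,n-1} with centre 0 (the empty graph if n = 0).
star : ∀ n → Graph n
star n = record
  { Adj        = λ u v → CentreLeaf u v ⊎ CentreLeaf v u
  ; adj?       = λ u v → centreLeaf? u v ⊎-dec centreLeaf? v u
  ; adj-sym    = swap
  ; adj-irrefl = λ { v (inj₁ (e , ne)) → ne e ; v (inj₂ (e , ne)) → ne e }
  }
  where
  CentreLeaf : Rel (Fin n) 0ℓ
  CentreLeaf u v = toℕ u ≡ 0 × toℕ v ≢ 0
  centreLeaf? : Decidable CentreLeaf
  centreLeaf? u v = (toℕ u ℕ.≟ 0) ×-dec ¬? (toℕ v ℕ.≟ 0)

-- The graph star G*.  Under Fin (n + n) ≅ Fin n ⊎ Fin n, inj₁ v is the vertex
-- v of G and inj₂ v is the new vertex v*.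
infix 9 _⋆

_⋆ : ∀ {n} → Graph n → Graph (n ℕ.+ n)
_⋆ {n} G = record
  { Adj        = Adj⊎ on splitAt n
  ; adj?       = λ u v → adj⊎? (splitAt n u) (splitAt n v)
  ; adj-sym    = λ {u} {v} → adj⊎-sym (splitAt n u) (splitAt n v)
  ; adj-irrefl = λ v → adj⊎-irrefl (splitAt n v)
  }
  where
  Adj⊎ : Rel (Fin n ⊎ Fin n) 0ℓ
  Adj⊎ (inj₁ u) (inj₁ v) = Adj G u v
  Adj⊎ (inj₁ u) (inj₂ v) = u ≡ v
  Adj⊎ (inj₂ u) (inj₁ v) = u ≡ v
  Adj⊎ (inj₂ u) (inj₂ v) = ⊥

  adj⊎? : Decidable Adj⊎
  adj⊎? (inj₁ u) (inj₁ v) = adj? G u v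
  adj⊎? (inj₁ u) (inj₂ v) = u Fin.≟ v
  adj⊎? (inj₂ u) (inj₁ v) = u Fin.≟ v
  adj⊎? (inj₂ u) (inj₂ v) = no λ ()

  adj⊎-sym : ∀ x y → Adj⊎ x y → Adj⊎ y x
  adj⊎-sym (inj₁ u) (inj₁ v) a = adj-sym G a
  adj⊎-sym (inj₁ u) (inj₂ v) e = sym e
  adj⊎-sym (inj₂ u) (inj₁ v) e = sym e

  adj⊎-irrefl : ∀ x → ¬ Adj⊎ x x
  adj⊎-irrefl (inj₁ u) a = adj-irrefl G u a
  adj⊎-irrefl (inj₂ u) ()

------------------------------------------------------------------------
-- The independence polynomial and the order it induces

subsets : ∀ n → List (Subset n)
subsets zero    = [] ∷ []
subsets (suc n) = map (outside ∷_) (subsets n) ++ map (inside ∷_) (subsets n)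

-- The coefficient i_k; it is 0 for k > n.
indepCount : ∀ {n} → Graph n → ℕ → ℕ
indepCount {n} G k =
  length (filter (λ S → independent? G S ×-dec (∣ S ∣ ℕ.≟ k)) (subsets n))

-- The value I(G,x).
I : ∀ {n} → Graph n → ℝ → ℝ
I {n} G x = sumᵣ {suc n} λ k → indepCount G (toℕ k) ×ᵣ (x ^ᵣ toℕ k)

SamePolynomial : ∀ {m n} → Graph m → Graph n → Set
SamePolynomial G H = ∀ k → indepCount G k ≡ indepCount H k

Root : ∀ {n} → Graph n → ℝ → Set
Root G x = I G x ≃ᵣ 0ᵣ

-- ξ is ξ(G), the largest real root of I(G,x).  This determines ξ up to ≃ᵣ.
IsLargestRoot : ∀ {n} → Graph n → ℝ → Set
IsLargestRoot G ξ = Root G ξ × (∀ y → Root G y → y ≤ᵣ ξ)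

infix 4 _⪯_ _≺_

_⪯_ : ∀ {m n} → Graph m → Graph n → Set
H ⪯ G = ∀ ξ → IsLargestRoot G ξ → ∀ x → ξ ≤ᵣ x → x ≤ᵣ 0ᵣ → I G x ≤ᵣ I H x

_≺_ : ∀ {m n} → Graph m → Graph n → Set
H ≺ G = H ⪯ G × ¬ SamePolynomial H G

{-# OPTIONS --safe #-}
module Submission where

open import Defs
import Algebra.Definitions.RawSemiring as RawSemiringDefinitions
import Algebra.Properties.CommutativeMonoid.Sum as Sum
open import Data.Bool.Base using (Bool; true; false; _∧_; not; if_then_else_)
open import Data.Empty using (⊥; ⊥-elim)
open import Data.Fin.Base as Fin using (Fin; zero; suc; toℕ; fromℕ; inject₁)
open import Data.Fin.Permutation using (↔⇒≡)
import Data.Fin.Properties as Fin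
open import Data.Fin.Subset as Subset using (Subset; _∈_; _⊆_)
import Data.Fin.Subset.Properties as Subset
import Data.Integer.Base as ℤ
import Data.Integer.Properties as ℤ
open import Data.List.Base as List using (List; []; _∷_; _++_; cartesianProduct; filter; length)
import Data.List.Membership.Propositional as List
import Data.List.Membership.Propositional.Properties as List
open import Data.List.Membership.Propositional.Properties.WithK using (unique∧set⇒bag)
open import Data.List.Relation.Binary.BagAndSetEquality using (∼bag⇒↭)
open import Data.List.Relation.Binary.Permutation.Propositional as ↭ using (_↭_)
open import Data.List.Relation.Unary.All using ([]; _∷_)
open import Data.List.Relation.Unary.AllPairs using ([]; _∷_)
open import Data.List.Relation.Unary.Any using (here; there)
open import Data.List.Relation.Unary.Unique.Propositional using (Unique)
import Data.List.Relation.Unary.Unique.Propositional.Properties as Unique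
open import Data.Nat.Base as ℕ using (ℕ; zero; suc; s≤s)
import Data.Nat.Coprimality as Coprimality
import Data.Nat.Properties as ℕ
open import Data.Product.Base using (Σ; ∃; ∃₂; _×_; _,_; proj₁; proj₂)
import Data.Rational.Base as ℚBase
open import Data.Rational.Base as ℚ using (ℚ; mkℚ; 0ℚ; 1ℚ; ½; *<*)
import Data.Rational.Properties as ℚ
import Data.Rational.Solver as ℚSolver
open import Data.Rational.Unnormalised.Base using (*≡*)
import Data.Rational.Unnormalised.Properties as ℚᵘ
open import Data.Sum.Base as ⊎ using (_⊎_; inj₁; inj₂)
open import Data.Sum.Function.Propositional using (_⊎-↔_)
open import Data.Unit.Base using (⊤; tt)
open import Data.Vec.Base as Vec using ([]; _∷_; tabulate; lookup)
import Data.Vec.Properties as Vec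
open import Function.Base using (_∘_)
open import Function.Bundles using (_↔_; Inverse; mk↔ₛ′; mk⇔)
open import Function.Construct.Composition using (_↔-∘_)
open import Function.Construct.Symmetry using (↔-sym)
open import Relation.Binary.Construct.Closure.ReflexiveTransitive as Star using (Star)
open import Relation.Binary.Definitions using (Tri; tri<; tri≈; tri>)
open import Relation.Binary.PropositionalEquality
  using (_≡_; _≢_; _≗_; refl; sym; trans; cong; cong₂; subst; subst₂)
open import Relation.Nullary using (¬_; Dec; yes; no; does)
open import Relation.Nullary.Decidable
  using (_×-dec_; dec-true; dec-false; decidable-stable; map′)

-- By Ravindra's theorem T = G⋆ for a tree G; this follows by comparing, for every rooted
-- subtree, the sizes of the maximal independent sets according to the state of the root.
-- I(G⋆,x) is computed on G with weight x for chosen and 1 + x for other vertices, by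
-- recursion over rooted trees.  For x < 0, I(G⋆,·) has no root in [x,0] precisely if the
-- values A of all rooted subtrees are positive ("good"): at the boundary of the good region
-- the value of the whole tree, being at most that of each part, vanishes.  So a point that
-- is not good yields, by bisection, a root of I(G⋆,·) to its right.  In the good region,
-- leaf deletion reduces both inequalities to the tree minus a leaf, and to bounds on the
-- part N of I omitting the root r and the part -D containing it: D / N is minimal for the
-- path with end r, and N is maximal for the star with centre r.  These bounds are strict
-- unless the rooted tree is the extremal one, and good points near 0 then separate the
-- polynomials.

-- Rooted trees

-- With the root at a leaf, `A (• ⊳ r) = b * A r - c * N r`. For the star both terms work together:
-- it minimises `A r` and maximises `N r`. For the path they pull apart: if the root of `r` is
-- itself a leaf, `N r` is `b` times the value of a smaller tree, which the path makes large rather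
-- than small. Hence the factored form `A r * (b - c * N r / A r)`: here `N / A` is an increasing
-- function of `D / N`, and this ratio is a quantity that the induction can carry. The reals are
-- Cauchy sequences, so a sign at a real point cannot be decided. All tree inequalities are
-- therefore proved at rational points, where goodness is decidable; a real `x` is replaced by
-- rational points slightly to its right, cut off at 0, and Lipschitz bounds carry the inequality
-- back. Goodness is known for only one of the two trees compared, so each comparison must also
-- produce the goodness of the other.

record Gr : Set₁ where
  constructor mkGr
  field
    V : Set
    E : V → V → Set

open Gr public

infix 4 _≃_

record _≃_ (G H : Gr) : Set where
  field
    to      : V G → V H
    from    : V H → V G
    to-from : ∀ y → to (from y) ≡ y
    from-to : ∀ x → from (to x) ≡ x
    to-E    : ∀ {u v} → E G u v → E H (to u) (to v)
    from-E  : ∀ {u v} → E H u v → E G (from u) (from v)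

open _≃_ public

≃-refl : ∀ {G} → G ≃ G
≃-refl = record
  { to = λ x → x ; from = λ x → x ; to-from = λ _ → refl ; from-to = λ _ → refl
  ; to-E = λ e → e ; from-E = λ e → e }

≃-sym : ∀ {G H} → G ≃ H → H ≃ G
≃-sym f = record
  { to = from f ; from = to f ; to-from = from-to f ; from-to = to-from f
  ; to-E = from-E f ; from-E = to-E f }

≃-trans : ∀ {G H K} → G ≃ H → H ≃ K → G ≃ K
≃-trans f g = record
  { to = λ x → to g (to f x)
  ; from = λ x → from f (from g x)
  ; to-from = λ y → trans (cong (to g) (to-from f (from g y))) (to-from g y)
  ; from-to = λ x → trans (cong (from f) (from-to g (to f x))) (from-to f x)
  ; to-E = λ e → to-E g (to-E f e)
  ; from-E = λ e → from-E f (from-E g e) }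

-- Vertex types are arbitrary so that gluing is a disjoint sum, with no renumbering of vertices.
join : (G : Gr) → V G → (H : Gr) → V H → Gr
join G u H v = mkGr (V G ⊎ V H) λ where
  (inj₁ a) (inj₁ b) → E G a b
  (inj₂ a) (inj₂ b) → E H a b
  (inj₁ a) (inj₂ b) → a ≡ u × b ≡ v
  (inj₂ a) (inj₁ b) → a ≡ v × b ≡ u

infixl 6 _⊳_

-- In t ⊳ s the root of s becomes a new child of the root of t.
data RTree : Set where
  •   : RTree
  _⊳_ : RTree → RTree → RTree

tree : RTree → Gr
root : ∀ t → V (tree t)
tree •       = mkGr ⊤ λ _ _ → ⊥
tree (t ⊳ s) = join (tree t) (root t) (tree s) (root s)
root •       = tt
root (t ⊳ s) = inj₁ (root t)

join-cong : ∀ {G G′ H H′ u u′ v v′} (f : G ≃ G′) (g : H ≃ H′) →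
  to f u ≡ u′ → to g v ≡ v′ → join G u H v ≃ join G′ u′ H′ v′
join-cong {G} {G′} {H} {H′} {u} {u′} {v} {v′} f g eu ev = record
  { to = λ { (inj₁ x) → inj₁ (to f x) ; (inj₂ y) → inj₂ (to g y) }
  ; from = λ { (inj₁ x) → inj₁ (from f x) ; (inj₂ y) → inj₂ (from g y) }
  ; to-from = λ { (inj₁ x) → cong inj₁ (to-from f x) ; (inj₂ y) → cong inj₂ (to-from g y) }
  ; from-to = λ { (inj₁ x) → cong inj₁ (from-to f x) ; (inj₂ y) → cong inj₂ (from-to g y) }
  ; to-E = λ {x} {y} → toE x y
  ; from-E = λ {x} {y} → fromE x y }
  where
  toE : ∀ x y → E (join G u H v) x y → _
  toE (inj₁ x) (inj₁ y) e = to-E f e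
  toE (inj₁ x) (inj₂ y) (refl , refl) = eu , ev
  toE (inj₂ x) (inj₁ y) (refl , refl) = ev , eu
  toE (inj₂ x) (inj₂ y) e = to-E g e
  back : ∀ {G H} (f : G ≃ H) {a b c} → to f a ≡ b → c ≡ b → from f c ≡ a
  back f refl refl = from-to f _
  fromE : ∀ x y → E (join G′ u′ H′ v′) x y → _
  fromE (inj₁ x) (inj₁ y) e = from-E f e
  fromE (inj₁ x) (inj₂ y) (p , q) = back f eu p , back g ev q
  fromE (inj₂ x) (inj₁ y) (p , q) = back g ev p , back f eu q
  fromE (inj₂ x) (inj₂ y) e = from-E g e

join-comm : ∀ G u H v → join G u H v ≃ join H v G u
join-comm G u H v = record
  { to = λ { (inj₁ x) → inj₂ x ; (inj₂ y) → inj₁ y }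
  ; from = λ { (inj₁ x) → inj₂ x ; (inj₂ y) → inj₁ y }
  ; to-from = λ { (inj₁ x) → refl ; (inj₂ y) → refl }
  ; from-to = λ { (inj₁ x) → refl ; (inj₂ y) → refl }
  ; to-E = λ {x} {y} → toE x y
  ; from-E = λ {x} {y} → fromE x y }
  where
  toE : ∀ x y → E (join G u H v) x y → _
  toE (inj₁ x) (inj₁ y) e = e
  toE (inj₁ x) (inj₂ y) e = e
  toE (inj₂ x) (inj₁ y) e = e
  toE (inj₂ x) (inj₂ y) e = e
  fromE : ∀ x y → E (join H v G u) x y → _
  fromE (inj₁ x) (inj₁ y) e = e
  fromE (inj₁ x) (inj₂ y) e = e
  fromE (inj₂ x) (inj₁ y) e = e
  fromE (inj₂ x) (inj₂ y) e = e

join-assoc : ∀ G u H v w K z →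
  join (join G u H v) (inj₂ w) K z ≃ join G u (join H w K z) (inj₁ v)
join-assoc G u H v w K z = record
  { to = λ { (inj₁ (inj₁ x)) → inj₁ x ; (inj₁ (inj₂ x)) → inj₂ (inj₁ x) ; (inj₂ x) → inj₂ (inj₂ x) }
  ; from = λ { (inj₁ x) → inj₁ (inj₁ x) ; (inj₂ (inj₁ x)) → inj₁ (inj₂ x) ; (inj₂ (inj₂ x)) → inj₂ x }
  ; to-from = λ { (inj₁ x) → refl ; (inj₂ (inj₁ x)) → refl ; (inj₂ (inj₂ x)) → refl }
  ; from-to = λ { (inj₁ (inj₁ x)) → refl ; (inj₁ (inj₂ x)) → refl ; (inj₂ x) → refl }
  ; to-E = λ {x} {y} → toE x y
  ; from-E = λ {x} {y} → fromE x y }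
  where
  toE : ∀ x y → E (join (join G u H v) (inj₂ w) K z) x y → _
  toE (inj₁ (inj₁ x)) (inj₁ (inj₁ y)) e = e
  toE (inj₁ (inj₁ x)) (inj₁ (inj₂ y)) (p , q) = p , cong inj₁ q
  toE (inj₁ (inj₁ x)) (inj₂ y) (() , _)
  toE (inj₁ (inj₂ x)) (inj₁ (inj₁ y)) (p , q) = cong inj₁ p , q
  toE (inj₁ (inj₂ x)) (inj₁ (inj₂ y)) e = e
  toE (inj₁ (inj₂ x)) (inj₂ y) (refl , q) = refl , q
  toE (inj₂ x) (inj₁ (inj₁ y)) (_ , ())
  toE (inj₂ x) (inj₁ (inj₂ y)) (p , refl) = p , refl
  toE (inj₂ x) (inj₂ y) e = e
  fromE : ∀ x y → E (join G u (join H w K z) (inj₁ v)) x y → _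
  fromE (inj₁ x) (inj₁ y) e = e
  fromE (inj₁ x) (inj₂ (inj₁ y)) (p , refl) = p , refl
  fromE (inj₁ x) (inj₂ (inj₂ y)) (_ , ())
  fromE (inj₂ (inj₁ x)) (inj₁ y) (refl , q) = refl , q
  fromE (inj₂ (inj₁ x)) (inj₂ (inj₁ y)) e = e
  fromE (inj₂ (inj₁ x)) (inj₂ (inj₂ y)) (p , q) = cong inj₂ p , q
  fromE (inj₂ (inj₂ x)) (inj₁ y) (() , _)
  fromE (inj₂ (inj₂ x)) (inj₂ (inj₁ y)) (p , q) = p , cong inj₂ q
  fromE (inj₂ (inj₂ x)) (inj₂ (inj₂ y)) e = e

join-exchange : ∀ G u H v w K z →
  join (join G u H v) (inj₁ w) K z ≃ join (join G w K z) (inj₁ u) H v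
join-exchange G u H v w K z = record
  { to = f ; from = f ; to-from = f-f ; from-to = f-f
  ; to-E = λ {x} {y} → f-E G u H v w K z x y
  ; from-E = λ {x} {y} → f-E G w K z u H v x y }
  where
  f : ∀ {A B C : Set} → (A ⊎ B) ⊎ C → (A ⊎ C) ⊎ B
  f (inj₁ (inj₁ x)) = inj₁ (inj₁ x)
  f (inj₁ (inj₂ x)) = inj₂ x
  f (inj₂ x)        = inj₁ (inj₂ x)
  f-f : ∀ {A B C : Set} (x : (A ⊎ B) ⊎ C) → f (f x) ≡ x
  f-f (inj₁ (inj₁ x)) = refl
  f-f (inj₁ (inj₂ x)) = refl
  f-f (inj₂ x)        = refl
  f-E : ∀ G u H v w K z x y → E (join (join G u H v) (inj₁ w) K z) x y →
    E (join (join G w K z) (inj₁ u) H v) (f x) (f y)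
  f-E G u H v w K z (inj₁ (inj₁ x)) (inj₁ (inj₁ y)) e = e
  f-E G u H v w K z (inj₁ (inj₁ x)) (inj₁ (inj₂ y)) (p , q) = cong inj₁ p , q
  f-E G u H v w K z (inj₁ (inj₁ x)) (inj₂ y) (refl , q) = refl , q
  f-E G u H v w K z (inj₁ (inj₂ x)) (inj₁ (inj₁ y)) (p , q) = p , cong inj₁ q
  f-E G u H v w K z (inj₁ (inj₂ x)) (inj₁ (inj₂ y)) e = e
  f-E G u H v w K z (inj₁ (inj₂ x)) (inj₂ y) (() , _)
  f-E G u H v w K z (inj₂ x) (inj₁ (inj₁ y)) (p , refl) = p , refl
  f-E G u H v w K z (inj₂ x) (inj₁ (inj₂ y)) (_ , ())
  f-E G u H v w K z (inj₂ x) (inj₂ y) e = e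

-- Moves the root across the edge from `a` to its child `b`; iterated, this brings the root to a
-- leaf.
reroot : ∀ a b s → tree (a ⊳ b ⊳ s) ≃ tree (b ⊳ (a ⊳ s))
reroot a b s =
  ≃-trans (join-exchange (tree a) (root a) (tree b) (root b) (root a) (tree s) (root s))
          (join-comm (tree (a ⊳ s)) (root (a ⊳ s)) (tree b) (root b))

-- Paths, stars and graph stars as rooted trees

line claw : ℕ → RTree
line zero    = •
line (suc n) = • ⊳ line n
claw zero    = •
claw (suc n) = claw n ⊳ •

-- The rooted counterpart of the graph star.
pendant : RTree → RTree
pendant •       = • ⊳ •
pendant (t ⊳ s) = pendant t ⊳ pendant s

-- G⋆ for an arbitrary vertex type; inj₂ v is the pendant vertex v*.
corona : Gr → Gr
corona G = mkGr (V G ⊎ V G) λ where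
  (inj₁ a) (inj₁ b) → E G a b
  (inj₁ a) (inj₂ b) → a ≡ b
  (inj₂ a) (inj₁ b) → a ≡ b
  (inj₂ a) (inj₂ b) → ⊥

corona-cong : ∀ {G H} → G ≃ H → corona G ≃ corona H
corona-cong {G} {H} f = record
  { to = ⊎.map (to f) (to f)
  ; from = ⊎.map (from f) (from f)
  ; to-from = λ { (inj₁ x) → cong inj₁ (to-from f x) ; (inj₂ x) → cong inj₂ (to-from f x) }
  ; from-to = λ { (inj₁ x) → cong inj₁ (from-to f x) ; (inj₂ x) → cong inj₂ (from-to f x) }
  ; to-E = λ {x} {y} → mapE f x y
  ; from-E = λ {x} {y} → mapE (≃-sym f) x y }
  where
  mapE : ∀ {G H} (f : G ≃ H) x y → E (corona G) x y →
    E (corona H) (⊎.map (to f) (to f) x) (⊎.map (to f) (to f) y)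
  mapE f (inj₁ x) (inj₁ y) e = to-E f e
  mapE f (inj₁ x) (inj₂ y) e = cong (to f) e
  mapE f (inj₂ x) (inj₁ y) e = cong (to f) e
  mapE f (inj₂ x) (inj₂ y) ()

corona-join : ∀ G u H v →
  corona (join G u H v) ≃ join (corona G) (inj₁ u) (corona H) (inj₁ v)
corona-join G u H v = record
  { to = f ; from = f ; to-from = f-f ; from-to = f-f
  ; to-E = λ {x} {y} → toE x y
  ; from-E = λ {x} {y} → fromE x y }
  where
  f : ∀ {A B C D : Set} → (A ⊎ B) ⊎ (C ⊎ D) → (A ⊎ C) ⊎ (B ⊎ D)
  f (inj₁ (inj₁ x)) = inj₁ (inj₁ x)
  f (inj₁ (inj₂ x)) = inj₂ (inj₁ x)
  f (inj₂ (inj₁ x)) = inj₁ (inj₂ x)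
  f (inj₂ (inj₂ x)) = inj₂ (inj₂ x)
  f-f : ∀ {A B C D : Set} (x : (A ⊎ B) ⊎ (C ⊎ D)) → f (f x) ≡ x
  f-f (inj₁ (inj₁ x)) = refl
  f-f (inj₁ (inj₂ x)) = refl
  f-f (inj₂ (inj₁ x)) = refl
  f-f (inj₂ (inj₂ x)) = refl
  toE : ∀ x y → E (corona (join G u H v)) x y →
    E (join (corona G) (inj₁ u) (corona H) (inj₁ v)) (f x) (f y)
  toE (inj₁ (inj₁ x)) (inj₁ (inj₁ y)) e = e
  toE (inj₁ (inj₁ x)) (inj₁ (inj₂ y)) (p , q) = cong inj₁ p , cong inj₁ q
  toE (inj₁ (inj₂ x)) (inj₁ (inj₁ y)) (p , q) = cong inj₁ p , cong inj₁ q
  toE (inj₁ (inj₂ x)) (inj₁ (inj₂ y)) e = e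
  toE (inj₁ (inj₁ x)) (inj₂ (inj₁ y)) refl = refl
  toE (inj₁ (inj₂ x)) (inj₂ (inj₂ y)) refl = refl
  toE (inj₂ (inj₁ x)) (inj₁ (inj₁ y)) refl = refl
  toE (inj₂ (inj₂ x)) (inj₁ (inj₂ y)) refl = refl
  fromE : ∀ x y → E (join (corona G) (inj₁ u) (corona H) (inj₁ v)) x y →
    E (corona (join G u H v)) (f x) (f y)
  fromE (inj₁ (inj₁ x)) (inj₁ (inj₁ y)) e = e
  fromE (inj₁ (inj₁ x)) (inj₁ (inj₂ y)) refl = refl
  fromE (inj₁ (inj₂ x)) (inj₁ (inj₁ y)) refl = refl
  fromE (inj₂ (inj₁ x)) (inj₂ (inj₁ y)) e = e
  fromE (inj₂ (inj₁ x)) (inj₂ (inj₂ y)) refl = refl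
  fromE (inj₂ (inj₂ x)) (inj₂ (inj₁ y)) refl = refl
  fromE (inj₁ (inj₁ x)) (inj₂ (inj₁ y)) (refl , refl) = refl , refl
  fromE (inj₂ (inj₁ x)) (inj₁ (inj₁ y)) (refl , refl) = refl , refl
  fromE (inj₁ (inj₁ x)) (inj₂ (inj₂ y)) (_ , ())
  fromE (inj₁ (inj₂ x)) (inj₂ _) (() , _)
  fromE (inj₂ (inj₁ x)) (inj₁ (inj₂ y)) (_ , ())
  fromE (inj₂ (inj₂ x)) (inj₁ _) (() , _)

-- The image of the root is recorded because `join-cong` needs to know where the attaching vertices
-- go.
corona-pendant : ∀ t → Σ (corona (tree t) ≃ tree (pendant t)) λ f →
  to f (inj₁ (root t)) ≡ root (pendant t)
corona-pendant •       = f , refl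
  where
  toE : ∀ x y → E (corona (tree •)) x y → E (tree (• ⊳ •)) x y
  toE (inj₁ x) (inj₁ y) e = e
  toE (inj₁ x) (inj₂ y) e = refl , refl
  toE (inj₂ x) (inj₁ y) e = refl , refl
  fromE : ∀ x y → E (tree (• ⊳ •)) x y → E (corona (tree •)) x y
  fromE (inj₁ x) (inj₁ y) e = e
  fromE (inj₁ x) (inj₂ y) e = refl
  fromE (inj₂ x) (inj₁ y) e = refl
  f : corona (tree •) ≃ tree (• ⊳ •)
  f = record
    { to = λ x → x ; from = λ x → x ; to-from = λ _ → refl ; from-to = λ _ → refl
    ; to-E = λ {x} {y} → toE x y ; from-E = λ {x} {y} → fromE x y }
corona-pendant (t ⊳ s) with corona-pendant t | corona-pendant s
... | f , p | g , q =
  ≃-trans (corona-join (tree t) (root t) (tree s) (root s)) (join-cong f g p q) , cong inj₁ p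

pendant-cong : ∀ {t s} → tree t ≃ tree s → tree (pendant t) ≃ tree (pendant s)
pendant-cong {t} {s} f =
  ≃-trans (≃-sym (proj₁ (corona-pendant t))) (≃-trans (corona-cong f) (proj₁ (corona-pendant s)))

edges : RTree → ℕ
edges •       = 0
edges (t ⊳ s) = suc (edges t ℕ.+ edges s)

toGr : ∀ {n} → Graph n → Gr
toGr {n} G = mkGr (Fin n) (Adj G)

≃⇒≅ : ∀ {m n} {G : Graph m} {H : Graph n} → toGr G ≃ toGr H → G ≅ H
≃⇒≅ {G = G} f = mk↔ₛ′ (to f) (from f) (to-from f) (from-to f) ,
  λ u v → mk⇔ (to-E f) λ e → subst₂ (Adj G) (from-to f u) (from-to f v) (from-E f e)

⋆≃corona : ∀ {n} (G : Graph n) → toGr (G ⋆) ≃ corona (toGr G)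
⋆≃corona {n} G = record
  { to = Fin.splitAt n
  ; from = Fin.join n n
  ; to-from = Fin.splitAt-join n n
  ; from-to = Fin.join-splitAt n n
  ; to-E = λ {u} {v} → toE u v
  ; from-E = λ {u} {v} → fromE u v }
  where
  toE : ∀ u v → Adj (G ⋆) u v → E (corona (toGr G)) (Fin.splitAt n u) (Fin.splitAt n v)
  toE u v e with Fin.splitAt n u | Fin.splitAt n v
  ... | inj₁ _ | inj₁ _ = e
  ... | inj₁ _ | inj₂ _ = e
  ... | inj₂ _ | inj₁ _ = e
  fromE : ∀ x y → E (corona (toGr G)) x y → Adj (G ⋆) (Fin.join n n x) (Fin.join n n y)
  fromE x y e with Fin.splitAt n (Fin.join n n x) | Fin.splitAt-join n n x
                 | Fin.splitAt n (Fin.join n n y) | Fin.splitAt-join n n y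
  fromE (inj₁ _) (inj₁ _) e | _ | refl | _ | refl = e
  fromE (inj₁ _) (inj₂ _) e | _ | refl | _ | refl = e
  fromE (inj₂ _) (inj₁ _) e | _ | refl | _ | refl = e

path≃line : ∀ n → toGr (path (suc n)) ≃ tree (line n)
path≃line n = record
  { to = to′ n
  ; from = from′ n
  ; to-from = to-from′ n
  ; from-to = from-to′ n
  ; to-E = λ {u} {v} → toE n u v
  ; from-E = λ {u} {v} → fromE n u v }
  where
  to′ : ∀ n → Fin (suc n) → V (tree (line n))
  to′ zero    _       = tt
  to′ (suc n) zero    = inj₁ tt
  to′ (suc n) (suc i) = inj₂ (to′ n i)
  from′ : ∀ n → V (tree (line n)) → Fin (suc n)
  from′ zero    _        = zero
  from′ (suc n) (inj₁ _) = zero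
  from′ (suc n) (inj₂ x) = suc (from′ n x)
  to-from′ : ∀ n x → to′ n (from′ n x) ≡ x
  to-from′ zero    _        = refl
  to-from′ (suc n) (inj₁ _) = refl
  to-from′ (suc n) (inj₂ x) = cong inj₂ (to-from′ n x)
  from-to′ : ∀ n i → from′ n (to′ n i) ≡ i
  from-to′ zero    zero    = refl
  from-to′ (suc n) zero    = refl
  from-to′ (suc n) (suc i) = cong suc (from-to′ n i)
  to-zero : ∀ n → to′ n zero ≡ root (line n)
  to-zero zero    = refl
  to-zero (suc n) = refl
  from-root : ∀ n → from′ n (root (line n)) ≡ zero
  from-root zero    = refl
  from-root (suc n) = refl
  suc≡1 : ∀ {k} (i : Fin (suc k)) → suc (toℕ i) ≡ 1 → i ≡ zero
  suc≡1 zero _ = refl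
  toE : ∀ n u v → Adj (path (suc n)) u v → E (tree (line n)) (to′ n u) (to′ n v)
  toE zero zero zero (inj₁ ())
  toE zero zero zero (inj₂ ())
  toE (suc n) zero zero (inj₁ ())
  toE (suc n) zero zero (inj₂ ())
  toE (suc n) zero (suc v) (inj₁ e) = refl , trans (cong (to′ n) (suc≡1 v e)) (to-zero n)
  toE (suc n) zero (suc v) (inj₂ ())
  toE (suc n) (suc u) zero (inj₁ ())
  toE (suc n) (suc u) zero (inj₂ e) = trans (cong (to′ n) (suc≡1 u e)) (to-zero n) , refl
  toE (suc n) (suc u) (suc v) e = toE n u v (⊎.map ℕ.suc-injective ℕ.suc-injective e)
  fromE : ∀ n x y → E (tree (line n)) x y → Adj (path (suc n)) (from′ n x) (from′ n y)
  fromE (suc n) (inj₁ x) (inj₂ y) (_ , refl) =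
    inj₁ (cong (λ z → suc (toℕ z)) (from-root n))
  fromE (suc n) (inj₂ x) (inj₁ y) (refl , _) =
    inj₂ (cong (λ z → suc (toℕ z)) (from-root n))
  fromE (suc n) (inj₂ x) (inj₂ y) e = ⊎.map (cong suc) (cong suc) (fromE n x y e)

size : RTree → ℕ
size •       = 1
size (t ⊳ s) = size t ℕ.+ size s

size≡1+edges : ∀ t → size t ≡ suc (edges t)
size≡1+edges •       = refl
size≡1+edges (t ⊳ s) = trans (cong₂ ℕ._+_ (size≡1+edges t) (size≡1+edges s))
  (cong suc (ℕ.+-suc (edges t) (edges s)))

index : ∀ t → V (tree t) ↔ Fin (size t)
index •       = mk↔ₛ′ (λ _ → zero) (λ _ → tt) (λ { zero → refl }) (λ _ → refl)
index (t ⊳ s) = ↔-sym (Fin.+↔⊎ {size t} {size s}) ↔-∘ (index t ⊎-↔ index s)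

-- The centre of `star` is vertex 0, so the root of `claw` has to receive the number 0.
index-root : ∀ t → toℕ (Inverse.to (index t) (root t)) ≡ 0
index-root •       = refl
index-root (t ⊳ s) = trans (Fin.toℕ-↑ˡ (Inverse.to (index t) (root t)) (size s)) (index-root t)

edges-claw : ∀ n → edges (claw n) ≡ n
edges-claw zero    = refl
edges-claw (suc n) = cong suc (trans (ℕ.+-identityʳ _) (edges-claw n))

star≃claw : ∀ n → toGr (star (suc n)) ≃ tree (claw n)
-- The order of the star is generalised to `k`, so that its equation with the size of the tree can
-- be matched with `refl`.
star≃claw n = helper (suc n) (trans (size≡1+edges (claw n)) (cong suc (edges-claw n)))
  where
  E⇒ : ∀ n x y → E (tree (claw n)) x y →
    (x ≡ root (claw n) × y ≢ root (claw n)) ⊎ (y ≡ root (claw n) × x ≢ root (claw n))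
  E⇒ (suc n) (inj₁ x) (inj₁ y) e = ⊎.map inject inject (E⇒ n x y e)
    where
    inject : ∀ {x y r : V (tree (claw n))} → x ≡ r × y ≢ r →
      _≡_ {A = V (tree (claw n)) ⊎ ⊤} (inj₁ x) (inj₁ r) × inj₁ y ≢ inj₁ r
    inject (p , q) = cong inj₁ p , λ { refl → q refl }
  E⇒ (suc n) (inj₁ x) (inj₂ y) (refl , _) = inj₁ (refl , λ ())
  E⇒ (suc n) (inj₂ x) (inj₁ y) (_ , refl) = inj₂ (refl , λ ())
  ⇒E : ∀ n x → x ≢ root (claw n) →
    E (tree (claw n)) (root (claw n)) x × E (tree (claw n)) x (root (claw n))
  ⇒E zero    x        x≢r = ⊥-elim (x≢r refl)
  ⇒E (suc n) (inj₁ x) x≢r = ⇒E n x λ e → x≢r (cong inj₁ e)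
  ⇒E (suc n) (inj₂ x) x≢r = (refl , refl) , (refl , refl)
  helper : ∀ k → size (claw n) ≡ k → toGr (star k) ≃ tree (claw n)
  helper k refl = record
    { to = from i ; from = to i
    ; to-from = strictlyInverseʳ i ; from-to = strictlyInverseˡ i
    ; to-E = λ {u} {v} → toE u v
    ; from-E = λ {x} {y} e → ⊎.map centre centre (E⇒ n x y e) }
    where
    open Inverse
    i = index (claw n)
    centre : ∀ {x y} → x ≡ root (claw n) × y ≢ root (claw n) →
      toℕ (to i x) ≡ 0 × toℕ (to i y) ≢ 0
    centre {y = y} (refl , q) = index-root (claw n) , λ e → q
      (trans (sym (strictlyInverseʳ i y))
        (trans (cong (from i) (Fin.toℕ-injective (trans e (sym (index-root (claw n))))))
          (strictlyInverseʳ i (root (claw n)))))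
    zero⇒root : ∀ u → toℕ u ≡ 0 → from i u ≡ root (claw n)
    zero⇒root u e = trans (cong (from i) (Fin.toℕ-injective (trans e (sym (index-root (claw n))))))
      (strictlyInverseʳ i (root (claw n)))
    nonzero : ∀ v → toℕ v ≢ 0 → from i v ≢ root (claw n)
    nonzero v ne e = ne (trans (cong toℕ (trans (sym (strictlyInverseˡ i v)) (cong (to i) e)))
      (index-root (claw n)))
    toE : ∀ u v → Adj (star k) u v → E (tree (claw n)) (from i u) (from i v)
    toE u v (inj₁ (p , q)) = subst (λ r → E (tree (claw n)) r (from i v)) (sym (zero⇒root u p))
      (proj₁ (⇒E n (from i v) (nonzero v q)))
    toE u v (inj₂ (p , q)) = subst (E (tree (claw n)) (from i u)) (sym (zero⇒root v p))
      (proj₂ (⇒E n (from i u) (nonzero u q)))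

G≃t⇒⋆≃pendant : ∀ {n t} (G : Graph n) → toGr G ≃ tree t → toGr (G ⋆) ≃ tree (pendant t)
G≃t⇒⋆≃pendant {t = t} G f =
  ≃-trans (⋆≃corona G) (≃-trans (corona-cong f) (proj₁ (corona-pendant t)))

-- Well-covered trees

-- Sizes of independent sets of a rooted tree in which every non-root vertex is chosen or
-- has a chosen neighbour; the root is chosen (Chosen), not chosen but with a
-- chosen child (Covered), or neither (Free).
data Chosen : RTree → ℕ → Set
data Covered : RTree → ℕ → Set
data Free : RTree → ℕ → Set

data Chosen where
  single  : Chosen • 1
  covered : ∀ {t s i j} → Chosen t i → Covered s j → Chosen (t ⊳ s) (i ℕ.+ j)
  free    : ∀ {t s i j} → Chosen t i → Free s j → Chosen (t ⊳ s) (i ℕ.+ j)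

data Covered where
  chosenʳ  : ∀ {t s i j} → Covered t i → Chosen s j → Covered (t ⊳ s) (i ℕ.+ j)
  coveredʳ : ∀ {t s i j} → Covered t i → Covered s j → Covered (t ⊳ s) (i ℕ.+ j)
  cover    : ∀ {t s i j} → Free t i → Chosen s j → Covered (t ⊳ s) (i ℕ.+ j)

data Free where
  empty : Free • 0
  free  : ∀ {t s i j} → Free t i → Covered s j → Free (t ⊳ s) (i ℕ.+ j)

-- A free root has no chosen child, so it can be added to the set.
Free⇒Chosen : ∀ {t i} → Free t i → Chosen t (suc i)
Free⇒Chosen empty      = single
Free⇒Chosen (free f c) = covered (Free⇒Chosen f) c

-- These supply the sets whose sizes are compared. A covered root needs only one edge at the root,
-- since the last child can be chosen.
chosen : ∀ t → ∃ (Chosen t)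
unchosen : ∀ t → ∃ (Covered t) ⊎ ∃ (Free t)
coveredNode : ∀ t s → ∃ (Covered (t ⊳ s))
chosen •       = _ , single
chosen (t ⊳ s) with chosen t | unchosen s
... | _ , c | inj₁ (_ , d) = _ , covered c d
... | _ , c | inj₂ (_ , f) = _ , free c f
unchosen •       = inj₂ (_ , empty)
unchosen (t ⊳ s) = inj₁ (coveredNode t s)
coveredNode t s with unchosen t | chosen s
... | inj₁ (_ , d) | _ , c = _ , chosenʳ d c
... | inj₂ (_ , f) | _ , c = _ , cover f c

-- Deleting a chosen root and re-extending costs at most one vertex.
Chosen⇒unchosen : ∀ {t i} → Chosen t i → ∃ λ j → (Covered t j ⊎ Free t j) × i ℕ.≤ suc j
Chosen⇒unchosen single = 0 , inj₂ empty , ℕ.≤-refl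
Chosen⇒unchosen (covered {j = j} c d) with Chosen⇒unchosen c
... | k , inj₁ d′ , le = _ , inj₁ (coveredʳ d′ d) , ℕ.+-monoˡ-≤ j le
... | k , inj₂ f  , le = _ , inj₂ (free f d) , ℕ.+-monoˡ-≤ j le
Chosen⇒unchosen (free {i = i} {j} c f) with Chosen⇒unchosen c
... | k , inj₁ d  , le = _ , inj₁ (chosenʳ d (Free⇒Chosen f)) ,
  ℕ.≤-trans (ℕ.+-mono-≤ le (ℕ.n≤1+n j)) ℕ.≤-refl
... | k , inj₂ f′ , le = _ , inj₁ (cover f′ (Free⇒Chosen f)) ,
  ℕ.+-mono-≤ le (ℕ.n≤1+n j)

-- The two ways a subtree can sit in a well-covered tree: rooted at a core vertex
-- together with, respectively without, the pendant vertex of that root.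
Complete Deficient : RTree → Set
Complete t  = (∀ i → ¬ Free t i) × (∀ {i j} → Chosen t i → Covered t j → i ≡ j)
Deficient t = (∀ {i j} → Chosen t i → Covered t j → i ≡ suc j) ×
              (∀ {i j} → Chosen t i → Free t j → i ≡ suc j)

-- `graft` adds an edge between two core vertices, `addPendant` the edge from the root to its own
-- pendant vertex.
data CompleteShape : RTree → Set
data DeficientShape : RTree → Set

data CompleteShape where
  graft      : ∀ {t s} → CompleteShape t → CompleteShape s → CompleteShape (t ⊳ s)
  addPendant : ∀ {t} → DeficientShape t → CompleteShape (t ⊳ •)

data DeficientShape where
  single : DeficientShape •
  graft  : ∀ {t s} → DeficientShape t → CompleteShape s → DeficientShape (t ⊳ s)

private
  +1 : ∀ {i j} → i ℕ.+ 0 ≡ j ℕ.+ 1 → i ≡ suc j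
  +1 {i} {j} e = trans (sym (ℕ.+-identityʳ i)) (trans e (ℕ.+-comm j 1))

  off-by-one : ∀ d u → d ℕ.+ u ≢ d ℕ.+ suc u
  off-by-one d u e = ℕ.1+n≢n (sym (ℕ.+-cancelˡ-≡ d u (suc u) e))

-- Take the root of `a` chosen and that of `b` free. Choosing the root of `b` instead gains one
-- vertex there and costs at most one in `a`, so the resulting covered set is not smaller than the
-- chosen one.
deficient⇒noFree : ∀ {a b} → (∀ {i j} → Chosen (a ⊳ b) i → Covered (a ⊳ b) j → i ≡ suc j) →
  ∀ u → ¬ Free b u
deficient⇒noFree {a} c≡1+d u f with chosen a
... | i , c with Chosen⇒unchosen c
...   | j , inj₁ d , i≤1+j = ℕ.<-irrefl refl (ℕ.≤-trans
            (ℕ.≤-reflexive (sym (trans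
              (c≡1+d (free c f) (chosenʳ d (Free⇒Chosen f))) (cong suc (ℕ.+-suc j u)))))
            (ℕ.+-monoˡ-≤ u i≤1+j))
...   | j , inj₂ f′ , _ = off-by-one (suc j) u
            (c≡1+d (free (Free⇒Chosen f′) f) (cover f′ (Free⇒Chosen f)))

-- Fixing a covered set of `b` passes both conditions on to `a`. Then `a` has a chosen and a covered
-- set of equal size, and cancelling these gives the conditions for `b`.
complete⇒parts : ∀ {a b e} → Complete (a ⊳ b) → Covered b e → Complete a × Complete b
complete⇒parts {a} {b} {e} (noFree , c≡d) covB with unchosen a | chosen a
... | inj₂ (_ , f) | _ = ⊥-elim (noFree _ (free f covB))
... | inj₁ (d , covA) | i , chA =
  ((λ _ f → noFree _ (free f covB)) , c≡d-a) ,
  ( (λ u f → off-by-one d u (trans (cong (ℕ._+ u) (sym i≡d))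
      (c≡d (free chA f) (chosenʳ covA (Free⇒Chosen f)))))
  , λ {i′} {j′} c′ d′ → sym (ℕ.+-cancelˡ-≡ d j′ i′ (trans (cong (ℕ._+ j′) (sym i≡d))
      (c≡d (covered chA d′) (chosenʳ covA c′)))))
  where
  c≡d-a : ∀ {i j} → Chosen a i → Covered a j → i ≡ j
  c≡d-a {i} {j} c d = ℕ.+-cancelʳ-≡ e i j (c≡d (covered c covB) (coveredʳ d covB))
  i≡d : i ≡ d
  i≡d = c≡d-a chA covA

-- A last child that is a single vertex has no covered set and is the pendant vertex of the root;
-- any other last child has one and belongs to the core.
completeShape : ∀ t → Complete t → CompleteShape t
deficientShape : ∀ t → Deficient t → DeficientShape t

completeShape •       (noFree , _) = ⊥-elim (noFree 0 empty)
completeShape (a ⊳ •) (noFree , c≡d) = addPendant (deficientShape a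
  ( (λ c d → +1 (c≡d (free c empty) (chosenʳ d single)))
  , (λ c f → +1 (c≡d (free c empty) (cover f single)))))
completeShape (a ⊳ b@(b₁ ⊳ b₂)) complete =
  graft (completeShape a (proj₁ parts)) (completeShape b (proj₂ parts))
  where parts = complete⇒parts complete (proj₂ (coveredNode b₁ b₂))

deficientShape •       _ = single
deficientShape (a ⊳ b) (c≡1+d , c≡1+f) with unchosen b
... | inj₂ (u , f) = ⊥-elim (deficient⇒noFree c≡1+d u f)
... | inj₁ (e , covB) = graft
  (deficientShape a
    ( (λ {i} {j} c d → ℕ.+-cancelʳ-≡ e i (suc j) (c≡1+d (covered c covB) (coveredʳ d covB)))
    , (λ {i} {j} c f → ℕ.+-cancelʳ-≡ e i (suc j) (c≡1+f (covered c covB) (free f covB)))))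
  (completeShape b (deficient⇒noFree c≡1+d , c≡d))
  where
  c≡d : ∀ {i j} → Chosen b i → Covered b j → i ≡ j
  c≡d {i′} {j′} c′ d′ with unchosen a | chosen a
  ... | inj₁ (d , covA) | i , chA = ℕ.+-cancelˡ-≡ d i′ j′ (ℕ.suc-injective (trans
          (sym (c≡1+d (covered chA d′) (chosenʳ covA c′)))
          (c≡1+d (covered chA d′) (coveredʳ covA d′))))
  ... | inj₂ (v , f) | _ = sym (ℕ.+-cancelˡ-≡ (suc v) j′ i′
          (c≡1+d (covered (Free⇒Chosen f) d′) (cover f c′)))

record RootedIso (t s : RTree) : Set where
  constructor _,_
  field
    iso       : tree t ≃ tree s
    iso-root  : to iso (root t) ≡ root s

open RootedIso

shape⇒pendant : ∀ {t} → CompleteShape t → ∃ λ g → RootedIso t (pendant g)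
-- The added leaf is the pendant vertex that the root lacks; in the `graft` case `join-exchange`
-- moves it past the last child, onto the part that it completes.
shape⇒pendant′ : ∀ {t} → DeficientShape t → ∃ λ g → RootedIso (t ⊳ •) (pendant g)
shape⇒pendant (graft a b) with shape⇒pendant a | shape⇒pendant b
... | g , (f , p) | h , (f′ , p′) = g ⊳ h , (join-cong f f′ p p′ , cong inj₁ p)
shape⇒pendant (addPendant a) = shape⇒pendant′ a
shape⇒pendant′ single = • , (≃-refl , refl)
shape⇒pendant′ (graft {t} {s} a b) with shape⇒pendant′ a | shape⇒pendant b
... | g , (f , p) | h , (f′ , p′) = g ⊳ h ,
  (≃-trans (join-exchange (tree t) (root t) (tree s) (root s) (root t) (tree •) tt)
    (join-cong f f′ p p′) , cong inj₁ p)

UniformlyCovered : RTree → Set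
UniformlyCovered t = ∀ {i j} → Chosen t i ⊎ Covered t i → Chosen t j ⊎ Covered t j → i ≡ j

-- Ravindra's theorem: a well-covered tree other than K₁ is a graph star.
uniformlyCovered⇒pendant : ∀ t → t ≢ • → UniformlyCovered t →
  ∃ λ g → tree t ≃ tree (pendant g)
uniformlyCovered⇒pendant •       t≢• _ = ⊥-elim (t≢• refl)
uniformlyCovered⇒pendant (a ⊳ •) _ uc with shape⇒pendant′ (deficientShape a
  ( (λ c d → +1 (uc (inj₁ (free c empty)) (inj₂ (chosenʳ d single))))
  , (λ c f → +1 (uc (inj₁ (free c empty)) (inj₂ (cover f single))))))
... | g , (f , _) = g , f
-- The root is itself a leaf, so it is the pendant vertex of the root of `b`.
uniformlyCovered⇒pendant (• ⊳ b@(_ ⊳ _)) _ uc with shape⇒pendant′ (deficientShape b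
  ( (λ c d → uc (inj₂ (cover empty c)) (inj₁ (covered single d)))
  , (λ c f → uc (inj₂ (cover empty c)) (inj₁ (free single f)))))
... | g , (f , _) = g , ≃-trans (join-comm (tree •) _ (tree b) (root b)) f
-- Both ends of the edge have further neighbours, so both parts have covered sets; against these,
-- each part is seen to be complete.
uniformlyCovered⇒pendant (a@(a₁ ⊳ a₂) ⊳ b@(b₁ ⊳ b₂)) _ uc
  with coveredNode a₁ a₂ | coveredNode b₁ b₂
... | d , covA | e , covB with shape⇒pendant (graft
        (completeShape a (noFree-a , c≡d-a)) (completeShape b (noFree-b , c≡d-b)))
  where
  c≡d-a : ∀ {i j} → Chosen a i → Covered a j → i ≡ j
  c≡d-a {i} {j} c d = ℕ.+-cancelʳ-≡ e i j (uc (inj₁ (covered c covB)) (inj₂ (coveredʳ d covB)))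
  c≡d-b : ∀ {i j} → Chosen b i → Covered b j → i ≡ j
  c≡d-b {i} {j} c d′ = ℕ.+-cancelˡ-≡ d i j (uc (inj₂ (chosenʳ covA c)) (inj₂ (coveredʳ covA d′)))
  noFree-a : ∀ u → ¬ Free a u
  noFree-a u f with chosen b
  ... | i , c = ℕ.1+n≢n (sym (trans (ℕ.+-cancelʳ-≡ e u (suc u) (trans
      (cong (u ℕ.+_) (sym (c≡d-b c covB)))
      (uc (inj₂ (cover f c)) (inj₁ (covered (Free⇒Chosen f) covB))))) refl))
  noFree-b : ∀ u → ¬ Free b u
  noFree-b u f with chosen a
  ... | i , c = off-by-one d u (trans (cong (ℕ._+ u) (sym (c≡d-a c covA)))
      (uc (inj₁ (free c f)) (inj₂ (chosenʳ covA (Free⇒Chosen f)))))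
... | g , (f , _) = g , f

-- Subsets of rooted trees, and the maximal independent sets behind the sizes

Sub : RTree → Set
Sub •       = Bool
Sub (t ⊳ s) = Sub t × Sub s

mem : ∀ t → Sub t → V (tree t) → Bool
mem •       b       _        = b
mem (t ⊳ s) (X , Y) (inj₁ v) = mem t X v
mem (t ⊳ s) (X , Y) (inj₂ v) = mem s Y v

bit : Bool → ℕ
bit b = if b then 1 else 0

card : ∀ t → Sub t → ℕ
card •       b       = bit b
card (t ⊳ s) (X , Y) = card t X ℕ.+ card s Y

module ℕΣ = Sum ℕ.+-0-commutativeMonoid

∣tabulate∣ : ∀ {n} (h : Fin n → Bool) → Subset.∣ tabulate h ∣ ≡ ℕΣ.sum (bit ∘ h)
∣tabulate∣ {zero}  h = refl
∣tabulate∣ {suc n} h with h zero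
... | true  = cong suc (∣tabulate∣ (h ∘ suc))
... | false = ∣tabulate∣ (h ∘ suc)

sum-splitAt : ∀ m {n} (f : Fin (m ℕ.+ n) → ℕ) →
  ℕΣ.sum f ≡ ℕΣ.sum (λ i → f (i Fin.↑ˡ n)) ℕ.+ ℕΣ.sum (λ i → f (m Fin.↑ʳ i))
sum-splitAt zero    f = refl
sum-splitAt (suc m) f = trans (cong (f zero ℕ.+_) (sum-splitAt m (f ∘ suc)))
  (sym (ℕ.+-assoc (f zero) _ _))

sum-index : ∀ t X → ℕΣ.sum (λ i → bit (mem t X (Inverse.from (index t) i))) ≡ card t X
sum-index •       X = ℕ.+-identityʳ _
sum-index (t ⊳ s) (X , Y) = trans (sum-splitAt (size t) _) (cong₂ ℕ._+_
  (trans (ℕΣ.sum-cong-≗ λ i → cong (bit ∘ mem (t ⊳ s) (X , Y) ∘ ⊎.map _ _)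
    (Fin.splitAt-↑ˡ (size t) i (size s))) (sum-index t X))
  (trans (ℕΣ.sum-cong-≗ λ i → cong (bit ∘ mem (t ⊳ s) (X , Y) ∘ ⊎.map _ _)
    (Fin.splitAt-↑ʳ (size t) (size s) i)) (sum-index s Y)))

≃⇒↔ : ∀ {G H} → G ≃ H → V G ↔ V H
≃⇒↔ f = mk↔ₛ′ (to f) (from f) (to-from f) (from-to f)

module _ {n t} (f : Fin n ↔ V (tree t)) where

  -- Nested pairs suit the recursion over `t`, Boolean vectors the definitions of
  -- `MaximalIndependent` and `indepCount`; this is the passage between them.
  pull : Sub t → Subset n
  pull X = tabulate (mem t X ∘ Inverse.to f)

  ∈-pull⁺ : ∀ {X v} → mem t X (Inverse.to f v) ≡ true → v ∈ pull X
  ∈-pull⁺ {X} {v} e = Vec.lookup⇒[]= v (pull X) (trans (Vec.lookup∘tabulate _ v) e)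

  ∈-pull⁻ : ∀ {X v} → v ∈ pull X → mem t X (Inverse.to f v) ≡ true
  ∈-pull⁻ {X} {v} v∈ = trans (sym (Vec.lookup∘tabulate _ v)) (Vec.[]=⇒lookup v∈)

  ∣pull∣ : ∀ X → Subset.∣ pull X ∣ ≡ card t X
  ∣pull∣ X = trans (∣tabulate∣ (mem t X ∘ Inverse.to f))
    (trans (trans (ℕΣ.sum-cong-≗ λ i → cong (bit ∘ mem t X)
        (sym (Inverse.strictlyInverseʳ (index t) (Inverse.to f i))))
      (sym (ℕΣ.sum-permute (λ i → bit (mem t X (Inverse.from (index t) i))) (index t ↔-∘ f))))
     (sum-index t X))

Indep : ∀ t → Sub t → Set
Indep t X = ∀ u v → mem t X u ≡ true → mem t X v ≡ true → ¬ E (tree t) u v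

Dominated : ∀ t → Sub t → V (tree t) → Set
Dominated t X v = mem t X v ≡ true ⊎ ∃ λ u → mem t X u ≡ true × E (tree t) v u

-- Domination is asked away from the root only, because the root may still be dominated by the
-- vertex to which the tree will be attached.
record AlmostMaximal (t : RTree) (i : ℕ) (inRoot : Bool) : Set where
  constructor almostMaximal
  field
    set     : Sub t
    sized   : card t set ≡ i
    at-root : mem t set (root t) ≡ inRoot
    indep   : Indep t set
    others  : ∀ v → v ≢ root t → Dominated t set v

open AlmostMaximal

RootDominated : ∀ {t i r} → AlmostMaximal t i r → Set
RootDominated {t} M = Dominated t (set M) (root t)

root? : ∀ t v → Dec (v ≡ root t)
root? •       _        = yes refl
root? (t ⊳ s) (inj₁ v) with root? t v
... | yes refl = yes refl
... | no v≢r   = no λ { refl → v≢r refl }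
root? (t ⊳ s) (inj₂ v) = no λ ()

module _ {t s : RTree} {X : Sub t} {Y : Sub s} where

  dominatedˡ : ∀ {v} → Dominated t X v → Dominated (t ⊳ s) (X , Y) (inj₁ v)
  dominatedˡ (inj₁ m)           = inj₁ m
  dominatedˡ (inj₂ (u , m , e)) = inj₂ (inj₁ u , m , e)

  dominatedʳ : ∀ {v} → Dominated s Y v → Dominated (t ⊳ s) (X , Y) (inj₂ v)
  dominatedʳ (inj₁ m)           = inj₁ m
  dominatedʳ (inj₂ (u , m , e)) = inj₂ (inj₂ u , m , e)

-- After joining, the root of `s` is no longer exempt: it must be dominated inside `s` or by the
-- chosen root of `t`.
combine : ∀ {t s i j r r′} (M : AlmostMaximal t i r) (N : AlmostMaximal s j r′) →
  ¬ (r ≡ true × r′ ≡ true) → RootDominated N ⊎ r ≡ true →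
  AlmostMaximal (t ⊳ s) (i ℕ.+ j) r
combine {t} {s} {r = r} {r′} M N notBoth rootN = record
  { set     = X , Y
  ; sized   = cong₂ ℕ._+_ (sized M) (sized N)
  ; at-root = at-root M
  ; indep   = ind
  ; others  = dom }
  where
  X = set M
  Y = set N
  ind : Indep (t ⊳ s) (X , Y)
  ind (inj₁ u) (inj₁ v) p q e = indep M u v p q e
  ind (inj₂ u) (inj₂ v) p q e = indep N u v p q e
  ind (inj₁ u) (inj₂ v) p q (refl , refl) =
    notBoth (trans (sym (at-root M)) p , trans (sym (at-root N)) q)
  ind (inj₂ u) (inj₁ v) p q (refl , refl) =
    notBoth (trans (sym (at-root M)) q , trans (sym (at-root N)) p)
  root-dom : RootDominated N ⊎ r ≡ true → Dominated (t ⊳ s) (X , Y) (inj₂ (root s))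
  root-dom (inj₁ d)    = dominatedʳ {t} {s} {X} {Y} d
  root-dom (inj₂ refl) = inj₂ (inj₁ (root t) , at-root M , refl , refl)
  dom : ∀ v → v ≢ root (t ⊳ s) → Dominated (t ⊳ s) (X , Y) v
  dom (inj₁ v) v≢r = dominatedˡ {t} {s} {X} {Y} (others M v λ { refl → v≢r refl })
  dom (inj₂ v) _ with root? s v
  ... | no v≢r = dominatedʳ {t} {s} {X} {Y} (others N v v≢r)
  ... | yes refl = root-dom rootN

chosenSet : ∀ {t i} → Chosen t i → AlmostMaximal t i true
coveredSet : ∀ {t i} → Covered t i → Σ (AlmostMaximal t i false) RootDominated
freeSet : ∀ {t i} → Free t i → AlmostMaximal t i false

chosenSet single = almostMaximal true refl refl (λ _ _ _ _ ()) λ _ ne → ⊥-elim (ne refl)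
chosenSet (covered c d) = combine (chosenSet c) (proj₁ (coveredSet d)) (λ ()) (inj₂ refl)
chosenSet (free c f) = combine (chosenSet c) (freeSet f) (λ ()) (inj₂ refl)

coveredSet (chosenʳ d c) with coveredSet d
... | M , rd = combine M (chosenSet c) (λ ()) (inj₁ (inj₁ (at-root (chosenSet c)))) ,
  dominatedˡ {Y = set (chosenSet c)} rd
coveredSet (coveredʳ d d′) with coveredSet d | coveredSet d′
... | M , rd | N , rd′ = combine M N (λ ()) (inj₁ rd′) , dominatedˡ {Y = set N} rd
coveredSet (cover {s = s} f c) =
  combine (freeSet f) (chosenSet c) (λ ()) (inj₁ (inj₁ (at-root (chosenSet c)))) ,
  inj₂ (inj₂ (root s) , at-root (chosenSet c) , refl , refl)

freeSet empty = almostMaximal false refl refl (λ _ _ ()) λ _ ne → ⊥-elim (ne refl)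
freeSet (free f d) = combine (freeSet f) (proj₁ (coveredSet d)) (λ ()) (inj₁ (proj₂ (coveredSet d)))

maximalSet : ∀ {t i} → Chosen t i ⊎ Covered t i → ∃ λ X →
  card t X ≡ i × Indep t X × ∀ v → Dominated t X v
maximalSet {t} {i} c = finish (split c)
  where
  split : Chosen t i ⊎ Covered t i → ∃ λ r → Σ (AlmostMaximal t i r) RootDominated
  split (inj₁ c) = _ , chosenSet c , inj₁ (at-root (chosenSet c))
  split (inj₂ d) = _ , coveredSet d
  finish : (∃ λ r → Σ (AlmostMaximal t i r) RootDominated) → _
  finish (_ , M , rd) = set M , sized M , indep M , dom
    where
    dom : ∀ v → Dominated t (set M) v
    dom v with root? t v
    ... | yes refl = rd
    ... | no v≢r   = others M v v≢r

-- An independent set that dominates every vertex is maximal, so `WellCovered` applies to the sets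
-- realising the two sizes.
wellCovered⇒uniform : ∀ {n t} {T : Graph n} → toGr T ≃ tree t → WellCovered T →
  UniformlyCovered t
wellCovered⇒uniform {t = t} {T} f wc c d with maximalSet c | maximalSet d
... | X , refl , indX , domX | Y , refl , indY , domY =
  trans (sym (∣pull∣ φ X)) (trans (wc _ _ (maximal X indX domX) (maximal Y indY domY)) (∣pull∣ φ Y))
  where
  φ = ≃⇒↔ f
  maximal : ∀ X → Indep t X → (∀ v → Dominated t X v) → MaximalIndependent T (pull φ X)
  maximal X ind dom =
    (λ u v u∈ v∈ e → ind (to f u) (to f v) (∈-pull⁻ φ {X} u∈) (∈-pull⁻ φ {X} v∈) (to-E f e)) ,
    λ S indS X⊆S → Subset.⊆-antisym (λ {v} v∈ → S⊆X S indS X⊆S v v∈ (dom (to f v))) X⊆S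
    where
    S⊆X : ∀ S → Independent T S → pull φ X ⊆ S → ∀ v → v ∈ S → Dominated t X (to f v) → v ∈ pull φ X
    S⊆X S indS X⊆S v v∈ (inj₁ m) = ∈-pull⁺ φ {X} m
    S⊆X S indS X⊆S v v∈ (inj₂ (u , m , e)) = ⊥-elim (indS v (from f u) v∈
      (X⊆S (∈-pull⁺ φ {X} (trans (cong (mem t X) (to-from f u)) m)))
      (subst (λ w → Adj T w (from f u)) (from-to f v) (from-E f e)))

-- The inequalities for rooted trees

module OrderedField where
  open ℚBase using (_+_; _*_; _-_; -_; _<_; _≤_)
  open ℚSolver.+-*-Solver using (solve; _:+_; _:*_; _:-_; :-_; _:=_; con)

  0≤+ : ∀ {p q} → 0ℚ ≤ p → 0ℚ ≤ q → 0ℚ ≤ p + q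
  0≤+ = ℚ.+-mono-≤

  0<+ : ∀ {p q} → 0ℚ < p → 0ℚ ≤ q → 0ℚ < p + q
  0<+ = ℚ.+-mono-<-≤

  0≤* : ∀ {p q} → 0ℚ ≤ p → 0ℚ ≤ q → 0ℚ ≤ p * q
  0≤* {p} {q} 0≤p 0≤q = subst (_≤ p * q) (ℚ.*-zeroʳ p)
    (ℚ.*-monoˡ-≤-nonNeg p {{ℚ.nonNegative 0≤p}} 0≤q)

  0<* : ∀ {p q} → 0ℚ < p → 0ℚ < q → 0ℚ < p * q
  0<* {p} {q} 0<p 0<q = subst (_< p * q) (ℚ.*-zeroʳ p)
    (ℚ.*-monoʳ-<-pos p {{ℚ.positive 0<p}} 0<q)

  private
    p+[q-p] : ∀ p q → p + (q - p) ≡ q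
    p+[q-p] = solve 2 (λ p q → p :+ (q :- p) := q) refl

  p<q⇒0<q-p : ∀ {p q} → p < q → 0ℚ < q - p
  p<q⇒0<q-p {p} {q} p<q = subst (_< q - p) (ℚ.+-inverseʳ p) (ℚ.+-monoˡ-< (- p) p<q)

  p≤q⇒0≤q-p : ∀ {p q} → p ≤ q → 0ℚ ≤ q - p
  p≤q⇒0≤q-p {p} {q} p≤q = subst (_≤ q - p) (ℚ.+-inverseʳ p) (ℚ.+-monoˡ-≤ (- p) p≤q)

  0<q-p⇒p<q : ∀ {p q} → 0ℚ < q - p → p < q
  0<q-p⇒p<q {p} {q} h = subst₂ _<_ (ℚ.+-identityʳ p) (p+[q-p] p q) (ℚ.+-monoʳ-< p h)

  0≤q-p⇒p≤q : ∀ {p q} → 0ℚ ≤ q - p → p ≤ q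
  0≤q-p⇒p≤q {p} {q} h = subst₂ _≤_ (ℚ.+-identityʳ p) (p+[q-p] p q) (ℚ.+-monoʳ-≤ p h)

  0<p*q⇒0<q : ∀ {p q} → 0ℚ < p → 0ℚ < p * q → 0ℚ < q
  0<p*q⇒0<q {p} {q} 0<p h = ℚ.*-cancelˡ-<-nonNeg p {{ℚ.nonNegative (ℚ.<⇒≤ 0<p)}}
    (subst (_< p * q) (sym (ℚ.*-zeroʳ p)) h)

  *-mono-≤ : ∀ {p q r s} → 0ℚ ≤ p → 0ℚ ≤ s → p ≤ q → r ≤ s → p * r ≤ q * s
  *-mono-≤ {p} {q} {r} {s} 0≤p 0≤s p≤q r≤s = ℚ.≤-trans
    (ℚ.*-monoˡ-≤-nonNeg p {{ℚ.nonNegative 0≤p}} r≤s)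
    (ℚ.*-monoʳ-≤-nonNeg s {{ℚ.nonNegative 0≤s}} p≤q)

open OrderedField

-- N t and -D t are the independence polynomials of t restricted to the sets that omit,
-- respectively contain, the root, when every vertex of the set counts -c and every
-- other vertex counts b.
module Weights (b c : ℚ) where
  open ℚBase using (_+_; _*_; _-_; -_; _<_; _≤_)
  open ℚSolver.+-*-Solver using (solve; _:+_; _:*_; _:-_; :-_; _:=_; con)

  N D A : RTree → ℚ
  N •       = b
  N (t ⊳ s) = N t * (N s - D s)
  D •       = c
  D (t ⊳ s) = D t * N s
  A t = N t - D t

  -- Unlike positivity of `A t` alone, this passes to both parts of a join by definition.
  Good : RTree → Set
  Good •       = 0ℚ < A •
  Good (t ⊳ s) = Good t × Good s × 0ℚ < A (t ⊳ s)

  -- Deleting the joining edge admits exactly the sets that contain both roots, and these contribute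
  -- `D t * D s`.
  A-join : ∀ t s → A (t ⊳ s) ≡ A t * A s - D t * D s
  A-join t s = solve 4 (λ n d m e → n :* (m :- e) :- d :* m := (n :- d) :* (m :- e) :- d :* e)
    refl (N t) (D t) (N s) (D s)

  A-comm : ∀ t s → A (t ⊳ s) ≡ A (s ⊳ t)
  A-comm t s = solve 4 (λ n d m e → n :* (m :- e) :- d :* m := m :* (n :- d) :- e :* n)
    refl (N t) (D t) (N s) (D s)

  -- `A` belongs to the whole tree and does not see the root, although `N` and `D` do.
  A-reroot : ∀ a b s → A (a ⊳ b ⊳ s) ≡ A (b ⊳ (a ⊳ s))
  A-reroot a b s = solve 6 (λ n d m e k f →
    (n :* (m :- e)) :* (k :- f) :- (d :* m) :* k :=
    m :* (n :* (k :- f) :- d :* k) :- e :* (n :* (k :- f)))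
    refl (N a) (D a) (N b) (D b) (N s) (D s)

  Good⇒0<A : ∀ t → Good t → 0ℚ < A t
  Good⇒0<A •       g           = g
  Good⇒0<A (t ⊳ s) (_ , _ , g) = g

  -- Two paths joined at their ends form a path whose root may be an inner vertex; moving the root
  -- along it leaves `A` unchanged.
  A-lines : ∀ i j → A (line i ⊳ line j) ≡ A (line (suc (i ℕ.+ j)))
  A-lines zero    j = refl
  A-lines (suc i) j = trans (A-reroot • (line i) (line j)) (trans (A-lines i (suc j))
    (cong (λ k → A (line (suc k))) (ℕ.+-suc i j)))

  good-line : ∀ {i k} → i ℕ.≤ k → Good (line k) → Good (line i)
  good-line {i} {k} i≤k g with ℕ.m≤n⇒m<n∨m≡n i≤k
  ... | inj₂ refl = g
  good-line {i} {suc k} _ (_ , g , _) | inj₁ (s≤s i≤k) = good-line i≤k g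

  N-positive : 0ℚ < b → ∀ t → Good t → 0ℚ < N t
  N-positive 0<b •       _           = 0<b
  N-positive 0<b (t ⊳ s) (g , h , _) = 0<* (N-positive 0<b t g) (Good⇒0<A s h)

  -- The weak inequality covers the point `q = 0ℚ`, where `c` vanishes.
  D-nonNegative : 0ℚ < b → 0ℚ ≤ c → ∀ t → Good t → 0ℚ ≤ D t
  D-nonNegative 0<b 0≤c •       _           = 0≤c
  D-nonNegative 0<b 0≤c (t ⊳ s) (g , h , _) =
    0≤* (D-nonNegative 0<b 0≤c t g) (ℚ.<⇒≤ (N-positive 0<b s h))

  Good⇒Good• : ∀ t → Good t → Good •
  Good⇒Good• •       g           = g
  Good⇒Good• (t ⊳ _) (g , _ , _) = Good⇒Good• t g

  module Positive (0<b : 0ℚ < b) (0<c : 0ℚ < c) where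

    0<N : ∀ t → Good t → 0ℚ < N t
    0<N = N-positive 0<b

    0<D : ∀ t → Good t → 0ℚ < D t
    0<D •       _           = 0<c
    0<D (t ⊳ s) (g , h , _) = 0<* (0<D t g) (0<N s h)

    -- Only the part `a ⊳ s` is new. By `A-join`, `A b` times its value exceeds the value of the
    -- whole tree, which is positive.
    good-reroot : ∀ a b s → Good (a ⊳ b ⊳ s) → Good (b ⊳ (a ⊳ s))
    good-reroot a b s ((ga , gb , _) , gs , g) = gb , (ga , gs , 0<Aas) , 0<A
      where
      0<A : 0ℚ < A (b ⊳ (a ⊳ s))
      0<A = subst (0ℚ <_) (A-reroot a b s) g
      eq : A b * A (a ⊳ s) ≡ A (b ⊳ (a ⊳ s)) + D b * D (a ⊳ s)
      eq = trans (solve 2 (λ x y → x := (x :- y) :+ y) refl (A b * A (a ⊳ s)) (D b * D (a ⊳ s)))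
        (cong (_+ D b * D (a ⊳ s)) (sym (A-join b (a ⊳ s))))
      0<Aas : 0ℚ < A (a ⊳ s)
      0<Aas = 0<p*q⇒0<q (Good⇒0<A b gb) (subst (0ℚ <_) (sym eq)
        (0<+ 0<A (ℚ.<⇒≤ (0<* (0<D b gb) (0<* (0<D a ga) (0<N s gs))))))

    -- `rest` is the tree minus a leaf, rooted at the neighbour of that leaf.
    record LeafRooting (t : RTree) : Set where
      field
        rest      : RTree
        iso       : tree t ≃ tree (• ⊳ rest)
        edges-eq  : edges t ≡ suc (edges rest)
        A-eq      : A t ≡ A (• ⊳ rest)
        good-rest : Good t → Good rest

    open LeafRooting

    -- Passing the root from `a ⊳ b` to `b` shrinks the left part until it is `•`, that is, until
    -- the root is a leaf.
    leafRooting : ∀ t s → LeafRooting (t ⊳ s)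
    leafRooting •       s = record
      { rest = s ; iso = ≃-refl ; edges-eq = refl ; A-eq = refl
      ; good-rest = λ g → proj₁ (proj₂ g) }
    leafRooting (a ⊳ b) s with leafRooting b (a ⊳ s)
    ... | l = record
      { rest = rest l
      ; iso = ≃-trans (reroot a b s) (iso l)
      ; edges-eq = trans (cong suc (edge-sum (edges a) (edges b) (edges s))) (edges-eq l)
      ; A-eq = trans (A-reroot a b s) (A-eq l)
      ; good-rest = λ g → good-rest l (good-reroot a b s g) }
      where
      edge-sum : ∀ x y z → suc (x ℕ.+ y) ℕ.+ z ≡ y ℕ.+ suc (x ℕ.+ z)
      edge-sum x y z = trans (cong (λ w → suc (w ℕ.+ z)) (ℕ.+-comm x y))
        (trans (cong suc (ℕ.+-assoc y x z)) (sym (ℕ.+-suc y (x ℕ.+ z))))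

    -- The ratio `D / N` and the upper bound by the path

    private
      -- With denominators restored, `Dt/Nt * Ns/as ≥ Di/Ni * Nj/aj > D′/N′`: replacing both parts
      -- by paths does not raise the ratio, and moving the root of the resulting path to an end
      -- lowers it strictly.
      core : ∀ {Dt Ns N′ Ni aj Nt as D′ Di Nj : ℚ} →
        0ℚ < Ns → 0ℚ < N′ → 0ℚ < Ni → 0ℚ < aj → 0ℚ < Nt → 0ℚ < as → 0ℚ < Di →
        Nt * Di ≤ Dt * Ni → as * Nj ≤ Ns * aj → Ni * aj * D′ < Di * Nj * N′ →
        Nt * as * D′ < Dt * Ns * N′
      core {Dt} {Ns} {N′} {Ni} {aj} {Nt} {as} {D′} {Di} {Nj} Ns>0 N′>0 Ni>0 aj>0 Nt>0 as>0 Di>0 h₁ h₂ h₃ =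
        0<q-p⇒p<q (0<p*q⇒0<q (0<* Ni>0 aj>0) (subst (0ℚ <_) (sym eq)
          (0<+ (0<* (0<* Nt>0 as>0) (p<q⇒0<q-p h₃))
            (0≤* (ℚ.<⇒≤ N′>0) (0≤+ (0≤* (ℚ.<⇒≤ (0<* Nt>0 Di>0)) (p≤q⇒0≤q-p h₂))
              (0≤* (p≤q⇒0≤q-p h₁) (ℚ.<⇒≤ (0<* Ns>0 aj>0))))))))
        where
        eq : (Ni * aj) * (Dt * Ns * N′ - Nt * as * D′) ≡
          (Nt * as) * (Di * Nj * N′ - Ni * aj * D′) +
          N′ * ((Nt * Di) * (Ns * aj - as * Nj) + (Dt * Ni - Nt * Di) * (Ns * aj))
        eq = solve 10 (λ Dt Ns N′ Ni aj Nt as D′ Di Nj →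
          (Ni :* aj) :* (Dt :* Ns :* N′ :- Nt :* as :* D′) :=
          (Nt :* as) :* (Di :* Nj :* N′ :- Ni :* aj :* D′) :+
          N′ :* ((Nt :* Di) :* (Ns :* aj :- as :* Nj) :+ (Dt :* Ni :- Nt :* Di) :* (Ns :* aj)))
          refl Dt Ns N′ Ni aj Nt as D′ Di Nj

      exchange-eq : ∀ Ns Ds Nj Dj → Ns * (Nj - Dj) - (Ns - Ds) * Nj ≡ Ds * Nj - Ns * Dj
      exchange-eq = solve 4 (λ Ns Ds Nj Dj → Ns :* (Nj :- Dj) :- (Ns :- Ds) :* Nj := Ds :* Nj :- Ns :* Dj) refl

    -- Removing an inner root leaves two paths, removing an end leaves these paths joined by an
    -- edge; by `A-join` that edge costs `D (line i) * D (line j)`.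
    N-lines-< : ∀ i j → Good (line (suc (suc i ℕ.+ j))) →
      N (line (suc (suc i ℕ.+ j))) < N (line (suc i) ⊳ line j)
    N-lines-< i j g = 0<q-p⇒p<q (subst (0ℚ <_) (sym eq)
      (0<* 0<b (0<* (0<D _ (good-line i≤ g)) (0<D _ (good-line j≤ g)))))
      where
      i≤ : i ℕ.≤ suc (suc i ℕ.+ j)
      i≤ = ℕ.m≤n⇒m≤1+n (ℕ.m≤n⇒m≤1+n (ℕ.m≤m+n i j))
      j≤ : j ℕ.≤ suc (suc i ℕ.+ j)
      j≤ = ℕ.m≤n⇒m≤1+n (ℕ.m≤n⇒m≤1+n (ℕ.m≤n+m j i))
      eq : N (line (suc i) ⊳ line j) - N (line (suc (suc i ℕ.+ j))) ≡ b * (D (line i) * D (line j))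
      eq = trans (cong (λ z → N (line (suc i) ⊳ line j) - b * z)
          (trans (sym (A-lines i j)) (A-join (line i) (line j))))
        (solve 5 (λ b x y d e → (b :* x) :* y :- b :* (x :* y :- d :* e) := b :* (d :* e)) refl
          b (A (line i)) (A (line j)) (D (line i)) (D (line j)))

    -- The ratio D / N is smallest for the path rooted at an end; cross-multiplied.
    path-ratio : ∀ t → Good t → Good (line (edges t)) →
      N t * D (line (edges t)) < D t * N (line (edges t)) ⊎ t ≡ line (edges t)
    -- The ratio of `• ⊳ s` is `c / b` divided by one minus the ratio of `s`, hence increasing in
    -- the latter.
    path-ratio• : ∀ s → Good (• ⊳ s) → Good (line (suc (edges s))) →
      N (• ⊳ s) * D (line (suc (edges s))) < D (• ⊳ s) * N (line (suc (edges s))) ⊎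
      • ⊳ s ≡ line (suc (edges s))

    path-ratio-≤ : ∀ t → Good t → Good (line (edges t)) →
      N t * D (line (edges t)) ≤ D t * N (line (edges t))
    path-ratio-≤ t g h with path-ratio t g h
    ... | inj₁ lt = ℚ.<⇒≤ lt
    ... | inj₂ eq = ℚ.≤-reflexive (trans (cong (λ z → N z * D (line (edges t))) eq)
      (trans (ℚ.*-comm (N L) (D L)) (cong (λ z → D z * N (line (edges t))) (sym eq))))
      where L = line (edges t)

    path-ratio •       _ _ = inj₂ refl
    path-ratio (• ⊳ s) g h = path-ratio• s g h
    path-ratio (t@(t₁ ⊳ t₂) ⊳ s) (gt , gs , _) h =
      inj₁ (core {Dt = D t} (0<N s gs) (0<N (line (suc (i ℕ.+ j))) h) (0<N (line i) hi) (Good⇒0<A (line j) hj)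
        (0<N t gt) (Good⇒0<A s gs) (0<D (line i) hi)
        (path-ratio-≤ t gt hi)
        (0≤q-p⇒p≤q (subst (0ℚ ≤_) (sym (exchange-eq (N s) (D s) (N (line j)) (D (line j))))
          (p≤q⇒0≤q-p (path-ratio-≤ s gs hj))))
        (0<q-p⇒p<q (subst (0ℚ <_) (sym eq)
          (0<* (Good⇒0<A P h) (p<q⇒0<q-p (N-lines-< (edges t₁ ℕ.+ edges t₂) j h))))))
      where
      i = edges t
      j = edges s
      P = line (suc (i ℕ.+ j))
      W = line i ⊳ line j
      hi : Good (line i)
      hi = good-line (ℕ.m≤n⇒m≤1+n (ℕ.m≤m+n i j)) h
      hj : Good (line j)
      hj = good-line (ℕ.m≤n⇒m≤1+n (ℕ.m≤n+m j i)) h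
      -- `W` is the path `P` with an inner root, so `A W` equals `A P`; as `D / N` is `1 - A / N`,
      -- the larger `N` has the larger ratio.
      eq : D W * N P - N W * D P ≡ A P * (N W - N P)
      eq = trans (cong (λ z → z * N P - N W * D P) D≡) (solve 3 (λ w p d →
             (w :- (p :- d)) :* p :- w :* d := (p :- d) :* (w :- p)) refl (N W) (N P) (D P))
        where
        D≡ : D W ≡ N W - A P
        D≡ = trans (solve 2 (λ w d → d := w :- (w :- d)) refl (N W) (D W))
          (cong (λ z → N W - z) (A-lines i j))

    path-ratio• s (_ , gs , _) h with path-ratio s gs (proj₁ (proj₂ h))
    ... | inj₂ eq = inj₂ (cong (• ⊳_) eq)
    ... | inj₁ lt = inj₁ (0<q-p⇒p<q (subst (0ℚ <_) (sym eq) (0<* (0<* 0<b 0<c) (p<q⇒0<q-p lt))))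
      where
      L = line (edges s)
      eq : (c * N s) * (b * (N L - D L)) - (b * (N s - D s)) * (c * N L) ≡
        (b * c) * (D s * N L - N s * D L)
      eq = solve 6 (λ b c n d m e → (c :* n) :* (b :* (m :- e)) :- (b :* (n :- d)) :* (c :* m) :=
        (b :* c) :* (d :* m :- n :* e)) refl b c (N s) (D s) (N L) (D L)

    -- Goodness is assumed for `t` alone, so goodness of the path is part of the conclusion and of
    -- the induction.
    record PathBound (t : RTree) (e : ℕ) : Set where
      field
        good-path : Good (line e)
        bound     : A t ≤ A (line e)
        strict    : A t < A (line e) ⊎ tree t ≃ tree (line e)

    open PathBound public

    pathBound : ∀ e t → edges t ≡ e → Good t → PathBound t e
    pathBound zero    •       _ g = record { good-path = g ; bound = ℚ.≤-refl ; strict = inj₂ ≃-refl }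
    pathBound (suc e) (t ⊳ s) eq g = record
      { good-path = Good⇒Good• (t ⊳ s) g , good-path ih , 0<A′
      ; bound = ⊎.[ ℚ.<⇒≤ , (λ p → ℚ.≤-reflexive (proj₁ p)) ] result
      ; strict = ⊎.map₂ proj₂ result }
      where
      l = leafRooting t s
      r = rest l
      gr = good-rest l g
      edges-r : edges r ≡ e
      edges-r = ℕ.suc-injective (trans (sym (edges-eq l)) eq)
      ih : PathBound r e
      ih = pathBound e r edges-r gr
      good-path′ : PathBound r e → Good (line (edges r))
      good-path′ p = subst (λ k → Good (line k)) (sym edges-r) (good-path p)
      0<Ats : 0ℚ < A (• ⊳ r)
      0<Ats = subst (0ℚ <_) (A-eq l) (Good⇒0<A (t ⊳ s) g)
      X = A r
      L = line e
      ratio-≤ : N r * D L ≤ D r * N L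
      ratio-≤ = subst (λ k → N r * D (line k) ≤ D r * N (line k)) edges-r
        (path-ratio-≤ r gr (good-path′ ih))
      -- This compares `A (line (suc e)) / A L` with `A (• ⊳ r) / A r`, the factors gained from the
      -- new leaf; they differ by a positive multiple of the difference of the ratios `D / N`. The
      -- right-hand side is positive, which makes the longer path good.
      eq′ : X * A (line (suc e)) ≡ A (• ⊳ r) * A L + c * (D r * N L - N r * D L)
      eq′ = solve 6 (λ b c n d m e → (n :- d) :* (b :* (m :- e) :- c :* m) :=
        (b :* (n :- d) :- c :* n) :* (m :- e) :+ c :* (d :* m :- n :* e)) refl
        b c (N r) (D r) (N L) (D L)
      0<A′ : 0ℚ < A (line (suc e))
      0<A′ = 0<p*q⇒0<q (Good⇒0<A r gr) (subst (0ℚ <_) (sym eq′)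
        (0<+ (0<* 0<Ats (Good⇒0<A L (good-path ih))) (0≤* (ℚ.<⇒≤ 0<c) (p≤q⇒0≤q-p ratio-≤))))
      result : A (t ⊳ s) < A (line (suc e)) ⊎
               (A (t ⊳ s) ≡ A (line (suc e)) × tree (t ⊳ s) ≃ tree (line (suc e)))
      -- Without a strict ratio bound, `r` is the path rooted at its end, and the deleted leaf
      -- prolongs it at that end.
      result with path-ratio r gr (good-path′ ih)
      ... | inj₂ r≡ = inj₂ (trans (A-eq l) (cong (λ z → A (• ⊳ z)) r≡L) ,
              ≃-trans (iso l) (subst (λ z → tree (• ⊳ r) ≃ tree (• ⊳ z)) r≡L ≃-refl))
        where r≡L = trans r≡ (cong line edges-r)
      ... | inj₁ lt = inj₁ lt′
        where
        lt-L : N r * D L < D r * N L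
        lt-L = subst (λ k → N r * D (line k) < D r * N (line k)) edges-r lt
        lt′ : A (t ⊳ s) < A (line (suc e))
        lt′ = subst (_< A (line (suc e))) (sym (A-eq l)) (0<q-p⇒p<q (0<p*q⇒0<q
          (Good⇒0<A L (good-path ih)) (subst (0ℚ <_) (sym eq″)
            (0<+ (0<* 0<c (p<q⇒0<q-p lt-L)) (0≤* (p≤q⇒0≤q-p (bound ih)) (ℚ.<⇒≤ 0<A′))))))
          where
          eq″ : A L * (A (line (suc e)) - A (• ⊳ r)) ≡
            c * (D r * N L - N r * D L) + (A L - X) * A (line (suc e))
          eq″ = trans (solve 4 (λ l a x w → l :* (a :- w) := (x :* a :- w :* l) :+ (l :- x) :* a)
              refl (A L) (A (line (suc e))) X (A (• ⊳ r)))
            (cong (_+ (A L - X) * A (line (suc e))) (trans (cong (_- A (• ⊳ r) * A L) eq′)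
              (solve 2 (λ x y → (x :+ y) :- x := y) refl (A (• ⊳ r) * A L)
                (c * (D r * N L - N r * D L)))))

    -- The bound on `N` and the lower bound by the star

    pow : ℕ → ℚ
    pow zero    = 1ℚ
    pow (suc k) = A • * pow k

    pow-+ : ∀ i j → pow (i ℕ.+ j) ≡ pow i * pow j
    pow-+ zero    j = sym (ℚ.*-identityˡ _)
    pow-+ (suc i) j = trans (cong (A • *_) (pow-+ i j)) (sym (ℚ.*-assoc (A •) (pow i) (pow j)))

    -- Without its centre, `claw k` is `k` isolated vertices, each of value `A •`.
    N-claw : ∀ k → N (claw k) ≡ b * pow k
    N-claw zero    = sym (ℚ.*-identityʳ b)
    N-claw (suc k) = trans (cong (_* A •) (N-claw k))
      (trans (ℚ.*-assoc b (pow k) (A •)) (cong (b *_) (ℚ.*-comm (pow k) (A •))))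

    module _ (0<A• : 0ℚ < A •) where

      0<pow : ∀ k → 0ℚ < pow k
      0<pow zero    = ℚ.positive⁻¹ 1ℚ
      0<pow (suc k) = 0<* 0<A• (0<pow k)

      -- By `A-join` every edge lowers the value, so isolated vertices of the same number have the
      -- largest one.
      A≤pow : ∀ t → Good t → A t ≤ pow (suc (edges t))
      A<pow : ∀ t s → Good (t ⊳ s) → A (t ⊳ s) < pow (suc (edges (t ⊳ s)))
      A≤pow •       g = ℚ.≤-reflexive (sym (ℚ.*-identityʳ (A •)))
      A≤pow (t ⊳ s) g = ℚ.<⇒≤ (A<pow t s g)
      A<pow t s (gt , gs , _) = ℚ.<-≤-trans
        (0<q-p⇒p<q (subst (0ℚ <_) (sym eq) (0<* (0<D t gt) (0<D s gs))))
        (ℚ.≤-trans (*-mono-≤ (ℚ.<⇒≤ (Good⇒0<A t gt)) (ℚ.<⇒≤ (0<pow (suc (edges s)))) (A≤pow t gt) (A≤pow s gs))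
          (ℚ.≤-reflexive (trans (sym (pow-+ (suc (edges t)) (suc (edges s))))
            (cong pow (ℕ.+-suc (suc (edges t)) (edges s))))))
        where
        eq : A t * A s - A (t ⊳ s) ≡ D t * D s
        eq = trans (cong (λ z → A t * A s - z) (A-join t s))
          (solve 2 (λ x y → x :- (x :- y) := y) refl (A t * A s) (D t * D s))

      -- `N t` is `b` times the product of the values of the subtrees at the children; each is at
      -- most a power of `A •`, with equality only for a single vertex.
      N-bound : ∀ t → Good t → N t < N (claw (edges t)) ⊎ t ≡ claw (edges t)
      N-bound-≤ : ∀ t → Good t → N t ≤ N (claw (edges t))
      N-bound-≤ t g with N-bound t g
      ... | inj₁ lt = ℚ.<⇒≤ lt
      ... | inj₂ eq = ℚ.≤-reflexive (cong N eq)
      N-bound •       g = inj₂ refl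
      N-bound (t ⊳ •) (gt , gs , _) with N-bound t gt
      ... | inj₁ lt = inj₁ (subst (λ k → N t * A • < N (claw (suc k))) (sym (ℕ.+-identityʳ (edges t)))
              (ℚ.*-monoˡ-<-pos (A •) {{ℚ.positive 0<A•}} lt))
      ... | inj₂ eq = inj₂ (subst (λ k → t ⊳ • ≡ claw (suc k)) (sym (ℕ.+-identityʳ (edges t)))
              (cong (_⊳ •) eq))
      N-bound (t ⊳ s@(s₁ ⊳ s₂)) (gt , gs , _) = inj₁ (ℚ.<-≤-trans
        (ℚ.*-monoʳ-<-pos (N t) {{ℚ.positive (0<N t gt)}} (A<pow s₁ s₂ gs))
        (ℚ.≤-trans (ℚ.*-monoʳ-≤-nonNeg (pow (suc (edges s))) {{ℚ.nonNegative (ℚ.<⇒≤ (0<pow (suc (edges s))))}}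
            (N-bound-≤ t gt))
          (ℚ.≤-reflexive (trans (cong (_* pow (suc (edges s))) (N-claw (edges t)))
            (trans (ℚ.*-assoc b (pow (edges t)) (pow (suc (edges s))))
              (trans (cong (b *_) (trans (sym (pow-+ (edges t) (suc (edges s))))
                 (cong pow (ℕ.+-suc (edges t) (edges s)))))
                (sym (N-claw (suc (edges t ℕ.+ edges s))))))))))

    record StarBound (t : RTree) : Set where
      field
        good      : Good t
        star-bound  : A (claw (edges t)) ≤ A t
        star-strict : A (claw (edges t)) < A t ⊎ tree t ≃ tree (claw (edges t))

    open StarBound public

    -- Here goodness of the star is given and goodness of `t` is to be shown. The latter includes
    -- the parts of `t`, which have fewer edges; hence `edges t ≤ e` in place of an equation.
    starBound : ∀ e → Good (claw e) → ∀ t → edges t ℕ.≤ e → StarBound t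
    starBound e       g • _ = record
      { good = Good⇒Good• (claw e) g ; star-bound = ℚ.≤-refl ; star-strict = inj₂ ≃-refl }
    starBound (suc e) g@(ge , g• , 0<A) (t ⊳ s) (s≤s le) with ℕ.m≤n⇒m<n∨m≡n le
    ... | inj₁ lt = starBound e ge (t ⊳ s) lt
    ... | inj₂ eq = record
      { good = good (starBound e ge t (ℕ.m+n≤o⇒m≤o (edges t) le)) ,
               good (starBound e ge s (ℕ.m+n≤o⇒n≤o (edges t) le)) , ℚ.<-≤-trans 0<A bound-≤′
      ; star-bound = subst (λ k → A (claw (suc k)) ≤ A (t ⊳ s)) (sym eq) bound-≤′
      ; star-strict = ⊎.map (subst (λ k → A (claw (suc k)) < A (t ⊳ s)) (sym eq))
          (subst (λ k → tree (t ⊳ s) ≃ tree (claw (suc k))) (sym eq)) strict′ }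
      where
      l = leafRooting t s
      r = rest l
      edges-r : edges r ≡ e
      edges-r = trans (ℕ.suc-injective (sym (edges-eq l))) eq
      ih : StarBound r
      ih = starBound e ge r (ℕ.≤-reflexive edges-r)
      A-r : A (claw e) ≤ A r
      A-r = subst (λ k → A (claw k) ≤ A r) edges-r (star-bound ih)
      -- Both trees are rooted at a leaf, where the value `b * A r - c * N r` grows with `A r` and
      -- falls with `N r`; the star minus a leaf is extremal for both.
      diff : A (t ⊳ s) - A (claw (suc e)) ≡
        c * (N (claw e) - N r) + b * (A r - A (claw e))
      diff = trans (cong₂ _-_ (A-eq l) (A-comm (claw e) •))
        (solve 6 (λ b c n d m e → (b :* (n :- d) :- c :* n) :- (b :* (m :- e) :- c :* m) :=
          c :* (m :- n) :+ b :* ((n :- d) :- (m :- e))) refl b c (N r) (D r) (N (claw e)) (D (claw e)))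
      N-r : N r ≤ N (claw e)
      N-r = subst (λ k → N r ≤ N (claw k)) edges-r (N-bound-≤ g• r (good ih))
      bound-≤′ : A (claw (suc e)) ≤ A (t ⊳ s)
      bound-≤′ = 0≤q-p⇒p≤q (subst (0ℚ ≤_) (sym diff)
        (0≤+ (0≤* (ℚ.<⇒≤ 0<c) (p≤q⇒0≤q-p N-r)) (0≤* (ℚ.<⇒≤ 0<b) (p≤q⇒0≤q-p A-r))))
      strict′ : A (claw (suc e)) < A (t ⊳ s) ⊎ tree (t ⊳ s) ≃ tree (claw (suc e))
      strict′ with N-bound g• r (good ih)
      ... | inj₁ lt = inj₁ (0<q-p⇒p<q (subst (0ℚ <_) (sym diff)
              (0<+ (0<* 0<c (p<q⇒0<q-p (subst (λ k → N r < N (claw k)) edges-r lt)))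
                (0≤* (ℚ.<⇒≤ 0<b) (p≤q⇒0≤q-p A-r)))))
      ... | inj₂ r≡ = inj₂ (≃-trans (iso l) (≃-trans
              (join-comm (tree •) (root •) (tree r) (root r))
              (subst (λ z → tree (r ⊳ •) ≃ tree (z ⊳ •)) (trans r≡ (cong claw edges-r)) ≃-refl)))

-- Evaluation of the independence polynomial

module ℚSR = RawSemiringDefinitions ℚ.+-*-rawSemiring
module ℚΣ = Sum ℚ.+-0-commutativeMonoid

evalℚ : ∀ {n} → Graph n → ℚ → ℚ
evalℚ {n} G q = ℚΣ.sum {suc n} λ k → indepCount G (toℕ k) ℚSR.× (q ℚSR.^ toℕ k)

-- The real operations act termwise on the sequences, so `I` is the rational polynomial evaluated at
-- each approximation.
seq-I : ∀ {n} (G : Graph n) x i → seq (I G x) i ≡ evalℚ G (seq x i)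
seq-I {n} G x i = trans (seq-sum {suc n} (λ k → indepCount G (toℕ k) ×ᵣ (x ^ᵣ toℕ k))) (ℚΣ.sum-cong-≗ {suc n} λ k →
  trans (seq-× (indepCount G (toℕ k)) (x ^ᵣ toℕ k)) (cong (indepCount G (toℕ k) ℚSR.×_) (seq-^ (toℕ k))))
  where
  seq-sum : ∀ {m} (f : Fin m → ℝ) → seq (sumᵣ f) i ≡ ℚΣ.sum (λ k → seq (f k) i)
  seq-sum {zero}  f = refl
  seq-sum {suc m} f = cong (seq (f zero) i ℚ.+_) (seq-sum (f ∘ suc))
  seq-× : ∀ k y → seq (k ×ᵣ y) i ≡ k ℚSR.× seq y i
  seq-× zero    y = refl
  seq-× (suc k) y = cong (seq y i ℚ.+_) (seq-× k y)
  seq-^ : ∀ k → seq (x ^ᵣ k) i ≡ seq x i ℚSR.^ k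
  seq-^ zero    = refl
  seq-^ (suc k) = cong (seq x i ℚ.*_) (seq-^ k)

module _ where
  open ℚBase using (_+_; _*_; _-_; -_)
  open ℚSR using (_^_)
  open ℚSolver.+-*-Solver using (solve; _:+_; _:*_; _:-_; :-_; _:=_; con)

  ^-+ : ∀ q i j → q ^ (i ℕ.+ j) ≡ q ^ i * q ^ j
  ^-+ q zero    j = sym (ℚ.*-identityˡ _)
  ^-+ q (suc i) j = trans (cong (q *_) (^-+ q i j)) (sym (ℚ.*-assoc q (q ^ i) (q ^ j)))

  ∑ : ∀ {A : Set} → (A → ℚ) → List A → ℚ
  ∑ f []       = 0ℚ
  ∑ f (x ∷ xs) = f x + ∑ f xs

  module _ {A : Set} where

    ∑-cong : {f g : A → ℚ} → f ≗ g → ∀ xs → ∑ f xs ≡ ∑ g xs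
    ∑-cong e []       = refl
    ∑-cong e (x ∷ xs) = cong₂ _+_ (e x) (∑-cong e xs)

    ∑-map : ∀ {B : Set} (f : A → ℚ) (h : B → A) xs → ∑ f (List.map h xs) ≡ ∑ (f ∘ h) xs
    ∑-map f h []       = refl
    ∑-map f h (x ∷ xs) = cong (f (h x) +_) (∑-map f h xs)

    ∑-++ : ∀ (f : A → ℚ) xs ys → ∑ f (xs ++ ys) ≡ ∑ f xs + ∑ f ys
    ∑-++ f []       ys = sym (ℚ.+-identityˡ _)
    ∑-++ f (x ∷ xs) ys = trans (cong (f x +_) (∑-++ f xs ys)) (sym (ℚ.+-assoc (f x) _ _))

    ∑-+ : ∀ (f g : A → ℚ) xs → ∑ (λ x → f x + g x) xs ≡ ∑ f xs + ∑ g xs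
    ∑-+ f g []       = refl
    ∑-+ f g (x ∷ xs) = trans (cong (f x + g x +_) (∑-+ f g xs))
      (solve 4 (λ a b c d → (a :+ b) :+ (c :+ d) := (a :+ c) :+ (b :+ d)) refl (f x) (g x) _ _)

    ∑-*ˡ : ∀ k (f : A → ℚ) xs → ∑ (λ x → k * f x) xs ≡ k * ∑ f xs
    ∑-*ˡ k f []       = sym (ℚ.*-zeroʳ k)
    ∑-*ˡ k f (x ∷ xs) = trans (cong (k * f x +_) (∑-*ˡ k f xs)) (sym (ℚ.*-distribˡ-+ k (f x) _))

    ∑-↭ : ∀ (f : A → ℚ) {xs ys} → xs ↭ ys → ∑ f xs ≡ ∑ f ys
    ∑-↭ f ↭.refl         = refl
    ∑-↭ f (↭.prep x p)   = cong (f x +_) (∑-↭ f p)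
    ∑-↭ f (↭.swap x y p) = trans (cong (λ z → f x + (f y + z)) (∑-↭ f p))
      (solve 3 (λ a b c → a :+ (b :+ c) := b :+ (a :+ c)) refl (f x) (f y) _)
    ∑-↭ f (↭.trans p q)  = trans (∑-↭ f p) (∑-↭ f q)

  ∑-product : ∀ {A B : Set} (f : A → ℚ) (g : B → ℚ) xs ys →
    ∑ (λ p → f (proj₁ p) * g (proj₂ p)) (cartesianProduct xs ys) ≡ ∑ f xs * ∑ g ys
  ∑-product f g []       ys = sym (ℚ.*-zeroˡ (∑ g ys))
  ∑-product f g (x ∷ xs) ys = trans (∑-++ _ (List.map (x ,_) ys) _)
    (trans (cong₂ _+_ (trans (∑-map _ (x ,_) ys) (∑-*ˡ (f x) g ys)) (∑-product f g xs ys))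
      (sym (ℚ.*-distribʳ-+ (∑ g ys) (f x) (∑ f xs))))

  ∑-zero : ∀ n → ℚΣ.sum {n} (λ _ → 0ℚ) ≡ 0ℚ
  ∑-zero zero    = refl
  ∑-zero (suc n) = trans (ℚ.+-identityˡ _) (∑-zero n)

  ∑-indicator : ∀ {n} j → j ℕ.< n → (f : ℕ → ℚ) →
    ℚΣ.sum {n} (λ k → if does (j ℕ.≟ toℕ k) then f (toℕ k) else 0ℚ) ≡ f j
  ∑-indicator {suc n} zero    _         f = trans (cong (f 0 +_) (∑-zero n)) (ℚ.+-identityʳ (f 0))
  ∑-indicator {suc n} (suc j) (s≤s j<n) f = trans (ℚ.+-identityˡ _) (∑-indicator j j<n (f ∘ suc))

  -- This undoes the grouping by size: an independent set contributes for one `k` only, and having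
  -- at most `n` elements it falls within the range of the sum.
  evalℚ-∑ : ∀ {n} (G : Graph n) q → evalℚ G q ≡
    ∑ (λ S → if does (independent? G S) then q ^ Subset.∣ S ∣ else 0ℚ) (subsets n)
  evalℚ-∑ {n} G q = go (subsets n)
    where
    count : List (Subset n) → ℕ → ℕ
    count L k = length (filter (λ S → independent? G S ×-dec (Subset.∣ S ∣ ℕ.≟ k)) L)
    count-∷ : ∀ S L k → count (S ∷ L) k ℚSR.× (q ^ k) ≡
      (if does (independent? G S) then (if does (Subset.∣ S ∣ ℕ.≟ k) then q ^ k else 0ℚ) else 0ℚ)
      + count L k ℚSR.× (q ^ k)
    count-∷ S L k with does (independent? G S) | does (Subset.∣ S ∣ ℕ.≟ k)
    ... | true  | true  = refl
    ... | true  | false = sym (ℚ.+-identityˡ _)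
    ... | false | _     = sym (ℚ.+-identityˡ _)
    outer : ∀ S → ℚΣ.sum {suc n} (λ k →
      if does (independent? G S) then (if does (Subset.∣ S ∣ ℕ.≟ toℕ k) then q ^ toℕ k else 0ℚ) else 0ℚ)
      ≡ (if does (independent? G S) then q ^ Subset.∣ S ∣ else 0ℚ)
    outer S with does (independent? G S)
    ... | true  = ∑-indicator Subset.∣ S ∣ (s≤s (Subset.∣p∣≤n S)) (q ^_)
    ... | false = ∑-zero (suc n)
    go : ∀ L → ℚΣ.sum {suc n} (λ k → count L (toℕ k) ℚSR.× (q ^ toℕ k)) ≡
      ∑ (λ S → if does (independent? G S) then q ^ Subset.∣ S ∣ else 0ℚ) L
    go []      = ∑-zero (suc n)
    go (S ∷ L) = trans (ℚΣ.sum-cong-≗ {suc n} λ k → count-∷ S L (toℕ k))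
      (trans (ℚΣ.∑-distrib-+ {suc n}
          (λ k → if does (independent? G S) then (if does (Subset.∣ S ∣ ℕ.≟ toℕ k) then q ^ toℕ k else 0ℚ) else 0ℚ)
          (λ k → count L (toℕ k) ℚSR.× (q ^ toℕ k)))
        (cong₂ _+_ (outer S) (go L)))

-- Summation over the subsets of a rooted tree

unique-subsets : ∀ n → Unique (subsets n)
unique-subsets zero    = [] ∷ []
unique-subsets (suc n) = Unique.++⁺ (Unique.map⁺ Vec.∷-injectiveʳ (unique-subsets n))
  (Unique.map⁺ Vec.∷-injectiveʳ (unique-subsets n)) disjoint
  where
  disjoint : ∀ {S} → ¬ (S List.∈ List.map (false ∷_) (subsets n) × S List.∈ List.map (true ∷_) (subsets n))
  disjoint (p , q) with List.∈-map⁻ (false ∷_) p | List.∈-map⁻ (true ∷_) q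
  ... | _ , _ , refl | _ , _ , ()

∈-subsets : ∀ {n} (S : Subset n) → S List.∈ subsets n
∈-subsets []                    = here refl
∈-subsets {suc n} (false ∷ S) = List.∈-++⁺ˡ (List.∈-map⁺ (false ∷_) (∈-subsets S))
∈-subsets {suc n} (true ∷ S)  = List.∈-++⁺ʳ (List.map (false ∷_) (subsets n)) (List.∈-map⁺ (true ∷_) (∈-subsets S))

subs : ∀ t → List (Sub t)
subs •       = false ∷ true ∷ []
subs (t ⊳ s) = cartesianProduct (subs t) (subs s)

unique-subs : ∀ t → Unique (subs t)
unique-subs •       = ((λ ()) ∷ []) ∷ ([] ∷ [])
unique-subs (t ⊳ s) = Unique.cartesianProduct⁺ (unique-subs t) (unique-subs s)

∈-subs : ∀ t X → X List.∈ subs t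
∈-subs •       false   = here refl
∈-subs •       true    = there (here refl)
∈-subs (t ⊳ s) (X , Y) = List.∈-cartesianProduct⁺ (∈-subs t X) (∈-subs s Y)

comprehension : ∀ t → (V (tree t) → Bool) → Sub t
comprehension •       χ = χ tt
comprehension (t ⊳ s) χ = comprehension t (χ ∘ inj₁) , comprehension s (χ ∘ inj₂)

mem-comprehension : ∀ t χ v → mem t (comprehension t χ) v ≡ χ v
mem-comprehension •       χ tt       = refl
mem-comprehension (t ⊳ s) χ (inj₁ v) = mem-comprehension t (χ ∘ inj₁) v
mem-comprehension (t ⊳ s) χ (inj₂ v) = mem-comprehension s (χ ∘ inj₂) v

mem-injective : ∀ t {X Y} → mem t X ≗ mem t Y → X ≡ Y
mem-injective •       e = e tt
mem-injective (t ⊳ s) e = cong₂ _,_ (mem-injective t (e ∘ inj₁)) (mem-injective s (e ∘ inj₂))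

-- Allows the two enumerations of subsets to be compared without relating their orders.
unique∧complete⇒↭ : ∀ {A : Set} {xs ys : List A} → Unique xs → Unique ys →
  (∀ x → x List.∈ xs) → (∀ x → x List.∈ ys) → xs ↭ ys
unique∧complete⇒↭ u v p q = ∼bag⇒↭ (unique∧set⇒bag u v (λ {x} → mk⇔ (λ _ → q x) (λ _ → p x)))

subsets↭pull : ∀ {n t} (f : Fin n ↔ V (tree t)) → subsets n ↭ List.map (pull f) (subs t)
subsets↭pull {n} {t} f = unique∧complete⇒↭ (unique-subsets n)
  (Unique.map⁺ (λ {X} {Y} → injective X Y) (unique-subs t)) ∈-subsets complete
  where
  injective : ∀ X Y → pull f X ≡ pull f Y → X ≡ Y
  injective X Y e = mem-injective t λ v → trans (sym (at X v)) (trans (cong (λ S → lookup S (Inverse.from f v)) e) (at Y v))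
    where
    at : ∀ X v → lookup (pull f X) (Inverse.from f v) ≡ mem t X v
    at X v = trans (Vec.lookup∘tabulate _ (Inverse.from f v)) (cong (mem t X) (Inverse.strictlyInverseˡ f v))
  complete : ∀ S → S List.∈ List.map (pull f) (subs t)
  complete S = subst (List._∈ List.map (pull f) (subs t)) eq (List.∈-map⁺ (pull f) (∈-subs t X))
    where
    X = comprehension t (λ v → lookup S (Inverse.from f v))
    eq : pull f X ≡ S
    eq = trans (Vec.tabulate-cong λ i → trans (mem-comprehension t _ (Inverse.to f i))
      (cong (lookup S) (Inverse.strictlyInverseʳ f i))) (Vec.tabulate∘lookup S)

-- A Boolean recursion rather than a decision of `Indep`: its conjunctions are what makes the
-- weights factor over a join.
indep? : ∀ t → Sub t → Bool
indep? •       _       = true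
indep? (t ⊳ s) (X , Y) =
  indep? t X ∧ (indep? s Y ∧ not (mem t X (root t) ∧ mem s Y (root s)))

private
  ∧-true : ∀ {x y} → x ∧ y ≡ true → x ≡ true × y ≡ true
  ∧-true {true} {true} _ = refl , refl

  not-both : ∀ {x y} → x ≡ true → y ≡ true → not (x ∧ y) ≢ true
  not-both refl refl ()

indep?⇒Indep : ∀ t X → indep? t X ≡ true → Indep t X
indep?⇒Indep (t ⊳ s) (X , Y) e with ∧-true e
... | eX , e′ with ∧-true e′
...   | eY , ne = ind
  where
  ind : Indep (t ⊳ s) (X , Y)
  ind (inj₁ u) (inj₁ v) = indep?⇒Indep t X eX u v
  ind (inj₂ u) (inj₂ v) = indep?⇒Indep s Y eY u v
  ind (inj₁ u) (inj₂ v) p q (refl , refl) = not-both p q ne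
  ind (inj₂ u) (inj₁ v) p q (refl , refl) = not-both q p ne

Indep⇒indep? : ∀ t X → Indep t X → indep? t X ≡ true
Indep⇒indep? •       X       _   = refl
Indep⇒indep? (t ⊳ s) (X , Y) ind
  rewrite Indep⇒indep? t X (λ u v → ind (inj₁ u) (inj₁ v))
        | Indep⇒indep? s Y (λ u v → ind (inj₂ u) (inj₂ v))
  with mem t X (root t) in p | mem s Y (root s) in q
... | false | _     = refl
... | true  | false = refl
... | true  | true  = ⊥-elim (ind (inj₁ (root t)) (inj₂ (root s)) p q (refl , refl))

does-independent : ∀ {n t} (T : Graph n) (f : toGr T ≃ tree t) X →
  does (independent? T (pull (≃⇒↔ f) X)) ≡ indep? t X
does-independent {t = t} T f X with indep? t X in eq
... | true  = dec-true (independent? T _) λ u v u∈ v∈ e →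
  indep?⇒Indep t X eq (to f u) (to f v) (∈-pull⁻ φ {X} u∈) (∈-pull⁻ φ {X} v∈) (to-E f e)
  where φ = ≃⇒↔ f
... | false = dec-false (independent? T _) λ ind →
  case-false (trans (sym eq) (Indep⇒indep? t X λ u v p q e → ind (from f u) (from f v)
    (∈-pull⁺ φ {X} (trans (cong (mem t X) (to-from f u)) p))
    (∈-pull⁺ φ {X} (trans (cong (mem t X) (to-from f v)) q)) (from-E f e)))
  where
  φ = ≃⇒↔ f
  case-false : false ≢ true
  case-false ()

-- The weights with which I(G⋆,q) is computed on G itself.
module At (q : ℚ) = Weights (1ℚ ℚ.+ q) (ℚ.- q)

module _ (q : ℚ) where
  open ℚBase using (_+_; _*_; _-_; -_)
  open ℚSR using (_^_)
  -- Unlike in `At`, an unchosen vertex counts 1: these weights evaluate the tree itself and are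
  -- applied to `pendant t` below.
  open Weights 1ℚ (- q)
  open ℚSolver.+-*-Solver using (solve; _:+_; _:*_; _:-_; :-_; _:=_; con)

  weight weightOut weightIn : ∀ t → Sub t → ℚ
  weight    t X = if indep? t X then q ^ card t X else 0ℚ
  weightOut t X = if indep? t X ∧ not (mem t X (root t)) then q ^ card t X else 0ℚ
  weightIn  t X = if indep? t X ∧ mem t X (root t) then q ^ card t X else 0ℚ

  weight-split : ∀ t X → weight t X ≡ weightOut t X + weightIn t X
  weight-split t X with indep? t X | mem t X (root t)
  ... | false | _     = refl
  ... | true  | false = sym (ℚ.+-identityʳ _)
  ... | true  | true  = sym (ℚ.+-identityˡ _)

  private
    if-* : ∀ o p x y →
      (if o ∧ p then x * y else 0ℚ) ≡ (if o then x else 0ℚ) * (if p then y else 0ℚ)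
    if-* true  true  x y = refl
    if-* true  false x y = sym (ℚ.*-zeroʳ x)
    if-* false p     x y = sym (ℚ.*-zeroˡ (if p then y else 0ℚ))

    out-bool : ∀ o p r s → (o ∧ (p ∧ not (r ∧ s))) ∧ not r ≡ (o ∧ not r) ∧ p
    out-bool false _     _     _     = refl
    out-bool true  false false _     = refl
    out-bool true  false true  _     = refl
    out-bool true  true  false _     = refl
    out-bool true  true  true  false = refl
    out-bool true  true  true  true  = refl

    in-bool : ∀ o p r s → (o ∧ (p ∧ not (r ∧ s))) ∧ r ≡ (o ∧ r) ∧ (p ∧ not s)
    in-bool false _     _     _     = refl
    in-bool true  false false _     = refl
    in-bool true  false true  _     = refl
    in-bool true  true  false _     = refl
    in-bool true  true  true  false = refl
    in-bool true  true  true  true  = refl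

  weightOut-⊳ : ∀ t s X Y → weightOut (t ⊳ s) (X , Y) ≡ weightOut t X * weight s Y
  weightOut-⊳ t s X Y = trans
    (cong₂ (λ o z → if o then z else 0ℚ)
      (out-bool (indep? t X) (indep? s Y) (mem t X (root t)) (mem s Y (root s)))
      (^-+ q (card t X) (card s Y)))
    (if-* (indep? t X ∧ not (mem t X (root t))) (indep? s Y) (q ^ card t X) (q ^ card s Y))

  weightIn-⊳ : ∀ t s X Y → weightIn (t ⊳ s) (X , Y) ≡ weightIn t X * weightOut s Y
  weightIn-⊳ t s X Y = trans
    (cong₂ (λ o z → if o then z else 0ℚ)
      (in-bool (indep? t X) (indep? s Y) (mem t X (root t)) (mem s Y (root s)))
      (^-+ q (card t X) (card s Y)))
    (if-* (indep? t X ∧ mem t X (root t)) (indep? s Y ∧ not (mem s Y (root s)))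
      (q ^ card t X) (q ^ card s Y))

  ∑-weightOut : ∀ t → ∑ (weightOut t) (subs t) ≡ N t
  ∑-weightIn : ∀ t → ∑ (weightIn t) (subs t) ≡ - D t
  ∑-weight : ∀ t → ∑ (weight t) (subs t) ≡ A t
  ∑-weight t = trans (∑-cong (weight-split t) (subs t))
    (trans (∑-+ (weightOut t) (weightIn t) (subs t)) (cong₂ _+_ (∑-weightOut t) (∑-weightIn t)))
  ∑-weightOut •       = refl
  ∑-weightOut (t ⊳ s) = trans (∑-cong (λ p → weightOut-⊳ t s (proj₁ p) (proj₂ p)) (subs (t ⊳ s)))
    (trans (∑-product (weightOut t) (weight s) (subs t) (subs s))
      (cong₂ _*_ (∑-weightOut t) (∑-weight s)))
  ∑-weightIn •       = solve 1 (λ x → con 0ℚ :+ (x :* con 1ℚ :+ con 0ℚ) := :- (:- x)) refl q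
  ∑-weightIn (t ⊳ s) = trans (∑-cong (λ p → weightIn-⊳ t s (proj₁ p) (proj₂ p)) (subs (t ⊳ s)))
    (trans (∑-product (weightIn t) (weightOut s) (subs t) (subs s))
      (trans (cong₂ _*_ (∑-weightIn t) (∑-weightOut s)) (sym (ℚ.neg-distribˡ-* (D t) (N s)))))

  evalℚ-tree : ∀ {n t} (T : Graph n) → toGr T ≃ tree t → evalℚ T q ≡ A t
  evalℚ-tree {n} {t} T f = trans (evalℚ-∑ T q) (trans (∑-↭ weight′ (subsets↭pull {t = t} (≃⇒↔ f)))
    (trans (∑-map weight′ (pull (≃⇒↔ f)) (subs t)) (trans (∑-cong pointwise (subs t)) (∑-weight t))))
    where
    weight′ : Subset n → ℚ
    weight′ S = if does (independent? T S) then q ^ Subset.∣ S ∣ else 0ℚ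
    pointwise : ∀ X → weight′ (pull (≃⇒↔ f) X) ≡ weight t X
    pointwise X = cong₂ (λ o k → if o then q ^ k else 0ℚ) (does-independent T f X) (∣pull∣ (≃⇒↔ f) X)

  -- An unchosen core vertex leaves its pendant vertex optional and contributes `1 + q`; a chosen
  -- one excludes it and contributes `q`.
  N-pendant : ∀ t → N (pendant t) ≡ At.N q t
  D-pendant : ∀ t → D (pendant t) ≡ At.D q t
  N-pendant •       = solve 1 (λ x → con 1ℚ :* (con 1ℚ :- :- x) := con 1ℚ :+ x) refl q
  N-pendant (t ⊳ s) = cong₂ _*_ (N-pendant t) (cong₂ _-_ (N-pendant s) (D-pendant s))
  D-pendant •       = ℚ.*-identityʳ (- q)
  D-pendant (t ⊳ s) = cong₂ _*_ (D-pendant t) (N-pendant s)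

  evalℚ-pendant : ∀ {n t} (T : Graph n) → toGr T ≃ tree (pendant t) → evalℚ T q ≡ At.A q t
  evalℚ-pendant {t = t} T f = trans (evalℚ-tree T f) (cong₂ _-_ (N-pendant t) (D-pendant t))

-- Every tree is a rooted tree

module _ {G : Gr} where

  data Walk : V G → V G → Set where
    [_] : ∀ u → Walk u u
    _∷_ : ∀ {u w v} → E G u w → Walk w v → Walk u v

  steps : ∀ {u v} → Walk u v → ℕ
  steps [ u ]   = 0
  steps (e ∷ p) = suc (steps p)

  at : ∀ {u v} (p : Walk u v) → Fin (suc (steps p)) → V G
  at {u} p       zero    = u
  at     (e ∷ p) (suc i) = at p i

  _∉_ : ∀ {u v} → V G → Walk u v → Set
  x ∉ [ u ]         = x ≢ u
  x ∉ (_∷_ {u} e p) = x ≢ u × x ∉ p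

  Simple : ∀ {u v} → Walk u v → Set
  Simple [ u ]         = ⊤
  Simple (_∷_ {u} e p) = u ∉ p × Simple p

  Disjoint : ∀ {u v u′ v′} → Walk u v → Walk u′ v′ → Set
  Disjoint [ u ]         q = u ∉ q
  Disjoint (_∷_ {u} e p) q = u ∉ q × Disjoint p q

  ∉⇒≢ : ∀ {x u v} (p : Walk u v) → x ∉ p → ∀ i → x ≢ at p i
  ∉⇒≢ [ u ]   x≢u       zero    = x≢u
  ∉⇒≢ (e ∷ p) (x≢u , _) zero    = x≢u
  ∉⇒≢ (e ∷ p) (_ , x∉p) (suc i) = ∉⇒≢ p x∉p i

  at-injective : ∀ {u v} (p : Walk u v) → Simple p → ∀ i j → at p i ≡ at p j → i ≡ j
  at-injective p       _         zero    zero    _ = refl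
  at-injective (e ∷ p) (u∉p , _) zero    (suc j) q = ⊥-elim (∉⇒≢ p u∉p j q)
  at-injective (e ∷ p) (u∉p , _) (suc i) zero    q = ⊥-elim (∉⇒≢ p u∉p i (sym q))
  at-injective (e ∷ p) (_ , s)   (suc i) (suc j) q = cong suc (at-injective p s i j q)

  at-step : ∀ {u v} (p : Walk u v) (i : Fin (steps p)) → E G (at p (inject₁ i)) (at p (suc i))
  at-step (e ∷ p) zero    = first e p
    where
    first : ∀ {u w v} → E G u w → (p : Walk w v) → E G u (at p zero)
    first e [ u ]   = e
    first e (_ ∷ _) = e
  at-step (e ∷ p) (suc i) = at-step p i

  at-last : ∀ {u v} (p : Walk u v) → at p (fromℕ (steps p)) ≡ v
  at-last [ u ]   = refl
  at-last (e ∷ p) = at-last p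

  append : ∀ {u a b v} → Walk u a → E G a b → Walk b v → Walk u v
  append [ u ]   e q = e ∷ q
  append (f ∷ p) e q = f ∷ append p e q

  ∉-append : ∀ {x u a b v} (p : Walk u a) (e : E G a b) (q : Walk b v) →
    x ∉ p → x ∉ q → x ∉ append p e q
  ∉-append [ u ]   e q x≢u       x∉q = x≢u , x∉q
  ∉-append (f ∷ p) e q (x≢u , h) x∉q = x≢u , ∉-append p e q h x∉q

  simple-append : ∀ {u a b v} (p : Walk u a) (e : E G a b) (q : Walk b v) →
    Simple p → Simple q → Disjoint p q → Simple (append p e q)
  simple-append [ u ]   e q _       s d       = d , s
  simple-append (f ∷ p) e q (h , r) s (k , d) = ∉-append p e q h k , simple-append p e q r s d

module _ {G H : Gr} (f : V G → V H) (f-E : ∀ {u v} → E G u v → E H (f u) (f v)) where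

  mapWalk : ∀ {u v} → Walk {G} u v → Walk {H} (f u) (f v)
  mapWalk [ u ]   = [ f u ]
  mapWalk (e ∷ p) = f-E e ∷ mapWalk p

  ∉-map : (∀ {x y} → f x ≡ f y → x ≡ y) → ∀ {x u v} (p : Walk {G} u v) → x ∉ p → f x ∉ mapWalk p
  ∉-map inj [ u ]   x≢u       = λ e → x≢u (inj e)
  ∉-map inj (e ∷ p) (x≢u , h) = (λ e → x≢u (inj e)) , ∉-map inj p h

  simple-map : (∀ {x y} → f x ≡ f y → x ≡ y) → ∀ {u v} (p : Walk {G} u v) → Simple p → Simple (mapWalk p)
  simple-map inj [ u ]   _       = tt
  simple-map inj (e ∷ p) (h , s) = ∉-map inj p h , simple-map inj p s

  ∉-range : ∀ {y} → (∀ x → y ≢ f x) → ∀ {u v} (p : Walk {G} u v) → y ∉ mapWalk p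
  ∉-range ne [ u ]   = ne u
  ∉-range ne (e ∷ p) = ne _ , ∉-range ne p

disjoint-maps : ∀ {G G′ H : Gr} (f : V G → V H) (f-E : ∀ {u v} → E G u v → E H (f u) (f v))
  (g : V G′ → V H) (g-E : ∀ {u v} → E G′ u v → E H (g u) (g v)) → (∀ x y → f x ≢ g y) →
  ∀ {u v u′ v′} (p : Walk {G} u v) (q : Walk {G′} u′ v′) →
  Disjoint {H} (mapWalk {G} {H} f f-E p) (mapWalk {G′} {H} g g-E q)
disjoint-maps f f-E g g-E ne [ u ]   q = ∉-range g g-E (ne u) q
disjoint-maps f f-E g g-E ne (e ∷ p) q = ∉-range g g-E (ne _) q , disjoint-maps f f-E g g-E ne p q

inj₁-injective : ∀ {A B : Set} {x y : A} → _≡_ {A = A ⊎ B} (inj₁ x) (inj₁ y) → x ≡ y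
inj₁-injective refl = refl

inj₂-injective : ∀ {A B : Set} {x y : B} → _≡_ {A = A ⊎ B} (inj₂ x) (inj₂ y) → x ≡ y
inj₂-injective refl = refl

-- The walk uses the joining edge at most once, and its two halves lie in different summands, hence
-- are disjoint.
simpleWalk : ∀ t u v → Σ (Walk {tree t} u v) Simple
simpleWalk •       u v = [ tt ] , tt
simpleWalk (t ⊳ s) (inj₁ u) (inj₁ v) with simpleWalk t u v
... | p , h = mapWalk inj₁ (λ e → e) p , simple-map inj₁ (λ e → e) inj₁-injective p h
simpleWalk (t ⊳ s) (inj₂ u) (inj₂ v) with simpleWalk s u v
... | p , h = mapWalk inj₂ (λ e → e) p , simple-map inj₂ (λ e → e) inj₂-injective p h
simpleWalk (t ⊳ s) (inj₁ u) (inj₂ v) with simpleWalk t u (root t) | simpleWalk s (root s) v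
... | p , h | q , k = append (mapWalk inj₁ (λ e → e) p) (refl , refl) (mapWalk inj₂ (λ e → e) q) ,
  simple-append _ _ _ (simple-map inj₁ (λ e → e) inj₁-injective p h)
    (simple-map inj₂ (λ e → e) inj₂-injective q k) (disjoint-maps {H = tree (t ⊳ s)} inj₁ (λ e → e) inj₂ (λ e → e) (λ _ _ ()) p q)
simpleWalk (t ⊳ s) (inj₂ u) (inj₁ v) with simpleWalk s u (root s) | simpleWalk t (root t) v
... | p , h | q , k = append (mapWalk inj₂ (λ e → e) p) (refl , refl) (mapWalk inj₁ (λ e → e) q) ,
  simple-append _ _ _ (simple-map inj₂ (λ e → e) inj₂-injective p h)
    (simple-map inj₁ (λ e → e) inj₁-injective q k) (disjoint-maps {H = tree (t ⊳ s)} inj₂ (λ e → e) inj₁ (λ e → e) (λ _ _ ()) p q)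

-- A new vertex may hang at any `w`, while `⊳` joins at roots only. The root is preserved so that
-- the result can replace a part of a larger tree.
record Graft (t : RTree) (w : V (tree t)) (s : RTree) : Set where
  field
    grafted    : RTree
    graft-iso  : join (tree t) w (tree s) (root s) ≃ tree grafted
    graft-root : to graft-iso (inj₁ (root t)) ≡ root grafted
    graft-size : size grafted ≡ size t ℕ.+ size s

open Graft

graftAt : ∀ t w s → Graft t w s
graftAt •       w        s = record
  { grafted = • ⊳ s ; graft-iso = ≃-refl ; graft-root = refl ; graft-size = refl }
graftAt (a ⊳ b) (inj₁ w) s = record
  { grafted = grafted g ⊳ b
  ; graft-iso = ≃-trans (join-exchange (tree a) (root a) (tree b) (root b) w (tree s) (root s))
      (join-cong (graft-iso g) ≃-refl (graft-root g) refl)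
  ; graft-root = cong inj₁ (graft-root g)
  ; graft-size = trans (cong (ℕ._+ size b) (graft-size g)) (trans (ℕ.+-assoc (size a) _ _)
      (trans (cong (size a ℕ.+_) (ℕ.+-comm (size s) (size b))) (sym (ℕ.+-assoc (size a) _ _)))) }
  where g = graftAt a w s
graftAt (a ⊳ b) (inj₂ w) s = record
  { grafted = a ⊳ grafted g
  ; graft-iso = ≃-trans (join-assoc (tree a) (root a) (tree b) (root b) w (tree s) (root s))
      (join-cong ≃-refl (graft-iso g) refl (graft-root g))
  ; graft-root = refl
  ; graft-size = trans (cong (size a ℕ.+_) (graft-size g)) (sym (ℕ.+-assoc (size a) _ _)) }
  where g = graftAt b w s

-- An induced subgraph: `reflect-E` is what turns an embedding onto all vertices into an
-- isomorphism.
record Embedding {m} (G : Gr) (T : Graph m) : Set where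
  field
    place     : V G → Fin m
    injective : ∀ {x y} → place x ≡ place y → x ≡ y
    place-E   : ∀ {x y} → E G x y → Adj T (place x) (place y)
    reflect-E : ∀ {x y} → Adj T (place x) (place y) → E G x y

open Embedding

embedding-≃ : ∀ {m G H} {T : Graph m} → G ≃ H → Embedding G T → Embedding H T
embedding-≃ {H = H} f ι = record
  { place = λ y → place ι (from f y)
  ; injective = λ {x} {y} e → trans (sym (to-from f x)) (trans (cong (to f) (injective ι e)) (to-from f y))
  ; place-E = λ e → place-E ι (from-E f e)
  ; reflect-E = λ {x} {y} e → subst₂ (E H) (to-from f x) (to-from f y) (to-E f (reflect-E ι e)) }

any? : ∀ t {P : V (tree t) → Set} → (∀ v → Dec (P v)) → Dec (∃ P)
any? •       P? = map′ (tt ,_) (λ { (tt , p) → p }) (P? tt)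
any? (t ⊳ s) P? with any? t (λ v → P? (inj₁ v)) | any? s (λ v → P? (inj₂ v))
... | yes (v , p) | _           = yes (inj₁ v , p)
... | no _        | yes (v , p) = yes (inj₂ v , p)
... | no ¬p       | no ¬q       = no λ { (inj₁ v , p) → ¬p (v , p) ; (inj₂ v , p) → ¬q (v , p) }

module _ {m} {T : Graph m} (acyclic : ¬ Cycle T) where

  -- Two neighbours of v in a connected induced subgraph avoiding v would close a cycle.
  cycle : ∀ {t} (ι : Embedding (tree t) T) {v x y} → (∀ z → v ≢ place ι z) →
    Adj T v (place ι x) → Adj T v (place ι y) → x ≡ y
  cycle {t} ι {v} {x} {y} v∉ ex ey with simpleWalk t x y
  ... | [ _ ]   , _ = refl
  ... | (e ∷ p) , s = ⊥-elim (acyclic record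
    { k = steps p
    ; vertex = vertex
    ; distinct = distinct
    ; step = step
    ; close = adj-sym T (subst (λ z → Adj T v (place ι z)) (sym (at-last (e ∷ p))) ey) })
    where
    vertex : Fin (3 ℕ.+ steps p) → Fin m
    vertex zero    = v
    vertex (suc i) = place ι (at (e ∷ p) i)
    distinct : ∀ i j → vertex i ≡ vertex j → i ≡ j
    distinct zero    zero    _ = refl
    distinct zero    (suc j) q = ⊥-elim (v∉ _ q)
    distinct (suc i) zero    q = ⊥-elim (v∉ _ (sym q))
    distinct (suc i) (suc j) q = cong suc (at-injective (e ∷ p) s i j (injective ι q))
    step : ∀ (i : Fin (2 ℕ.+ steps p)) → Adj T (vertex (inject₁ i)) (vertex (suc i))
    step zero    = ex
    step (suc i) = place-E ι (at-step (e ∷ p) i)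

  -- By `cycle` the new vertex has no neighbour in the image other than `u`, so the enlarged
  -- subgraph is again induced.
  extend : ∀ {t} (ι : Embedding (tree t) T) {u v} → (∀ z → v ≢ place ι z) →
    Adj T (place ι u) v → Embedding (join (tree t) u (tree •) tt) T
  extend {t} ι {u} {v} v∉ e = record
    { place = place′
    ; injective = λ {x} {y} → injective′ x y
    ; place-E = λ {x} {y} → placeE x y
    ; reflect-E = λ {x} {y} → reflectE x y }
    where
    place′ : V (tree t) ⊎ ⊤ → Fin m
    place′ (inj₁ x) = place ι x
    place′ (inj₂ _) = v
    injective′ : ∀ x y → place′ x ≡ place′ y → x ≡ y
    injective′ (inj₁ x) (inj₁ y) q = cong inj₁ (injective ι q)
    injective′ (inj₁ x) (inj₂ y) q = ⊥-elim (v∉ x (sym q))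
    injective′ (inj₂ x) (inj₁ y) q = ⊥-elim (v∉ y q)
    injective′ (inj₂ x) (inj₂ y) q = refl
    placeE : ∀ x y → E (join (tree t) u (tree •) tt) x y → Adj T (place′ x) (place′ y)
    placeE (inj₁ x) (inj₁ y) q          = place-E ι q
    placeE (inj₁ x) (inj₂ y) (refl , _) = e
    placeE (inj₂ x) (inj₁ y) (_ , refl) = adj-sym T e
    reflectE : ∀ x y → Adj T (place′ x) (place′ y) → E (join (tree t) u (tree •) tt) x y
    reflectE (inj₁ x) (inj₁ y) q = reflect-E ι q
    reflectE (inj₁ x) (inj₂ y) q = cycle ι v∉ (adj-sym T q) (adj-sym T e) , refl
    reflectE (inj₂ x) (inj₁ y) q = refl , cycle ι v∉ q (adj-sym T e)
    reflectE (inj₂ x) (inj₂ y) q = ⊥-elim (adj-irrefl T v q)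

  size≤ : ∀ {t} → Embedding (tree t) T → size t ℕ.≤ m
  size≤ {t} ι = Fin.injective⇒≤ {f = λ i → place ι (Inverse.from (index t) i)} λ {i} {j} e →
    trans (sym (Inverse.strictlyInverseˡ (index t) i))
      (trans (cong (Inverse.to (index t)) (injective ι e)) (Inverse.strictlyInverseˡ (index t) j))

  module _ (connected : Connected T) where

    InImage : ∀ {t} → Embedding (tree t) T → Fin m → Set
    InImage ι v = ∃ λ u → place ι u ≡ v

    inImage? : ∀ {t} (ι : Embedding (tree t) T) v → Dec (InImage ι v)
    inImage? {t} ι v = any? t λ u → place ι u Fin.≟ v

    -- The first edge of the walk that leaves the image supplies the next vertex to attach.
    crossing : ∀ {t} (ι : Embedding (tree t) T) {a v} → Star (Adj T) a v → InImage ι a →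
      ¬ InImage ι v → ∃₂ λ u w → Adj T (place ι u) w × ¬ InImage ι w
    crossing ι Star.ε             a∈          v∉ = ⊥-elim (v∉ a∈)
    crossing ι (Star._◅_ {j = y} e p) a∈@(u , q) v∉ with inImage? ι y
    ... | yes y∈ = crossing ι p y∈ v∉
    ... | no  y∉ = u , y , subst (λ z → Adj T z y) (sym q) e , y∉

    -- `k` bounds the number of vertices still missing; when it is 0, one more vertex would embed a
    -- tree with more than `m` vertices.
    grow : ∀ k {t} → Embedding (tree t) T → m ℕ.≤ size t ℕ.+ k → ∃ λ t → toGr T ≃ tree t
    grow k {t} ι m≤ with Fin.all? (inImage? ι)
    ... | yes onto = t , record
      { to = λ v → proj₁ (onto v)
      ; from = place ι
      ; to-from = λ x → injective ι (proj₂ (onto (place ι x)))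
      ; from-to = λ v → proj₂ (onto v)
      ; to-E = λ {u} {v} e → reflect-E ι
          (subst₂ (Adj T) (sym (proj₂ (onto u))) (sym (proj₂ (onto v))) e)
      ; from-E = place-E ι }
    ... | no ¬onto with Fin.¬∀⟶∃¬ m _ (inImage? ι) ¬onto
    ...   | v , v∉ with crossing ι (connected (place ι (root t)) v) (root t , refl) v∉
    ...     | u , w , e , w∉ = next k m≤
      where
      g = graftAt t u •
      ι′ : Embedding (tree (grafted g)) T
      ι′ = embedding-≃ (graft-iso g) (extend ι (λ z q → w∉ (z , sym q)) e)
      size-g : size (grafted g) ≡ suc (size t)
      size-g = trans (graft-size g) (ℕ.+-comm (size t) 1)
      next : ∀ k → m ℕ.≤ size t ℕ.+ k → ∃ λ t → toGr T ≃ tree t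
      next zero    m≤ = ⊥-elim (ℕ.<-irrefl refl (ℕ.≤-trans
        (ℕ.≤-trans (ℕ.≤-reflexive (sym size-g)) (size≤ ι′))
        (ℕ.≤-trans m≤ (ℕ.≤-reflexive (ℕ.+-identityʳ (size t))))))
      next (suc k) m≤ = grow k ι′ (ℕ.≤-trans m≤ (ℕ.≤-reflexive
        (trans (ℕ.+-suc (size t) k) (cong (ℕ._+ k) (sym size-g)))))

isTree⇒tree : ∀ {m} (T : Graph m) → IsTree T → ∃ λ t → toGr T ≃ tree t
isTree⇒tree {suc m} T isTree = grow acyclic connected (suc m) {•} record
  { place = λ _ → zero
  ; injective = λ _ → refl
  ; place-E = λ ()
  ; reflect-E = λ e → adj-irrefl T zero e } (ℕ.n≤1+n (suc m))
  where open IsTree isTree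

-- From rational points to the real line

module _ where
  open ℚBase using (_+_; _*_; _-_; -_; _<_; _≤_; ∣_∣)
  open ℚSolver.+-*-Solver using (solve; _:+_; _:*_; _:-_; :-_; _:=_; con)

  nat : ℕ → ℚ
  nat n = mkℚ (ℤ.+ n) 0 (Coprimality.sym (Coprimality.1-coprimeTo n))

  nat-suc : ∀ n → nat (suc n) ≡ 1ℚ + nat n
  nat-suc n = ℚ.toℚᵘ-injective (ℚᵘ.≃-sym (ℚᵘ.≃-trans (ℚ.toℚᵘ-homo-+ 1ℚ (nat n))
    (*≡* (cong (ℤ._* ℤ.1ℤ) (cong (λ z → ℤ.1ℤ ℤ.+ z) (ℤ.*-identityʳ (ℤ.+ n)))))))

  archimedean : ∀ p → ∃ λ n → p < nat n
  archimedean p@(mkℚ i d _) = suc ℤ.∣ i ∣ , *<* (ℤ.≤-<-trans (ℤ.≤-reflexive (ℤ.*-identityʳ i))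
    (ℤ.≤-<-trans (i≤∣i∣ i) (subst (ℤ._< (ℤ.+ suc ℤ.∣ i ∣) ℤ.* (ℤ.+ suc d)) refl
      (subst (ℤ.+ ℤ.∣ i ∣ ℤ.<_) (ℤ.pos-* (suc ℤ.∣ i ∣) (suc d))
        (ℤ.+<+ (ℕ.m≤m*n (suc ℤ.∣ i ∣) (suc d)))))))
    where
    i≤∣i∣ : ∀ i → i ℤ.≤ ℤ.+ ℤ.∣ i ∣
    i≤∣i∣ (ℤ.+ n)    = ℤ.≤-refl
    i≤∣i∣ ℤ.-[1+ n ] = ℤ.-≤+

  0<1 : 0ℚ < 1ℚ
  0<1 = ℚ.positive⁻¹ 1ℚ

  halving : ℕ → ℚ
  halving zero    = 1ℚ
  halving (suc n) = ½ * halving n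

  0<halving : ∀ n → 0ℚ < halving n
  0<halving zero    = 0<1
  0<halving (suc n) = 0<* (ℚ.positive⁻¹ ½) (0<halving n)

  nat*halving≤1 : ∀ n → nat n * halving n ≤ 1ℚ
  nat*halving≤1 zero    = ℚ.<⇒≤ 0<1
  nat*halving≤1 (suc n) = 0≤q-p⇒p≤q (subst (0ℚ ≤_) (sym eq)
    (0≤+ (0≤* (ℚ.<⇒≤ (ℚ.positive⁻¹ ½)) (p≤q⇒0≤q-p (nat*halving≤1 n)))
      (0≤* (ℚ.<⇒≤ (ℚ.positive⁻¹ ½)) (p≤q⇒0≤q-p (halving≤1 n)))))
    where
    halving≤1 : ∀ n → halving n ≤ 1ℚ
    halving≤1 zero    = ℚ.≤-refl
    halving≤1 (suc n) = 0≤q-p⇒p≤q (subst (0ℚ ≤_)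
      (solve 1 (λ h → con ½ :+ con ½ :* (con 1ℚ :- h) := con 1ℚ :- con ½ :* h) refl (halving n))
      (0≤+ (ℚ.<⇒≤ (ℚ.positive⁻¹ ½)) (0≤* (ℚ.<⇒≤ (ℚ.positive⁻¹ ½)) (p≤q⇒0≤q-p (halving≤1 n)))))
    eq : 1ℚ - nat (suc n) * (½ * halving n) ≡
      ½ * (1ℚ - nat n * halving n) + ½ * (1ℚ - halving n)
    eq = trans (cong (λ z → 1ℚ - z * (½ * halving n)) (nat-suc n))
      (solve 2 (λ k h → con 1ℚ :- (con 1ℚ :+ k) :* (con ½ :* h) :=
        con ½ :* (con 1ℚ :- k :* h) :+ con ½ :* (con 1ℚ :- h)) refl (nat n) (halving n))

  abstract
    inverse : ∀ p → 0ℚ < p → ∃ λ r → 0ℚ < r × r * p ≡ 1ℚ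
    inverse p 0<p = ℚ.1/ p , ℚ.positive⁻¹ (ℚ.1/ p) {{ℚ.1/pos⇒pos p}} , ℚ.*-inverseˡ p
      where
      instance
        p-pos : ℚ.Positive p
        p-pos = ℚ.positive 0<p
        p-nonZero : ℚ.NonZero p
        p-nonZero = ℚ.pos⇒nonZero p

  abstract
    -- Some n has C < ε n, and n ≤ 2ⁿ.
    halving-small : ∀ C ε → 0ℚ < ε → ∃ λ N → C * halving N < ε
    halving-small C ε 0<ε with inverse ε 0<ε
    ... | r , _ , rε with archimedean (C * r)
    ...   | n , lt = n , ℚ.<-≤-trans (ℚ.*-monoˡ-<-pos (halving n) {{ℚ.positive (0<halving n)}} C<)
        (0≤q-p⇒p≤q (subst (0ℚ ≤_)
          (solve 3 (λ e k h → e :* (con 1ℚ :- k :* h) := e :- (k :* e) :* h) refl ε (nat n) (halving n))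
          (0≤* (ℚ.<⇒≤ 0<ε) (p≤q⇒0≤q-p (nat*halving≤1 n)))))
      where
      C< : C < nat n * ε
      C< = subst (_< nat n * ε) (trans (ℚ.*-assoc C r ε) (trans (cong (C *_) rε) (ℚ.*-identityʳ C)))
        (ℚ.*-monoˡ-<-pos ε {{ℚ.positive 0<ε}} lt)

  abstract
    -- δ = ε / (1 + ε + K).
    small : ∀ K ε → 0ℚ ≤ K → 0ℚ < ε → ∃ λ δ → 0ℚ < δ × δ ≤ 1ℚ × K * δ < ε
    small K ε 0≤K 0<ε with inverse (1ℚ + ε + K) (0<+ (0<+ 0<1 (ℚ.<⇒≤ 0<ε)) 0≤K)
    ... | r , 0<r , rM = ε * r , 0<* 0<ε 0<r ,
      0≤q-p⇒p≤q (subst (0ℚ ≤_) eq₁ (ℚ.<⇒≤ (0<* 0<r (0<+ 0<1 0≤K)))) ,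
      0<q-p⇒p<q (subst (0ℚ <_) eq₂ (0<* 0<ε (0<* 0<r (0<+ 0<1 (ℚ.<⇒≤ 0<ε)))))
      where
      eq₁ : r * (1ℚ + K) ≡ 1ℚ - ε * r
      eq₁ = trans (solve 3 (λ r e k → r :* (con 1ℚ :+ k) := r :* (con 1ℚ :+ e :+ k) :- e :* r) refl r ε K)
        (cong (_- ε * r) rM)
      eq₂ : ε * (r * (1ℚ + ε)) ≡ ε - K * (ε * r)
      eq₂ = trans (solve 3 (λ r e k → e :* (r :* (con 1ℚ :+ e)) :=
          e :* (r :* (con 1ℚ :+ e :+ k)) :- k :* (e :* r)) refl r ε K)
        (cong (_- K * (ε * r)) (trans (cong (ε *_) rM) (ℚ.*-identityʳ ε)))

  -- Absolute values and Lipschitz bounds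

  ∣p∣≤q : ∀ {p q} → p ≤ q → - p ≤ q → ∣ p ∣ ≤ q
  ∣p∣≤q {p} {q} h h′ with ℚ.∣p∣≡p∨∣p∣≡-p p
  ... | inj₁ e = subst (_≤ q) (sym e) h
  ... | inj₂ e = subst (_≤ q) (sym e) h′

  p≤∣p∣ : ∀ p → p ≤ ∣ p ∣
  p≤∣p∣ p with ℚ.≤-total 0ℚ p
  ... | inj₁ h = ℚ.≤-reflexive (sym (ℚ.0≤p⇒∣p∣≡p h))
  ... | inj₂ h = ℚ.≤-trans h (ℚ.0≤∣p∣ p)

  ∣p-q∣≡∣q-p∣ : ∀ p q → ∣ p - q ∣ ≡ ∣ q - p ∣
  ∣p-q∣≡∣q-p∣ p q = trans (cong ∣_∣ (solve 2 (λ p q → p :- q := :- (q :- p)) refl p q))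
    (ℚ.∣-p∣≡∣p∣ (q - p))

  p-q≤r⇒p≤q+r : ∀ {p q r} → p - q ≤ r → p ≤ q + r
  p-q≤r⇒p≤q+r {p} {q} {r} h = subst (_≤ q + r)
    (solve 2 (λ p q → q :+ (p :- q) := p) refl p q) (ℚ.+-monoʳ-≤ q h)

  within : ∀ {l h x y} → l ≤ x → x ≤ h → l ≤ y → y ≤ h → ∣ x - y ∣ ≤ h - l
  within {x = x} {y} l≤x x≤h l≤y y≤h = ∣p∣≤q (ℚ.+-mono-≤ x≤h (ℚ.neg-antimono-≤ l≤y))
    (ℚ.≤-trans (ℚ.≤-reflexive (solve 2 (λ x y → :- (x :- y) := y :- x) refl x y))
      (ℚ.+-mono-≤ y≤h (ℚ.neg-antimono-≤ l≤x)))

  -- Continuity with explicit constants on `∣ a ∣ ≤ B`; `bound` is carried along for the product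
  -- rule.
  record Lipschitz (B : ℚ) (f : ℚ → ℚ) : Set where
    field
      bound     : ℚ
      0≤bound   : 0ℚ ≤ bound
      const     : ℚ
      0≤const   : 0ℚ ≤ const
      bounded   : ∀ {a} → ∣ a ∣ ≤ B → ∣ f a ∣ ≤ bound
      lipschitz : ∀ {a b} → ∣ a ∣ ≤ B → ∣ b ∣ ≤ B → ∣ f a - f b ∣ ≤ const * ∣ a - b ∣

  open Lipschitz public

  module _ {B : ℚ} where

    lip-affine : 0ℚ ≤ B → ∀ k s → Lipschitz B (λ q → k + s * q)
    lip-affine 0≤B k s = record
      { bound = ∣ k ∣ + ∣ s ∣ * B
      ; 0≤bound = 0≤+ (ℚ.0≤∣p∣ k) (0≤* (ℚ.0≤∣p∣ s) 0≤B)
      ; const = ∣ s ∣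
      ; 0≤const = ℚ.0≤∣p∣ s
      ; bounded = λ {a} a≤B → ℚ.≤-trans (ℚ.∣p+q∣≤∣p∣+∣q∣ k (s * a)) (ℚ.+-monoʳ-≤ ∣ k ∣
          (ℚ.≤-trans (ℚ.≤-reflexive (ℚ.∣p*q∣≡∣p∣*∣q∣ s a))
            (ℚ.*-monoˡ-≤-nonNeg ∣ s ∣ {{ℚ.∣-∣-nonNeg s}} a≤B)))
      ; lipschitz = λ {a} {b} _ _ → ℚ.≤-reflexive (trans
          (cong ∣_∣ (solve 4 (λ k s a b → (k :+ s :* a) :- (k :+ s :* b) := s :* (a :- b)) refl k s a b))
          (ℚ.∣p*q∣≡∣p∣*∣q∣ s (a - b))) }

    lip-- : ∀ {f g} → Lipschitz B f → Lipschitz B g → Lipschitz B (λ q → f q - g q)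
    lip-- {f} {g} F G = record
      { bound = bound F + bound G
      ; 0≤bound = 0≤+ (0≤bound F) (0≤bound G)
      ; const = const F + const G
      ; 0≤const = 0≤+ (0≤const F) (0≤const G)
      ; bounded = λ {a} h → ℚ.≤-trans (ℚ.∣p-q∣≤∣p∣+∣q∣ (f a) (g a))
          (ℚ.+-mono-≤ (bounded F h) (bounded G h))
      ; lipschitz = λ {a} {b} h k → ℚ.≤-trans (ℚ.≤-reflexive (cong ∣_∣
            (solve 4 (λ x y z w → (x :- y) :- (z :- w) := (x :- z) :- (y :- w)) refl
              (f a) (g a) (f b) (g b))))
          (ℚ.≤-trans (ℚ.∣p-q∣≤∣p∣+∣q∣ (f a - f b) (g a - g b))
            (ℚ.≤-trans (ℚ.+-mono-≤ (lipschitz F h k) (lipschitz G h k))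
              (ℚ.≤-reflexive (sym (ℚ.*-distribʳ-+ ∣ a - b ∣ (const F) (const G)))))) }

    lip-* : ∀ {f g} → Lipschitz B f → Lipschitz B g → Lipschitz B (λ q → f q * g q)
    lip-* {f} {g} F G = record
      { bound = bound F * bound G
      ; 0≤bound = 0≤* (0≤bound F) (0≤bound G)
      ; const = bound F * const G + bound G * const F
      ; 0≤const = 0≤+ (0≤* (0≤bound F) (0≤const G)) (0≤* (0≤bound G) (0≤const F))
      ; bounded = λ {a} h → ℚ.≤-trans (ℚ.≤-reflexive (ℚ.∣p*q∣≡∣p∣*∣q∣ (f a) (g a)))
          (*-mono-≤ (ℚ.0≤∣p∣ (f a)) (0≤bound G) (bounded F h) (bounded G h))
      ; lipschitz = λ {a} {b} h k → ℚ.≤-trans (ℚ.≤-reflexive (cong ∣_∣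
            (solve 4 (λ x y z w → x :* y :- z :* w := x :* (y :- w) :+ w :* (x :- z)) refl
              (f a) (g a) (f b) (g b))))
          (ℚ.≤-trans (ℚ.∣p+q∣≤∣p∣+∣q∣ (f a * (g a - g b)) (g b * (f a - f b)))
          (ℚ.≤-trans (ℚ.+-mono-≤ (product (bounded F h) (0≤bound F) (lipschitz G h k) (0≤const G))
                                 (product (bounded G k) (0≤bound G) (lipschitz F h k) (0≤const F)))
            (ℚ.≤-reflexive (solve 5 (λ m c n d e → m :* (c :* e) :+ n :* (d :* e) := (m :* c :+ n :* d) :* e)
              refl (bound F) (const G) (bound G) (const F) (∣ a - b ∣))))) }
      where
      product : ∀ {x y m c e} → ∣ x ∣ ≤ m → 0ℚ ≤ m → ∣ y ∣ ≤ c * ∣ e ∣ → 0ℚ ≤ c →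
        ∣ x * y ∣ ≤ m * (c * ∣ e ∣)
      product {x} {y} {e = e} h _ k 0≤c = ℚ.≤-trans (ℚ.≤-reflexive (ℚ.∣p*q∣≡∣p∣*∣q∣ x y))
        (*-mono-≤ (ℚ.0≤∣p∣ x) (0≤* 0≤c (ℚ.0≤∣p∣ e)) h k)

    lip-≗ : ∀ {f g} → (∀ q → f q ≡ g q) → Lipschitz B f → Lipschitz B g
    lip-≗ e F = record
      { bound = bound F ; 0≤bound = 0≤bound F ; const = const F ; 0≤const = 0≤const F
      ; bounded = λ {a} h → subst (λ z → ∣ z ∣ ≤ bound F) (e a) (bounded F h)
      ; lipschitz = λ {a} {b} h k →
          subst₂ (λ z w → ∣ z - w ∣ ≤ const F * ∣ a - b ∣) (e a) (e b) (lipschitz F h k) }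

-- The good region and its boundary

module _ where
  open ℚBase using (_+_; _*_; _-_; -_; _<_; _≤_; ∣_∣)
  open ℚSolver.+-*-Solver using (solve; _:+_; _:*_; _:-_; :-_; _:=_; con)

  -- Decidability at rational points steers the bisection and permits proofs of goodness by
  -- contradiction.
  good? : ∀ q t → Dec (At.Good q t)
  good? q •       = 0ℚ ℚ.<? At.A q •
  good? q (t ⊳ s) = good? q t ×-dec (good? q s ×-dec (0ℚ ℚ.<? At.A q (t ⊳ s)))

  N-at-0 : ∀ t → At.N 0ℚ t ≡ 1ℚ
  D-at-0 : ∀ t → At.D 0ℚ t ≡ 0ℚ
  N-at-0 •       = refl
  N-at-0 (t ⊳ s) = trans (cong₂ _*_ (N-at-0 t) (cong₂ _-_ (N-at-0 s) (D-at-0 s))) refl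
  D-at-0 •       = refl
  D-at-0 (t ⊳ s) = trans (cong₂ _*_ (D-at-0 t) (N-at-0 s)) refl

  A-at-0 : ∀ t → At.A 0ℚ t ≡ 1ℚ
  A-at-0 t = trans (cong₂ _-_ (N-at-0 t) (D-at-0 t)) refl

  good-at-0 : ∀ t → At.Good 0ℚ t
  0<A-at-0 : ∀ t → 0ℚ < At.A 0ℚ t
  0<A-at-0 t = subst (0ℚ <_) (sym (A-at-0 t)) 0<1
  good-at-0 •       = 0<A-at-0 •
  good-at-0 (t ⊳ s) = good-at-0 t , good-at-0 s , 0<A-at-0 (t ⊳ s)

  module _ {q} (q≤0 : q ≤ 0ℚ) where
    open At q

    0≤-q : 0ℚ ≤ - q
    0≤-q = ℚ.neg-antimono-≤ q≤0

    Good⇒0<1+q : ∀ t → Good t → 0ℚ < 1ℚ + q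
    Good⇒0<1+q t g = subst (0ℚ <_) (solve 1 (λ x → (con 1ℚ :+ x :- :- x) :+ :- x := con 1ℚ :+ x) refl q)
      (0<+ (Good⇒Good• t g) 0≤-q)

    -- `A •` is `1 + 2 q`, at most 1, and by `A-join` with nonnegative `D` a join has at most the
    -- product of the values of its parts.
    A≤1 : ∀ t → Good t → A t ≤ 1ℚ
    A-⊳≤* : ∀ t s → Good t → Good s → A (t ⊳ s) ≤ A t * A s
    A-⊳≤* t s g h = 0≤q-p⇒p≤q (subst (0ℚ ≤_) (sym eq)
      (0≤* (D-nonNegative 0<1+q 0≤-q t g) (D-nonNegative 0<1+q 0≤-q s h)))
      where
      0<1+q = Good⇒0<1+q t g
      eq : A t * A s - A (t ⊳ s) ≡ D t * D s
      eq = trans (cong (λ z → A t * A s - z) (A-join t s))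
          (solve 2 (λ x y → x :- (x :- y) := y) refl (A t * A s) (D t * D s))
    A≤1 •       g = 0≤q-p⇒p≤q (subst (0ℚ ≤_)
      (solve 1 (λ x → :- x :+ :- x := con 1ℚ :- (con 1ℚ :+ x :- :- x)) refl q) (0≤+ 0≤-q 0≤-q))
    A≤1 (t ⊳ s) (g , h , _) = ℚ.≤-trans (A-⊳≤* t s g h) (ℚ.≤-trans
      (*-mono-≤ (ℚ.<⇒≤ (Good⇒0<A t g)) (ℚ.<⇒≤ 0<1) (A≤1 t g) (A≤1 s h))
      (ℚ.≤-reflexive (ℚ.*-identityˡ 1ℚ)))

    A-⊳≤ˡ : ∀ t s → Good t → Good s → A (t ⊳ s) ≤ A t
    A-⊳≤ˡ t s g h = ℚ.≤-trans (A-⊳≤* t s g h) (ℚ.≤-trans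
      (*-mono-≤ (ℚ.<⇒≤ (Good⇒0<A t g)) (ℚ.<⇒≤ 0<1) ℚ.≤-refl (A≤1 s h))
      (ℚ.≤-reflexive (ℚ.*-identityʳ (A t))))

    A-⊳≤ʳ : ∀ t s → Good t → Good s → A (t ⊳ s) ≤ A s
    A-⊳≤ʳ t s g h = subst (_≤ A s) (A-comm s t) (A-⊳≤ˡ s t h g)

  module _ {B : ℚ} (0≤B : 0ℚ ≤ B) where

    lip-N : ∀ t → Lipschitz B (λ q → At.N q t)
    lip-D : ∀ t → Lipschitz B (λ q → At.D q t)
    lip-N •       = lip-≗ (λ q → cong (1ℚ +_) (ℚ.*-identityˡ q)) (lip-affine 0≤B 1ℚ 1ℚ)
    lip-N (t ⊳ s) = lip-* (lip-N t) (lip-- (lip-N s) (lip-D s))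
    lip-D •       = lip-≗ (λ q → solve 1 (λ q → con 0ℚ :+ :- con 1ℚ :* q := :- q) refl q)
                      (lip-affine 0≤B 0ℚ (- 1ℚ))
    lip-D (t ⊳ s) = lip-* (lip-D t) (lip-N s)

    lip-A : ∀ t → Lipschitz B (λ q → At.A q t)
    lip-A t = lip-- (lip-N t) (lip-D t)

    private
      -- A value at most 0 at `b` puts the value at `a` below the difference of the two.
      at-top : ∀ t {a b} → ∣ a ∣ ≤ B → ∣ b ∣ ≤ B → ¬ 0ℚ < At.A b t →
        At.A a t ≤ const (lip-A t) * ∣ a - b ∣
      at-top t {a} {b} a≤B b≤B ¬0<A = ℚ.≤-trans
        (0≤q-p⇒p≤q (subst (0ℚ ≤_) (solve 2 (λ x y → :- y := (x :- y) :- x) refl (At.A a t) (At.A b t))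
          (ℚ.neg-antimono-≤ (ℚ.≮⇒≥ ¬0<A))))
        (ℚ.≤-trans (p≤∣p∣ _) (lipschitz (lip-A t) a≤B b≤B))

      widen : ∀ K K′ e → K ≤ K′ → K * ∣ e ∣ ≤ K′ * ∣ e ∣
      widen K K′ e = ℚ.*-monoʳ-≤-nonNeg ∣ e ∣ {{ℚ.∣-∣-nonNeg e}}

    abstract
      -- The boundary of the good region consists of zeros of A.
      boundary : ∀ t → ∃ λ K → 0ℚ ≤ K × ∀ {a b} → a ≤ 0ℚ → ∣ a ∣ ≤ B → ∣ b ∣ ≤ B →
        At.Good a t → ¬ At.Good b t → At.A a t ≤ K * ∣ a - b ∣
      boundary •       =
        const (lip-A •) , 0≤const (lip-A •) , λ _ a≤B b≤B _ ¬g → at-top • a≤B b≤B ¬g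
      boundary (t ⊳ s) with boundary t | boundary s
      ... | K , 0≤K , h | K′ , 0≤K′ , h′ = K + K′ + L , 0≤+ (0≤+ 0≤K 0≤K′) 0≤L , bound′
        where
        L : ℚ
        L = const (lip-A (t ⊳ s))
        0≤L : 0ℚ ≤ L
        0≤L = 0≤const (lip-A (t ⊳ s))
        bound′ : ∀ {a b} → a ≤ 0ℚ → ∣ a ∣ ≤ B → ∣ b ∣ ≤ B →
          At.Good a (t ⊳ s) → ¬ At.Good b (t ⊳ s) → At.A a (t ⊳ s) ≤ (K + K′ + L) * ∣ a - b ∣
        bound′ {a} {b} a≤0 a≤B b≤B (gt , gs , _) ¬g with good? b t | good? b s
        -- A part that is bad at `b` has a small value at `a`, and the value of the whole tree at
        -- `a` is at most that.
        ... | no ¬gt | _ = ℚ.≤-trans (A-⊳≤ˡ a≤0 t s gt gs) (ℚ.≤-trans (h a≤0 a≤B b≤B gt ¬gt)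
                (widen K (K + K′ + L) (a - b) (0≤q-p⇒p≤q (subst (0ℚ ≤_)
                  (solve 3 (λ k l m → l :+ m := k :+ l :+ m :- k) refl K K′ L) (0≤+ 0≤K′ 0≤L)))))
        ... | yes _ | no ¬gs = ℚ.≤-trans (A-⊳≤ʳ a≤0 t s gt gs) (ℚ.≤-trans (h′ a≤0 a≤B b≤B gs ¬gs)
                (widen K′ (K + K′ + L) (a - b) (0≤q-p⇒p≤q (subst (0ℚ ≤_)
                  (solve 3 (λ k l m → k :+ m := k :+ l :+ m :- l) refl K K′ L) (0≤+ 0≤K 0≤L)))))
        ... | yes gt′ | yes gs′ = ℚ.≤-trans (at-top (t ⊳ s) a≤B b≤B (λ p → ¬g (gt′ , gs′ , p)))
                (widen L (K + K′ + L) (a - b) (0≤q-p⇒p≤q (subst (0ℚ ≤_)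
                  (solve 3 (λ k l m → k :+ l := k :+ l :+ m :- m) refl K K′ L) (0≤+ 0≤K 0≤K′))))

  -- At 0 every `A` is 1, so by `boundary` a bad point at distance `δ` would give `1 ≤ K δ`, against
  -- the choice of `δ`.
  good-near-0 : ∀ t → ∃ λ q → q < 0ℚ × At.Good q t
  good-near-0 t = - δ , ℚ.neg-antimono-< 0<δ , decidable-stable (good? (- δ) t) contra
    where
    K = proj₁ (boundary (ℚ.<⇒≤ 0<1) t)
    h = proj₂ (proj₂ (boundary (ℚ.<⇒≤ 0<1) t))
    smallδ : ∃ λ δ → 0ℚ < δ × δ ≤ 1ℚ × K * δ < 1ℚ
    smallδ = small K 1ℚ (proj₁ (proj₂ (boundary (ℚ.<⇒≤ 0<1) t))) 0<1
    δ : ℚ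
    δ = proj₁ smallδ
    0<δ : 0ℚ < δ
    0<δ = proj₁ (proj₂ smallδ)
    δ≤1 : δ ≤ 1ℚ
    δ≤1 = proj₁ (proj₂ (proj₂ smallδ))
    Kδ<1 : K * δ < 1ℚ
    Kδ<1 = proj₂ (proj₂ (proj₂ smallδ))
    ∣-δ∣ : ∣ - δ ∣ ≡ δ
    ∣-δ∣ = trans (ℚ.∣-p∣≡∣p∣ δ) (ℚ.0≤p⇒∣p∣≡p (ℚ.<⇒≤ 0<δ))
    ∣0+δ∣ : ∣ 0ℚ - - δ ∣ ≡ δ
    ∣0+δ∣ = trans (cong ∣_∣ (solve 1 (λ d → con 0ℚ :- :- d := d) refl δ)) (ℚ.0≤p⇒∣p∣≡p (ℚ.<⇒≤ 0<δ))
    contra : ¬ ¬ At.Good (- δ) t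
    contra ¬g = ℚ.<-irrefl refl (ℚ.<-≤-trans Kδ<1 1≤Kδ)
      where
      A≤ : At.A 0ℚ t ≤ K * ∣ 0ℚ - - δ ∣
      A≤ = h ℚ.≤-refl (ℚ.<⇒≤ 0<1) (ℚ.≤-trans (ℚ.≤-reflexive ∣-δ∣) δ≤1) (good-at-0 t) ¬g
      1≤Kδ : 1ℚ ≤ K * δ
      1≤Kδ = ℚ.≤-trans (ℚ.≤-reflexive (sym (A-at-0 t)))
        (ℚ.≤-trans A≤ (ℚ.≤-reflexive (cong (K *_) ∣0+δ∣)))

  -- Bisection between a bad point and 0

  module Bisection (t : RTree) (z : ℚ) (z≤0 : z ≤ 0ℚ) (bad : ¬ At.Good z t) where

    record Bracket : Set where
      field
        lo hi  : ℚ
        z≤lo   : z ≤ lo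
        lo≤hi  : lo ≤ hi
        hi≤0   : hi ≤ 0ℚ
        badlo  : ¬ At.Good lo t
        goodhi : At.Good hi t

    open Bracket

    mid : Bracket → ℚ
    mid b = ½ * (lo b + hi b)

    private
      0≤half : ∀ b → 0ℚ ≤ ½ * (hi b - lo b)
      0≤half b = 0≤* (ℚ.<⇒≤ (ℚ.positive⁻¹ ½)) (p≤q⇒0≤q-p (lo≤hi b))

      lo≤mid : ∀ b → lo b ≤ mid b
      lo≤mid b = 0≤q-p⇒p≤q (subst (0ℚ ≤_)
        (solve 2 (λ l h → con ½ :* (h :- l) := con ½ :* (l :+ h) :- l) refl (lo b) (hi b)) (0≤half b))

      mid≤hi : ∀ b → mid b ≤ hi b
      mid≤hi b = 0≤q-p⇒p≤q (subst (0ℚ ≤_)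
        (solve 2 (λ l h → con ½ :* (h :- l) := h :- con ½ :* (l :+ h)) refl (lo b) (hi b)) (0≤half b))

    next : ∀ b → Dec (At.Good (mid b) t) → Bracket
    next b (yes g) = record
      { lo = lo b ; hi = mid b ; z≤lo = z≤lo b ; lo≤hi = lo≤mid b
      ; hi≤0 = ℚ.≤-trans (mid≤hi b) (hi≤0 b) ; badlo = badlo b ; goodhi = g }
    next b (no ¬g) = record
      { lo = mid b ; hi = hi b ; z≤lo = ℚ.≤-trans (z≤lo b) (lo≤mid b) ; lo≤hi = mid≤hi b
      ; hi≤0 = hi≤0 b ; badlo = ¬g ; goodhi = goodhi b }

    bracket : ℕ → Bracket
    bracket zero    = record
      { lo = z ; hi = 0ℚ ; z≤lo = ℚ.≤-refl ; lo≤hi = z≤0 ; hi≤0 = ℚ.≤-refl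
      ; badlo = bad ; goodhi = good-at-0 t }
    bracket (suc n) = next (bracket n) (good? (mid (bracket n)) t)

    width : ∀ n → hi (bracket n) - lo (bracket n) ≡ - z * halving n
    width zero    = trans (ℚ.+-identityˡ (- z)) (sym (ℚ.*-identityʳ (- z)))
    width (suc n) with good? (mid (bracket n)) t
    ... | yes _ = trans (solve 2 (λ l h → con ½ :* (l :+ h) :- l := con ½ :* (h :- l)) refl
            (lo (bracket n)) (hi (bracket n)))
          (trans (cong (½ *_) (width n)) (solve 2 (λ z h → con ½ :* (z :* h) := z :* (con ½ :* h)) refl (- z) (halving n)))
    ... | no _  = trans (solve 2 (λ l h → h :- con ½ :* (l :+ h) := con ½ :* (h :- l)) refl
            (lo (bracket n)) (hi (bracket n)))
          (trans (cong (½ *_) (width n)) (solve 2 (λ z h → con ½ :* (z :* h) := z :* (con ½ :* h)) refl (- z) (halving n)))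

    nested : ∀ {m n} → m ℕ.≤ n → lo (bracket m) ≤ lo (bracket n) × hi (bracket n) ≤ hi (bracket m)
    nested {m} {n} m≤n with ℕ.m≤n⇒m<n∨m≡n m≤n
    ... | inj₂ refl = ℚ.≤-refl , ℚ.≤-refl
    nested {m} {suc n} _ | inj₁ (s≤s m≤n) with nested m≤n | good? (mid (bracket n)) t
    ... | h , k | yes _ = h , ℚ.≤-trans (mid≤hi (bracket n)) k
    ... | h , k | no _  = ℚ.≤-trans h (lo≤mid (bracket n)) , k

    abstract
      widths-small : ∀ C ε → 0ℚ < ε → ∃ λ N → C * (hi (bracket N) - lo (bracket N)) < ε
      widths-small C ε 0<ε = N , subst (_< ε)
        (trans (ℚ.*-assoc C (- z) (halving N)) (cong (C *_) (sym (width N)))) lt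
        where
        N : ℕ
        N = proj₁ (halving-small (C * - z) ε 0<ε)
        lt : C * - z * halving N < ε
        lt = proj₂ (halving-small (C * - z) ε 0<ε)

    hi-close : ∀ {N m n} → N ℕ.≤ m → N ℕ.≤ n →
      ∣ hi (bracket m) - hi (bracket n) ∣ ≤ hi (bracket N) - lo (bracket N)
    hi-close {N} {m} {n} h k = within
      (ℚ.≤-trans (proj₁ (nested h)) (lo≤hi (bracket m))) (proj₂ (nested h))
      (ℚ.≤-trans (proj₁ (nested k)) (lo≤hi (bracket n))) (proj₂ (nested k))

    -- The good ends are taken because `A` is positive there, so the upper estimate from `boundary`
    -- already bounds its absolute value.
    limit : ℝ
    limit = mkℝ (λ n → hi (bracket n)) cauchy′
      where
      cauchy′ : IsCauchy (λ n → hi (bracket n))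
      cauchy′ ε 0<ε with widths-small 1ℚ ε 0<ε
      ... | N , lt = N , λ m n h k → ℚ.≤-<-trans (hi-close h k) (subst (_< ε) (ℚ.*-identityˡ _) lt)

    z≤limit : ∀ n → z ≤ seq limit n
    z≤limit n = ℚ.≤-trans (z≤lo (bracket n)) (lo≤hi (bracket n))

    A-limit : ∀ ε → 0ℚ < ε → ∃ λ N → ∀ n → N ℕ.≤ n → ∣ At.A (seq limit n) t ∣ < ε
    A-limit ε 0<ε with boundary {B = - z} (ℚ.neg-antimono-≤ z≤0) t
    ... | K , 0≤K , h with widths-small K ε 0<ε
    ...   | N , lt = N , λ n N≤n → ℚ.≤-<-trans (bound′ n N≤n) lt
      where
      in-range : ∀ {a} → z ≤ a → a ≤ 0ℚ → ∣ a ∣ ≤ - z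
      in-range z≤a a≤0 = ∣p∣≤q (ℚ.≤-trans a≤0 (ℚ.neg-antimono-≤ z≤0)) (ℚ.neg-antimono-≤ z≤a)
      bound′ : ∀ n → N ℕ.≤ n → ∣ At.A (hi (bracket n)) t ∣ ≤ K * (hi (bracket N) - lo (bracket N))
      bound′ n N≤n = ℚ.≤-trans
        (ℚ.≤-reflexive (ℚ.0≤p⇒∣p∣≡p (ℚ.<⇒≤ (At.Good⇒0<A (hi b) t (goodhi b)))))
        (ℚ.≤-trans (h (hi≤0 b) (in-range (z≤limit n) (hi≤0 b))
            (in-range (z≤lo b) (ℚ.≤-trans (lo≤hi b) (hi≤0 b))) (goodhi b) (badlo b))
          (ℚ.*-monoˡ-≤-nonNeg K {{ℚ.nonNegative 0≤K}}
            (within (ℚ.≤-trans (proj₁ (nested N≤n)) (lo≤hi b)) (proj₂ (nested N≤n))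
              (proj₁ (nested N≤n)) (ℚ.≤-trans (lo≤hi b) (proj₂ (nested N≤n))))))
        where b = bracket n

  -- One third of `δ` covers the distance from `seq x k` to `a`; the other two are the margins
  -- `η + η` in `good-above-ξ`.
  ⅓ : ℚ
  ⅓ = ℤ.+ 1 ℚ./ 3

  -- Transfer of the inequalities to real points

  seq-I-pendant : ∀ {m} (G : Graph m) t → toGr G ≃ tree (pendant t) → ∀ x n →
    seq (I G x) n ≡ At.A (seq x n) t
  seq-I-pendant G t f x n = trans (seq-I G x n) (evalℚ-pendant (seq x n) G f)

  zero⇒root : ∀ {m} (G : Graph m) t → toGr G ≃ tree (pendant t) → ∀ y →
    (∀ ε → 0ℚ < ε → ∃ λ N → ∀ n → N ℕ.≤ n → ∣ At.A (seq y n) t ∣ < ε) → Root G y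
  zero⇒root G t f y h ε 0<ε = proj₁ (h ε 0<ε) , λ n N≤n →
    subst (λ v → ∣ v ∣ < ε)
      (trans (sym (seq-I-pendant G t f y n)) (sym (ℚ.+-identityʳ (seq (I G y) n))))
      (proj₂ (h ε 0<ε) n N≤n)

  -- If z > ξ(G) were not good, bisection would produce a root of I(G,·) above ξ(G).
  good-above-ξ : ∀ {m} (G : Graph m) t → toGr G ≃ tree (pendant t) → ∀ ξ → IsLargestRoot G ξ →
    ∀ x → ξ ≤ᵣ x → ∀ η z → 0ℚ < η → z ≤ 0ℚ →
    (∃ λ N → ∀ k → N ℕ.≤ k → seq x k + η + η < z) → At.Good z t
  good-above-ξ G t f ξ (_ , largest) x ξ≤x η z 0<η z≤0 (N₀ , x<z) =
    decidable-stable (good? z t) λ bad → contra bad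
    where
    contra : ¬ At.Good z t → ⊥
    -- At index `k`, with `y` the limit of the bisection: `z ≤ y < ξ + η < x + η + η < z`.
    contra bad = ℚ.<-irrefl refl (ℚ.<-trans (ℚ.≤-<-trans (z≤limit k)
      (ℚ.<-trans (proj₂ y≤ξ k N₁≤k) (ℚ.+-monoˡ-< η (proj₂ (ξ≤x η 0<η) k N₂≤k)))) (x<z k N₀≤k))
      where
      open Bisection t z z≤0 bad
      y≤ξ = largest limit (zero⇒root G t f limit A-limit) η 0<η
      N₁ = proj₁ y≤ξ
      N₂ = proj₁ (ξ≤x η 0<η)
      k = N₀ ℕ.⊔ (N₁ ℕ.⊔ N₂)
      N₀≤k : N₀ ℕ.≤ k
      N₀≤k = ℕ.m≤m⊔n N₀ _
      N₁≤k : N₁ ℕ.≤ k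
      N₁≤k = ℕ.≤-trans (ℕ.m≤m⊔n N₁ N₂) (ℕ.m≤n⊔m N₀ _)
      N₂≤k : N₂ ℕ.≤ k
      N₂≤k = ℕ.≤-trans (ℕ.m≤n⊔m N₁ N₂) (ℕ.m≤n⊔m N₀ _)

  -- `x ≤ᵣ 0ᵣ` only makes the approximation `a` smaller than `δ`, so `a + δ` may be positive and is
  -- cut off at 0.
  clamp-close : ∀ a δ → 0ℚ < δ → a < 0ℚ + δ → ∣ (a + δ) ℚ.⊓ 0ℚ - a ∣ ≤ δ
  clamp-close a δ 0<δ a<δ with ℚ.≤-total (a + δ) 0ℚ
  ... | inj₁ p = subst (λ w → ∣ w - a ∣ ≤ δ) (sym (ℚ.p≤q⇒p⊓q≡p p)) (ℚ.≤-reflexive (trans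
        (cong ∣_∣ (solve 2 (λ a d → (a :+ d) :- a := d) refl a δ)) (ℚ.0≤p⇒∣p∣≡p (ℚ.<⇒≤ 0<δ))))
  ... | inj₂ p = subst (λ w → ∣ w - a ∣ ≤ δ) (sym (ℚ.p≥q⇒p⊓q≡q p)) (∣p∣≤q
        (0≤q-p⇒p≤q (subst (0ℚ ≤_) (solve 2 (λ a d → (a :+ d) :- con 0ℚ := d :- (con 0ℚ :- a)) refl a δ)
          (p≤q⇒0≤q-p p)))
        (ℚ.≤-trans (ℚ.≤-reflexive (solve 1 (λ a → :- (con 0ℚ :- a) := a) refl a))
          (ℚ.<⇒≤ (subst (a <_) (ℚ.+-identityˡ δ) a<δ))))

  ∣p∣≤∣q∣+r : ∀ p q {r} → ∣ p - q ∣ ≤ r → ∣ p ∣ ≤ ∣ q ∣ + r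
  ∣p∣≤∣q∣+r p q h = ℚ.≤-trans
    (ℚ.≤-reflexive (cong ∣_∣ (solve 2 (λ p q → p := q :+ (p :- q)) refl p q)))
    (ℚ.≤-trans (ℚ.∣p+q∣≤∣p∣+∣q∣ q (p - q)) (ℚ.+-monoʳ-≤ ∣ q ∣ h))

  -- The inequality known at `z` moves to `a` at the cost of both Lipschitz constants times `δ`.
  perturb : ∀ {B f f′ a z δ ε} (F : Lipschitz B f) (F′ : Lipschitz B f′) →
    ∣ a ∣ ≤ B → ∣ z ∣ ≤ B → ∣ z - a ∣ ≤ δ → (const F + const F′) * δ < ε → f z ≤ f′ z →
    f a < f′ a + ε
  perturb {B} {f} {f′} {a} {z} {δ} {ε} F F′ a≤B z≤B z-a≤δ Kδ<ε fz≤ =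
    ℚ.≤-<-trans (ℚ.≤-trans up (ℚ.≤-trans (ℚ.+-monoˡ-≤ (const F * δ) (ℚ.≤-trans fz≤ down))
        (ℚ.≤-reflexive (solve 4 (λ x k l d → x :+ l :* d :+ k :* d := x :+ (k :+ l) :* d) refl
          (f′ a) (const F) (const F′) δ))))
      (ℚ.+-monoʳ-< (f′ a) Kδ<ε)
    where
    step : ∀ {f} (L : Lipschitz B f) → ∣ f z - f a ∣ ≤ const L * δ
    step L = ℚ.≤-trans (lipschitz L z≤B a≤B)
      (ℚ.*-monoˡ-≤-nonNeg (const L) {{ℚ.nonNegative (0≤const L)}} z-a≤δ)
    up : f a ≤ f z + const F * δ
    up = p-q≤r⇒p≤q+r (ℚ.≤-trans (p≤∣p∣ (f a - f z))
      (subst (_≤ const F * δ) (∣p-q∣≡∣q-p∣ (f z) (f a)) (step F)))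
    down : f′ z ≤ f′ a + const F′ * δ
    down = p-q≤r⇒p≤q+r (ℚ.≤-trans (p≤∣p∣ (f′ z - f′ a)) (step F′))

  ⅓-gap : ∀ x a δ → x - a < ⅓ * δ → x + ⅓ * δ + ⅓ * δ < a + δ
  ⅓-gap x a δ h = 0<q-p⇒p<q (subst (0ℚ <_)
    (solve 3 (λ x a d → con ⅓ :* d :- (x :- a) := (a :+ d) :- (x :+ con ⅓ :* d :+ con ⅓ :* d)) refl x a δ)
    (p<q⇒0<q-p h))

  module _ {m n} (G : Graph m) (H : Graph n) g h
    (iG : toGr G ≃ tree (pendant g)) (iH : toGr H ≃ tree (pendant h))
    (A≤ : ∀ {q} → q < 0ℚ → At.Good q g → At.A q g ≤ At.A q h) where

    private
      -- Either `z` is negative and a definite margin to the right of `x`, hence good, or it is 0,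
      -- where both values are 1.
      A≤-clamp : ∀ ξ → IsLargestRoot G ξ → ∀ x → ξ ≤ᵣ x → ∀ a δ → 0ℚ < δ →
        (∃ λ N → ∀ k → N ℕ.≤ k → ∣ seq x k - a ∣ < ⅓ * δ) → ∀ z → z ≡ (a + δ) ℚ.⊓ 0ℚ →
        At.A z g ≤ At.A z h
      A≤-clamp ξ isξ x ξ≤x a δ 0<δ (N , close) z z≡ = cases (ℚ.≤-total (a + δ) 0ℚ) (ℚ.<-cmp z 0ℚ)
        where
        z≤0 : z ≤ 0ℚ
        z≤0 = subst (_≤ 0ℚ) (sym z≡) (ℚ.p⊓q≤q (a + δ) 0ℚ)
        at-0 : z ≡ 0ℚ → At.A z g ≤ At.A z h
        at-0 z≡0 = subst (λ w → At.A w g ≤ At.A w h) (sym z≡0)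
          (ℚ.≤-reflexive (trans (A-at-0 g) (sym (A-at-0 h))))
        below : a + δ ≤ 0ℚ → ∀ k → N ℕ.≤ k → seq x k + ⅓ * δ + ⅓ * δ < z
        below p k N≤k = subst (seq x k + ⅓ * δ + ⅓ * δ <_) (sym (trans z≡ (ℚ.p≤q⇒p⊓q≡p p)))
          (⅓-gap (seq x k) a δ (ℚ.≤-<-trans (p≤∣p∣ (seq x k - a)) (close k N≤k)))
        cases : a + δ ≤ 0ℚ ⊎ 0ℚ ≤ a + δ → Tri (z < 0ℚ) (z ≡ 0ℚ) (0ℚ < z) → At.A z g ≤ At.A z h
        cases (inj₂ p) _                = at-0 (trans z≡ (ℚ.p≥q⇒p⊓q≡q p))
        cases (inj₁ p) (tri≈ _ z≡0 _)   = at-0 z≡0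
        cases (inj₁ p) (tri> _ _ z>0)   = ⊥-elim (ℚ.<-irrefl refl (ℚ.<-≤-trans z>0 z≤0))
        cases (inj₁ p) (tri< z<0 _ _)   = A≤ z<0 (good-above-ξ G g iG ξ isξ x ξ≤x (⅓ * δ) z
          (0<* (ℚ.positive⁻¹ ⅓) 0<δ) z≤0 (N , below p))

      -- `B` leaves room for 1 beyond `∣ seq x k ∣` because the comparison point `z` may be `δ ≤ 1ℚ`
      -- away.
      eventually : ∀ ξ → IsLargestRoot G ξ → ∀ x → ξ ≤ᵣ x → x ≤ᵣ 0ᵣ → ∀ ε B N₁ →
        (∀ k → N₁ ℕ.≤ k → ∣ seq x k ∣ + 1ℚ ≤ B) →
        (F : Lipschitz B (λ q → At.A q g)) (F′ : Lipschitz B (λ q → At.A q h)) →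
        ∀ δ → 0ℚ < δ → δ ≤ 1ℚ → (const F + const F′) * δ < ε →
        ∃ λ N → ∀ k → N ℕ.≤ k → At.A (seq x k) g < At.A (seq x k) h + ε
      eventually ξ isξ x ξ≤x x≤0 ε B N₁ bounded F F′ δ 0<δ δ≤1 Kδ<ε = N , final
        where
        near : ∃ λ N → ∀ i j → N ℕ.≤ i → N ℕ.≤ j → ∣ seq x i - seq x j ∣ < ⅓ * δ
        near = cauchy x (⅓ * δ) (0<* (ℚ.positive⁻¹ ⅓) 0<δ)
        N₂ = proj₁ near
        N₃ = proj₁ (x≤0 δ 0<δ)
        N = N₁ ℕ.⊔ (N₂ ℕ.⊔ N₃)
        final : ∀ k → N ℕ.≤ k → At.A (seq x k) g < At.A (seq x k) h + ε
        final k N≤k = perturb F F′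
          (ℚ.≤-trans (subst (_≤ ∣ a ∣ + 1ℚ) (ℚ.+-identityʳ ∣ a ∣) (ℚ.+-monoʳ-≤ ∣ a ∣ (ℚ.<⇒≤ 0<1))) (bounded k N₁≤k))
          (ℚ.≤-trans (∣p∣≤∣q∣+r z a (ℚ.≤-trans z-a≤δ δ≤1)) (bounded k N₁≤k))
          z-a≤δ Kδ<ε
          (A≤-clamp ξ isξ x ξ≤x a δ 0<δ (N₂ , λ j N₂≤j → proj₂ near j k N₂≤j N₂≤k) z refl)
          where
          a = seq x k
          z = (a + δ) ℚ.⊓ 0ℚ
          N₁≤k : N₁ ℕ.≤ k
          N₁≤k = ℕ.≤-trans (ℕ.m≤m⊔n N₁ _) N≤k
          N₂≤k : N₂ ℕ.≤ k
          N₂≤k = ℕ.≤-trans (ℕ.m≤m⊔n N₂ N₃) (ℕ.≤-trans (ℕ.m≤n⊔m N₁ _) N≤k)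
          N₃≤k : N₃ ℕ.≤ k
          N₃≤k = ℕ.≤-trans (ℕ.m≤n⊔m N₂ N₃) (ℕ.≤-trans (ℕ.m≤n⊔m N₁ _) N≤k)
          z-a≤δ : ∣ z - a ∣ ≤ δ
          z-a≤δ = clamp-close a δ 0<δ (proj₂ (x≤0 δ 0<δ) k N₃≤k)

      eventually-bounded : ∀ (x : ℝ) → ∃ λ B → 0ℚ ≤ B × ∃ λ N → ∀ k → N ℕ.≤ k → ∣ seq x k ∣ + 1ℚ ≤ B
      eventually-bounded x = ∣ seq x N ∣ + 1ℚ + 1ℚ ,
        0≤+ (0≤+ (ℚ.0≤∣p∣ (seq x N)) (ℚ.<⇒≤ 0<1)) (ℚ.<⇒≤ 0<1) , N ,
        λ k N≤k → ℚ.+-monoˡ-≤ 1ℚ (∣p∣≤∣q∣+r (seq x k) (seq x N)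
          (ℚ.<⇒≤ (proj₂ (cauchy x 1ℚ 0<1) k N N≤k ℕ.≤-refl)))
        where N = proj₁ (cauchy x 1ℚ 0<1)

      from-eventually : ∀ x ε → (∃ λ N → ∀ k → N ℕ.≤ k → At.A (seq x k) g < At.A (seq x k) h + ε) →
        ∃ λ N → ∀ k → N ℕ.≤ k → seq (I G x) k < seq (I H x) k + ε
      from-eventually x ε (N , lt) = N , λ k N≤k → subst₂ (λ u v → u < v + ε)
        (sym (seq-I-pendant G g iG x k)) (sym (seq-I-pendant H h iH x k)) (lt k N≤k)

    ⪯-from-good : H ⪯ G
    ⪯-from-good ξ isξ x ξ≤x x≤0 ε 0<ε = from-eventually x ε (onBound (eventually-bounded x))
      where
      onBound : (∃ λ B → 0ℚ ≤ B × ∃ λ N → ∀ k → N ℕ.≤ k → ∣ seq x k ∣ + 1ℚ ≤ B) →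
        ∃ λ N → ∀ k → N ℕ.≤ k → At.A (seq x k) g < At.A (seq x k) h + ε
      onBound (B , 0≤B , N₁ , bd) = choose (small (const F + const F′) ε (0≤+ (0≤const F) (0≤const F′)) 0<ε)
        where
        F = lip-A 0≤B g
        F′ = lip-A 0≤B h
        choose : (∃ λ δ → 0ℚ < δ × δ ≤ 1ℚ × (const F + const F′) * δ < ε) →
          ∃ λ N → ∀ k → N ℕ.≤ k → At.A (seq x k) g < At.A (seq x k) h + ε
        choose (δ , 0<δ , δ≤1 , Kδ<ε) =
          eventually ξ isξ x ξ≤x x≤0 ε B N₁ bd F F′ δ 0<δ δ≤1 Kδ<ε

-- From cores back to the given graphs

open import Data.Nat.Base using (_*_)

size-unique : ∀ {m} (T : Graph m) t → toGr T ≃ tree t → m ≡ size t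
size-unique T t f = ↔⇒≡ (index t ↔-∘ ≃⇒↔ f)

size-pendant : ∀ t → size (pendant t) ≡ 2 * size t
size-pendant •       = refl
size-pendant (t ⊳ s) = trans (cong₂ ℕ._+_ (size-pendant t) (size-pendant s))
  (sym (ℕ.*-distribˡ-+ 2 (size t) (size s)))

-- An even order excludes `•`, which is well-covered but not a graph star.
2*n≢1 : ∀ n → 2 * n ≢ 1
2*n≢1 (suc n) e with ℕ.suc-injective e
... | e′ rewrite ℕ.+-suc n (n ℕ.+ 0) with () ← e′

samePolynomial⇒evalℚ : ∀ {m n} {G : Graph m} {H : Graph n} → m ≡ n → SamePolynomial G H →
  ∀ q → evalℚ G q ≡ evalℚ H q
samePolynomial⇒evalℚ {m} refl same q = ℚΣ.sum-cong-≗ {suc m} λ k →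
  cong (ℚSR._× (q ℚSR.^ toℕ k)) (same (toℕ k))

module _ {q} (q<0 : q ℚ.< 0ℚ) where
  open At q using (A; Good; module Positive)

  line-bound : ∀ t → Good t →
    A t ℚ.≤ A (line (edges t)) × (A t ℚ.< A (line (edges t)) ⊎ tree t ≃ tree (line (edges t)))
  line-bound t g = bound b , strict b
    where
    open Positive (Good⇒0<1+q (ℚ.<⇒≤ q<0) t g) (ℚ.neg-antimono-< q<0)
    b = pathBound (edges t) t refl g

  claw-bound : ∀ t → Good (claw (edges t)) →
    A (claw (edges t)) ℚ.≤ A t × (A (claw (edges t)) ℚ.< A t ⊎ tree (claw (edges t)) ≃ tree t)
  claw-bound t g = star-bound b , ⊎.map₂ ≃-sym (star-strict b)
    where
    open Positive (Good⇒0<1+q (ℚ.<⇒≤ q<0) (claw (edges t)) g) (ℚ.neg-antimono-< q<0)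
    b = starBound (edges t) g t ℕ.≤-refl

≢-polynomial : ∀ {m n} (G : Graph m) (H : Graph n) g h →
  toGr G ≃ tree (pendant g) → toGr H ≃ tree (pendant h) → m ≡ n → ∀ q →
  At.A q g ℚ.< At.A q h → ¬ SamePolynomial G H
≢-polynomial G H g h iG iH m≡n q lt same = ℚ.<-irrefl (trans (sym (evalℚ-pendant q G iG))
  (trans (samePolynomial⇒evalℚ {G = G} {H} m≡n same q) (evalℚ-pendant q H iH))) lt

-- Goodness is available for `g` because `H ≺ G` refers to the largest root of `G`, the graph with
-- the smaller values.
≺-from-good : ∀ {m n} (G : Graph m) (H : Graph n) g h →
  toGr G ≃ tree (pendant g) → toGr H ≃ tree (pendant h) → m ≡ n →
  (∀ {q} → q ℚ.< 0ℚ → At.Good q g →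
    At.A q g ℚ.≤ At.A q h × (At.A q g ℚ.< At.A q h ⊎ tree g ≃ tree h)) →
  ¬ (tree g ≃ tree h) → H ≺ G
≺-from-good G H g h iG iH m≡n bounds g≄h =
  ⪯-from-good G H g h iG iH (λ q<0 good → proj₁ (bounds q<0 good)) , differ (good-near-0 g)
  where
  differ : (∃ λ q → q ℚ.< 0ℚ × At.Good q g) → ¬ SamePolynomial H G
  differ (q , q<0 , good) same = ⊎.[
    (λ lt → ≢-polynomial G H g h iG iH m≡n q lt λ k → sym (same k)) ,
    g≄h ] (proj₂ (bounds q<0 good))

path⋆≃ : ∀ n e → n ≡ suc e → toGr ((path n) ⋆) ≃ tree (pendant (line e))
path⋆≃ _ e refl = G≃t⇒⋆≃pendant (path (suc e)) (path≃line e)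

star⋆≃ : ∀ n e → n ≡ suc e → toGr ((star n) ⋆) ≃ tree (pendant (claw e))
star⋆≃ _ e refl = G≃t⇒⋆≃pendant (star (suc e)) (star≃claw e)

2*n≡n+n : ∀ n → 2 * n ≡ n ℕ.+ n
2*n≡n+n n = cong (n ℕ.+_) (ℕ.+-identityʳ n)

wellCovered⇒pendant : ∀ n (T : Graph (2 * n)) → IsTree T → WellCovered T →
  ∃ λ g → toGr T ≃ tree (pendant g)
wellCovered⇒pendant n T isTree wc with isTree⇒tree T isTree
... | t , f with uniformlyCovered⇒pendant t (λ { refl → 2*n≢1 n (size-unique T • f) })
                   (wellCovered⇒uniform {T = T} f wc)
...   | g , i = g , ≃-trans f i

≃pendant⇒n≡1+edges : ∀ n g (T : Graph (2 * n)) → toGr T ≃ tree (pendant g) → n ≡ suc (edges g)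
≃pendant⇒n≡1+edges n g T f = trans
  (ℕ.*-cancelˡ-≡ n (size g) 2 (trans (size-unique T (pendant g) f) (size-pendant g))) (size≡1+edges g)

corollary3p7 : ∀ (n : ℕ) (T : Graph (2 * n)) → IsTree T → WellCovered T →
    ¬ (T ≅ (path n) ⋆) → ¬ (T ≅ (star n) ⋆) →
    ((path n) ⋆ ≺ T) × (T ≺ (star n) ⋆)
corollary3p7 n T isTree wc T≇P T≇S =
  ≺-from-good T (path n ⋆) g (line e) f fP (2*n≡n+n n) (λ q<0 → line-bound q<0 g)
    (λ i → T≇P (≅⋆ (path n ⋆) fP i)) ,
  ≺-from-good (star n ⋆) T (claw e) g fS f (sym (2*n≡n+n n)) (λ q<0 → claw-bound q<0 g)
    (λ i → T≇S (≅⋆ (star n ⋆) fS (≃-sym i)))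
  where
  g = proj₁ (wellCovered⇒pendant n T isTree wc)
  f = proj₂ (wellCovered⇒pendant n T isTree wc)
  e = edges g
  n≡1+e : n ≡ suc e
  n≡1+e = ≃pendant⇒n≡1+edges n g T f
  fP = path⋆≃ n e n≡1+e
  fS = star⋆≃ n e n≡1+e
  -- An isomorphism of the cores would extend to the graph stars, against the hypotheses on `T`.
  ≅⋆ : ∀ {m} (G : Graph m) {h} → toGr G ≃ tree (pendant h) → tree g ≃ tree h → T ≅ G
  ≅⋆ G j i = ≃⇒≅ {G = T} {G} (≃-trans f (≃-trans (pendant-cong i) (≃-sym j)))
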